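{- Let $q$ be a prime power and $G=\langle x,y\mid x^n=1,\ y^2=1,\ xy=yx^s\rangle$, where $s$ is a positive integer with $s^2\equiv1\pmod n$ and $\gcd(2n,q)=1$; let $d=\gcd(n,s-1)$. Let $f(x)$ be an $s$-self-involutive monic irreducible factor of $\frac{x^n-1}{x^d-1}$ in $\mathbb F_q[x]$, and let $\ell(x)\in\mathbb F_q[x]$ satisfy $(x^{s-1}-1)\ell(x)\equiv1\pmod{f(x)}$. Then $$e_{f,1}=-\frac1n((f^*)')^*(x)\cdot\frac{x^n-1}{f(x)}\cdot\bigl[\ell(x)(1-y)+1\bigr]\quad\text{and}\quad e_{f,2}=\frac1n((f^*)')^*(x)\cdot\frac{x^n-1}{f(x)}\cdot\ell(x)(1-y)$$ are non-central primitive idempotents of $\mathbb F_qG$.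
   Context: Polynomials in $x$ are viewed as elements of $\mathbb F_qG$ by substituting the group element $x$. $g^*(x)=x^{\deg g}g(1/x)$ denotes the reciprocal polynomial, $'$ the formal derivative, and the outer reciprocal of $(f^*)'$ is taken with respect to degree $\deg f-1$ (so that $-\frac1n((f^*)')^*\cdot\frac{x^n-1}{f}$ is the idempotent of $\mathbb F_q[x]/(x^n-1)$ congruent to $1$ mod $f$ and $0$ mod $(x^n-1)/f$). For a monic $g(x)=(x-a_1)\cdots(x-a_k)$ with $g(0)\ne0$ and $s^2\equiv1\pmod{\mathrm{ord}(g)}$ (where $\mathrm{ord}(g)$ is the least $N\ge1$ with $g\mid x^N-1$), $g^{*_s}(x)=(x-a_1^s)\cdots(x-a_k^s)$, and $g$ is $s$-self-involutive if $g$ and $g^{*_s}$ have the same roots. -}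

module Defs where

open import Level using (0ℓ)
open import Data.Nat as ℕ using (ℕ; zero; suc; NonZero)
open import Data.Nat.DivMod using (_mod_)
open import Data.Nat.Primality using (Prime)
open import Data.Fin as Fin using (Fin; toℕ)
open import Data.Fin.Properties using () renaming (_≟_ to _≟F_)
open import Data.Product using (_×_; _,_; ∃; proj₁; proj₂)
open import Data.Product.Properties using (≡-dec)
open import Data.Sum using (_⊎_)
open import Data.List using (List; []; _∷_; _++_; map; replicate; length; upTo)
open import Data.List.Membership.Propositional using (_∈_)
open import Data.Bool using (if_then_else_)
open import Relation.Nullary using (¬_; Dec; yes; no)
open import Relation.Nullary.Decidable using (⌊_⌋)
open import Relation.Binary.PropositionalEquality using (_≡_)
open import Function.Bundles using (_↔_)
open import Algebra.Structures using (IsCommutativeRing)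

IsPrimePower : ℕ → Set
IsPrimePower q = ∃ λ p → ∃ λ k → Prime p × 1 ℕ.≤ k × q ≡ p ℕ.^ k

record FiniteField : Set₁ where
  infixl 6 _+_
  infixl 7 _*_
  field
    Carrier : Set
    _+_ _*_ : Carrier → Carrier → Carrier
    -_      : Carrier → Carrier
    0# 1#   : Carrier
    isCommutativeRing : IsCommutativeRing _≡_ _+_ _*_ -_ 0# 1#
    0≢1     : ¬ (0# ≡ 1#)
    inverse : ∀ a → ¬ (a ≡ 0#) → ∃ λ b → a * b ≡ 1#
    _≟_     : (a b : Carrier) → Dec (a ≡ b)
    size    : ℕ
    enum    : Fin size ↔ Carrier

  fromℕ : ℕ → Carrier
  fromℕ zero    = 0#
  fromℕ (suc k) = 1# + fromℕ k

  _^_ : Carrier → ℕ → Carrier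
  a ^ zero  = 1#
  a ^ suc k = a * (a ^ k)

record IsFieldHom (F K : FiniteField) (ι : FiniteField.Carrier F → FiniteField.Carrier K) : Set where
  private
    module F = FiniteField F
    module K = FiniteField K
  field
    hom-+ : ∀ a b → ι (a F.+ b) ≡ ι a K.+ ι b
    hom-* : ∀ a b → ι (a F.* b) ≡ ι a K.* ι b
    hom-1 : ι F.1# ≡ K.1#

-- Polynomials over a field: coefficient lists, lowest degree first.
-- Trailing zeros are allowed; equality is coefficientwise (_≈ₚ_).

module Poly (F : FiniteField) where
  open FiniteField F

  Pol : Set
  Pol = List Carrier

  coeff : Pol → ℕ → Carrier
  coeff []      _       = 0#
  coeff (a ∷ p) zero    = a
  coeff (a ∷ p) (suc i) = coeff p i

  infix 4 _≈ₚ_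
  _≈ₚ_ : Pol → Pol → Set
  p ≈ₚ r = ∀ i → coeff p i ≡ coeff r i

  infixl 6 _+ₚ_ _-ₚ_
  infixl 7 _*ₚ_ _·ₚ_

  _+ₚ_ : Pol → Pol → Pol
  []      +ₚ r       = r
  (a ∷ p) +ₚ []      = a ∷ p
  (a ∷ p) +ₚ (b ∷ r) = (a + b) ∷ (p +ₚ r)

  _·ₚ_ : Carrier → Pol → Pol
  c ·ₚ p = map (c *_) p

  -ₚ_ : Pol → Pol
  -ₚ p = map -_ p

  _-ₚ_ : Pol → Pol → Pol
  p -ₚ r = p +ₚ (-ₚ r)

  _*ₚ_ : Pol → Pol → Pol
  []      *ₚ r = []
  (a ∷ p) *ₚ r = (a ·ₚ r) +ₚ (0# ∷ (p *ₚ r))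

  1ₚ : Pol
  1ₚ = 1# ∷ []

  X^ : ℕ → Pol
  X^ k = replicate k 0# ++ (1# ∷ [])

  normalize : Pol → Pol
  normalize [] = []
  normalize (a ∷ p) with normalize p
  ... | [] with a ≟ 0#
  ...   | yes _ = []
  ...   | no  _ = a ∷ []
  normalize (a ∷ p) | b ∷ r = a ∷ b ∷ r

  -- degree (with the convention deg 0 = 0)
  deg : Pol → ℕ
  deg p = length (normalize p) ℕ.∸ 1

  Monic : Pol → Set
  Monic p = coeff p (deg p) ≡ 1#

  -- irreducible: nonconstant, and any factorisation has a constant
  -- (= unit, since the product is nonzero) factor
  Irreducible : Pol → Set
  Irreducible f = 1 ℕ.≤ deg f ×
    (∀ a b → a *ₚ b ≈ₚ f → deg a ≡ 0 ⊎ deg b ≡ 0)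

  -- reciprocal with respect to degree k:  x^k p(1/x)
  rev : ℕ → Pol → Pol
  rev k p = map (λ i → coeff p (k ℕ.∸ i)) (upTo (suc k))

  _* : Pol → Pol
  p * = rev (deg p) p

  derivAux : ℕ → Pol → Pol
  derivAux k []      = []
  derivAux k (b ∷ p) = (fromℕ k * b) ∷ derivAux (suc k) p

  deriv : Pol → Pol
  deriv []      = []
  deriv (a ∷ p) = derivAux 1 p

  linProd : List Carrier → Pol
  linProd []       = 1ₚ
  linProd (a ∷ as) = ((- a) ∷ 1# ∷ []) *ₚ linProd as

mapₚ : {F K : FiniteField} → (FiniteField.Carrier F → FiniteField.Carrier K) →
       Poly.Pol F → Poly.Pol K
mapₚ ι p = map ι p

-- g is s-self-involutive: g and g^{*s} = (x - a_1^s)...(x - a_k^s) have the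
-- same roots, where g = (x - a_1)...(x - a_k) over an extension field.
-- Roots are taken in any (finite) extension field K of F over which g splits.
SelfInvolutive : (F : FiniteField) → ℕ → Poly.Pol F → Set₁
SelfInvolutive F s g =
  ∀ (K : FiniteField) (ι : FiniteField.Carrier F → FiniteField.Carrier K) →
  IsFieldHom F K ι → ∀ (as : List (FiniteField.Carrier K)) →
  Poly._≈ₚ_ K (mapₚ {F} {K} ι g) (Poly.linProd K as) →
  (∀ a → a ∈ as → FiniteField._^_ K a s ∈ as) ×
  (∀ a → a ∈ as → ∃ λ b → b ∈ as × a ≡ FiniteField._^_ K b s)

-- The group G = ⟨x, y | x^n = 1, y^2 = 1, xy = yx^s⟩ (s² ≡ 1 mod n),
-- realised concretely: the element (i , j) stands for x^i y^j, with
-- x^i y^j · x^k y^l = x^{i + s^j k} y^{j + l}   (since y x^k = x^{sk} y),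
-- and its group algebra F G (functions G → F with convolution).

module GroupAlgebra (F : FiniteField) (n s : ℕ) .{{_ : NonZero n}} where
  open FiniteField F
  open Poly F

  G : Set
  G = Fin n × Fin 2

  _≟G_ : (g h : G) → Dec (g ≡ h)
  _≟G_ = ≡-dec _≟F_ _≟F_

  sPow : Fin 2 → ℕ
  sPow j = s ℕ.^ toℕ j

  _·G_ : G → G → G
  (i , j) ·G (k , l) = ((toℕ i ℕ.+ sPow j ℕ.* toℕ k) mod n , (toℕ j ℕ.+ toℕ l) mod 2)

  sumFin : {m : ℕ} → (Fin m → Carrier) → Carrier
  sumFin {zero}  f = 0#
  sumFin {suc m} f = f Fin.zero + sumFin (λ i → f (Fin.suc i))

  sumG : (G → Carrier) → Carrier
  sumG f = sumFin (λ i → sumFin (λ j → f (i , j)))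

  FG : Set
  FG = G → Carrier

  infix 4 _≈ᴳ_
  _≈ᴳ_ : FG → FG → Set
  a ≈ᴳ b = ∀ g → a g ≡ b g

  infixl 6 _+ᴳ_ _-ᴳ_
  infixl 7 _⋆_ _·ᴳ_

  _+ᴳ_ : FG → FG → FG
  (a +ᴳ b) g = a g + b g

  _-ᴳ_ : FG → FG → FG
  (a -ᴳ b) g = a g + (- b g)

  _·ᴳ_ : Carrier → FG → FG
  (c ·ᴳ a) g = c * a g

  _⋆_ : FG → FG → FG
  (a ⋆ b) g = sumG (λ h → sumG (λ h' →
                if ⌊ (h ·G h') ≟G g ⌋ then a h * b h' else 0#))

  0ᴳ : FG
  0ᴳ _ = 0#

  δ : G → FG
  δ g h = if ⌊ g ≟G h ⌋ then 1# else 0#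

  1ᴳ : FG
  1ᴳ = δ (0 mod n , 0 mod 2)

  xᴳ : FG
  xᴳ = δ (1 mod n , 0 mod 2)

  yᴳ : FG
  yᴳ = δ (0 mod n , 1 mod 2)

  ⟦_⟧ : Pol → FG
  ⟦ [] ⟧    = 0ᴳ
  ⟦ c ∷ p ⟧ = (c ·ᴳ 1ᴳ) +ᴳ (xᴳ ⋆ ⟦ p ⟧)

  IsIdempotent : FG → Set
  IsIdempotent e = e ⋆ e ≈ᴳ e

  IsPrimitiveIdempotent : FG → Set
  IsPrimitiveIdempotent e =
    IsIdempotent e × ¬ (e ≈ᴳ 0ᴳ) ×
    (∀ e₁ e₂ → IsIdempotent e₁ → IsIdempotent e₂ →
       e₁ ⋆ e₂ ≈ᴳ 0ᴳ → e₂ ⋆ e₁ ≈ᴳ 0ᴳ → e ≈ᴳ e₁ +ᴳ e₂ →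
       e₁ ≈ᴳ 0ᴳ ⊎ e₂ ≈ᴳ 0ᴳ)

  IsCentral : FG → Set
  IsCentral e = ∀ a → e ⋆ a ≈ᴳ a ⋆ e

{-# OPTIONS --safe #-}
-- Let K = F[x]/(f) and let α be the class of x.  If N is the order of α, then f divides
-- x^N − 1 = ∏ (x − α^i), so f splits over K; self-involutivity gives f(α^s) = 0, hence an automorphism
-- t of K over F with t(α) = α^s and t² = 1.  Sending x to α maps FG onto the skew algebra K ⊕ K y,
-- y v = t(v) y.  Since ((f*)′)* = (deg f) f − x f′, the element −(1/n) ((f*)′)* (x^n − 1)/f maps to 1;
-- it annihilates the kernel, which f generates, so identities between its right multiples can be
-- checked in K ⊕ K y.
-- There, with c = −ℓ(α), one has c + t(c) = 1, e₂ = c (1 − y) and e₁ = (1 + y) t(c).  An idempotent g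
-- with e g = g e = g is determined by its K-component a, which satisfies a (a + t(a)) = a; hence
-- a = 0 and g = 0, or a + t(a) = 1 and g = e.
module Submission where

open import Defs
open import Algebra.Bundles using (CommutativeRing; AbelianGroup)
import Algebra.Properties.CommutativeSemigroup as CommutativeSemigroupProperties
import Algebra.Properties.Ring as RingProperties
import Algebra.Solver.Ring.NaturalCoefficients.Default as NatSolver
open import Data.Bool using (if_then_else_)
open import Data.Empty using (⊥-elim)
import Data.Fin as Fin
open import Data.Fin using (Fin; toℕ)
import Data.Fin.Properties as Finₚ
open import Data.List using (List; []; _∷_; map; length; tabulate; applyUpTo)
open import Data.List.Membership.Propositional using (_∈_)
import Data.List.Membership.Propositional.Properties as ∈ₚ
import Data.List.Properties as Listₚ
import Data.List.Relation.Unary.All as All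
import Data.List.Relation.Unary.AllPairs as AllPairs
open import Data.List.Relation.Unary.Any using (here; there)
open import Data.List.Relation.Unary.Unique.Propositional using (Unique)
import Data.List.Relation.Unary.Unique.Propositional.Properties as Uniqueₚ
import Data.Nat as ℕ
open import Data.Nat using (ℕ; NonZero; _≤_; _∸_; _%_; zero; suc; _<_; z≤n; s≤s) renaming (_*_ to _*ℕ_; _+_ to _+ℕ_; _^_ to _^ℕ_)
open import Data.Nat.DivMod using (_mod_; m≡m%n+[m/n]*n; m%n<n; m<n⇒m%n≡m; %-distribˡ-+; %-distribˡ-*; m%n%n≡m%n; [m+n]%n≡m%n)
open import Data.Nat.GCD using (gcd)
open import Data.Nat.Induction using (<-rec)
import Data.Nat.Properties as ℕₚ
open import Data.Product using (_×_; ∃; _,_; proj₁; proj₂)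
open import Data.Product.Function.NonDependent.Propositional using (_×-↔_)
open import Data.Sum using (_⊎_; inj₁; inj₂; [_,_]′)
import Data.Vec as Vec
open import Data.Vec using (Vec)
import Data.Vec.Properties as Vecₚ
open import Function.Bundles using (_↔_; mk↔ₛ′)
open import Function.Related.Propositional using (module EquationalReasoning)
open import Level using (0ℓ)
open import Relation.Binary.Bundles using (Setoid)
open import Relation.Binary.Definitions using (tri<; tri≈; tri>)
open import Relation.Binary.PropositionalEquality
import Relation.Binary.Reasoning.Setoid as SetoidReasoning
open import Relation.Nullary using (¬_; Dec; yes; no)
open import Relation.Nullary.Decidable using (⌊_⌋)

-- Put z = α^(s - 1). Then t(α) = z α, so z t(z) = 1, and the congruence for ℓ says c = 1/(1 - z).
-- Hence t(c) = 1/(1 - 1/z) = -z/(1 - z), which explains c + t(c) = 1. Moreover z - 1 is invertible,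
-- so z ≠ 1, and this is why neither idempotent commutes with x. The factor 1/n comes from
-- differentiating f h = x^n - 1 at α, which gives α f′(α) h(α) = n. Self-involutivity speaks only
-- of fields over which f splits completely, with the roots given as a list. Before it can be
-- applied, K has to be built as a `FiniteField`, with laws up to propositional equality and an
-- enumeration, and a full list of roots of f has to be produced over it. Products in FG are
-- convolutions, awkward to compare coefficient by coefficient. The two components of the map to K ⊕
-- K y are therefore F-linear extensions of functions on G, and multiplicativity needs checking only
-- on pairs of group elements. Primitivity is then a matter of solving equations in K, with no count
-- of dimensions.

fieldRing : FiniteField → CommutativeRing 0ℓ 0ℓ
fieldRing F = record { isCommutativeRing = FiniteField.isCommutativeRing F }

-- Field arithmetic: cancellation, and powers of roots of unity.

module FieldProperties (F : FiniteField) where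
  open FiniteField F
  open CommutativeRing (fieldRing F) public
    using ( +-assoc; +-comm; +-identityˡ; +-identityʳ; -‿inverseˡ; -‿inverseʳ
          ; *-assoc; *-comm; *-identityˡ; *-identityʳ; distribˡ; distribʳ; zeroˡ; zeroʳ)
  open RingProperties (CommutativeRing.ring (fieldRing F)) public
    using (-‿distribˡ-*; -‿distribʳ-*; -1*x≈-x; -‿involutive; -0#≈0#; -‿+-comm; +-inverseʳ-unique; +-inverseˡ-unique; +-cancelˡ)
    renaming (x∙y⁻¹≈ε⇒x≈y to x-y≈0⇒x≈y; x≈y⇒x∙y⁻¹≈ε to x≈y⇒x-y≈0)
  open CommutativeSemigroupProperties (CommutativeRing.+-commutativeSemigroup (fieldRing F)) public
    using () renaming (interchange to +-interchange; x∙yz≈y∙xz to +-swap)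
  open CommutativeSemigroupProperties (CommutativeRing.*-commutativeSemigroup (fieldRing F)) public
    using () renaming (x∙yz≈y∙xz to *-swap)
  module Solver = NatSolver (CommutativeRing.commutativeSemiring (fieldRing F))
  open ≡-Reasoning

  integral : ∀ a b → a * b ≡ 0# → a ≡ 0# ⊎ b ≡ 0#
  integral a b ab≡0 with a ≟ 0#
  ... | yes a≡0 = inj₁ a≡0
  ... | no a≢0 with inverse a a≢0
  ...   | a⁻¹ , aa⁻¹≡1 = inj₂ (begin
    b               ≡⟨ *-identityˡ b ⟨
    1# * b          ≡⟨ cong (_* b) aa⁻¹≡1 ⟨
    a * a⁻¹ * b     ≡⟨ trans (*-assoc a a⁻¹ b) (*-swap a a⁻¹ b) ⟩
    a⁻¹ * (a * b)   ≡⟨ cong (a⁻¹ *_) ab≡0 ⟩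
    a⁻¹ * 0#        ≡⟨ zeroʳ a⁻¹ ⟩
    0#              ∎)

  *-cancelˡ : ∀ a {b c} → ¬ (a ≡ 0#) → a * b ≡ a * c → b ≡ c
  *-cancelˡ a {b} {c} a≢0 ab≡ac with integral a (b + - c) (begin
    a * (b + - c)       ≡⟨ distribˡ a b (- c) ⟩
    a * b + a * - c     ≡⟨ cong₂ _+_ ab≡ac (sym (-‿distribʳ-* a c)) ⟩
    a * c + - (a * c)   ≡⟨ -‿inverseʳ (a * c) ⟩
    0#                  ∎)
  ... | inj₁ a≡0   = ⊥-elim (a≢0 a≡0)
  ... | inj₂ b-c≡0 = x-y≈0⇒x≈y b c b-c≡0

  ^-+ : ∀ a m k → a ^ (m +ℕ k) ≡ a ^ m * a ^ k
  ^-+ a zero k    = sym (*-identityˡ _)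
  ^-+ a (suc m) k = trans (cong (a *_) (^-+ a m k)) (sym (*-assoc a _ _))

  1^ : ∀ m → 1# ^ m ≡ 1#
  1^ zero    = refl
  1^ (suc m) = trans (*-identityˡ _) (1^ m)

  ^-* : ∀ a m k → a ^ (m *ℕ k) ≡ (a ^ k) ^ m
  ^-* a zero k    = refl
  ^-* a (suc m) k = trans (^-+ a k (m *ℕ k)) (cong (a ^ k *_) (^-* a m k))

  ^-swap : ∀ a m k → (a ^ m) ^ k ≡ (a ^ k) ^ m
  ^-swap a m k = begin
    (a ^ m) ^ k   ≡⟨ ^-* a k m ⟨
    a ^ (k *ℕ m)  ≡⟨ cong (a ^_) (ℕₚ.*-comm k m) ⟩
    a ^ (m *ℕ k)  ≡⟨ ^-* a m k ⟩
    (a ^ k) ^ m   ∎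

  ^-% : ∀ a n .{{_ : NonZero n}} → a ^ n ≡ 1# → ∀ m → a ^ (m % n) ≡ a ^ m
  ^-% a n aⁿ≡1 m = sym (begin
    a ^ m                                       ≡⟨ cong (a ^_) (m≡m%n+[m/n]*n m n) ⟩
    a ^ (m % n +ℕ (m ℕ./ n) *ℕ n)         ≡⟨ ^-+ a (m % n) _ ⟩
    a ^ (m % n) * a ^ ((m ℕ./ n) *ℕ n)    ≡⟨ cong (a ^ (m % n) *_) (^-* a (m ℕ./ n) n) ⟩
    a ^ (m % n) * (a ^ n) ^ (m ℕ./ n)     ≡⟨ cong (λ z → a ^ (m % n) * z ^ (m ℕ./ n)) aⁿ≡1 ⟩
    a ^ (m % n) * 1# ^ (m ℕ./ n)          ≡⟨ cong (a ^ (m % n) *_) (1^ (m ℕ./ n)) ⟩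
    a ^ (m % n) * 1#                            ≡⟨ *-identityʳ _ ⟩
    a ^ (m % n)                                 ∎)

  ^-≢0 : ∀ a → ¬ (a ≡ 0#) → ∀ m → ¬ (a ^ m ≡ 0#)
  ^-≢0 a a≢0 zero    e = 0≢1 (sym e)
  ^-≢0 a a≢0 (suc m) e with integral a (a ^ m) e
  ... | inj₁ z = a≢0 z
  ... | inj₂ z = ^-≢0 a a≢0 m z

  unit-root-≢0 : ∀ a n .{{_ : NonZero n}} → a ^ n ≡ 1# → ¬ (a ≡ 0#)
  unit-root-≢0 a (suc n) aⁿ≡1 refl = 0≢1 (trans (sym (zeroˡ _)) aⁿ≡1)

-- The commutative ring of coefficient lists up to trailing zeros.

module PolyProperties (F : FiniteField) where
  open FiniteField F
  open Poly F hiding (_*)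
  open FieldProperties F

  infix 4 _≋_
  -- The record keeps both polynomials visible in the type. The bare relation `_≈ₚ_` unfolds to
  -- equations between coefficients, from which implicit polynomials could not be inferred.
  record _≋_ (p r : Pol) : Set where
    constructor mk≋
    field at : p ≈ₚ r
  open _≋_ public

  ≋-refl : ∀ {p} → p ≋ p
  ≋-refl = mk≋ λ _ → refl

  ≋-sym : ∀ {p r} → p ≋ r → r ≋ p
  ≋-sym e = mk≋ λ i → sym (at e i)

  ≋-trans : ∀ {p q r} → p ≋ q → q ≋ r → p ≋ r
  ≋-trans d e = mk≋ λ i → trans (at d i) (at e i)

  coeff-+ : ∀ p r i → coeff (p +ₚ r) i ≡ coeff p i + coeff r i
  coeff-+ []      r       i       = sym (+-identityˡ _)
  coeff-+ (a ∷ p) []      i       = sym (+-identityʳ _)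
  coeff-+ (a ∷ p) (b ∷ r) zero    = refl
  coeff-+ (a ∷ p) (b ∷ r) (suc i) = coeff-+ p r i

  coeff-· : ∀ c p i → coeff (c ·ₚ p) i ≡ c * coeff p i
  coeff-· c []      i       = sym (zeroʳ c)
  coeff-· c (a ∷ p) zero    = refl
  coeff-· c (a ∷ p) (suc i) = coeff-· c p i

  coeff-neg : ∀ p i → coeff (-ₚ p) i ≡ - coeff p i
  coeff-neg []      i       = sym -0#≈0#
  coeff-neg (a ∷ p) zero    = refl
  coeff-neg (a ∷ p) (suc i) = coeff-neg p i

  coeff-- : ∀ p r i → coeff (p -ₚ r) i ≡ coeff p i + - coeff r i
  coeff-- p r i = trans (coeff-+ p (-ₚ r) i) (cong (coeff p i +_) (coeff-neg r i))

  ∷-cong : ∀ {a b p r} → a ≡ b → p ≋ r → a ∷ p ≋ b ∷ r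
  ∷-cong a≡b e = mk≋ λ { zero → a≡b ; (suc i) → at e i }

  ∷-zero : ∀ {p} → p ≋ [] → 0# ∷ p ≋ []
  ∷-zero e = mk≋ λ { zero → refl ; (suc i) → at e i }

  tail-zero : ∀ {a p} → a ∷ p ≋ [] → p ≋ []
  tail-zero e = mk≋ λ i → at e (suc i)

  tail-cong : ∀ {a b p r} → a ∷ p ≋ b ∷ r → p ≋ r
  tail-cong e = mk≋ λ i → at e (suc i)

  +ₚ-cong : ∀ {p p′ r r′} → p ≋ p′ → r ≋ r′ → p +ₚ r ≋ p′ +ₚ r′
  +ₚ-cong {p} {p′} {r} {r′} d e = mk≋ λ i →
    trans (coeff-+ p r i) (trans (cong₂ _+_ (at d i) (at e i)) (sym (coeff-+ p′ r′ i)))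

  +ₚ-assoc : ∀ p q r → (p +ₚ q) +ₚ r ≋ p +ₚ (q +ₚ r)
  +ₚ-assoc p q r = mk≋ λ i → begin
    coeff (p +ₚ q +ₚ r) i                ≡⟨ coeff-+ (p +ₚ q) r i ⟩
    coeff (p +ₚ q) i + coeff r i         ≡⟨ cong (_+ coeff r i) (coeff-+ p q i) ⟩
    coeff p i + coeff q i + coeff r i    ≡⟨ +-assoc _ _ _ ⟩
    coeff p i + (coeff q i + coeff r i)  ≡⟨ cong (coeff p i +_) (coeff-+ q r i) ⟨
    coeff p i + coeff (q +ₚ r) i         ≡⟨ coeff-+ p (q +ₚ r) i ⟨
    coeff (p +ₚ (q +ₚ r)) i              ∎
    where open ≡-Reasoning

  +ₚ-comm : ∀ p r → p +ₚ r ≋ r +ₚ p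
  +ₚ-comm p r = mk≋ λ i → trans (coeff-+ p r i) (trans (+-comm _ _) (sym (coeff-+ r p i)))

  +ₚ-identityʳ : ∀ p → p +ₚ [] ≋ p
  +ₚ-identityʳ p = +ₚ-comm p []

  -ₚ-cong : ∀ {p r} → p ≋ r → -ₚ p ≋ -ₚ r
  -ₚ-cong {p} {r} e = mk≋ λ i → trans (coeff-neg p i) (trans (cong -_ (at e i)) (sym (coeff-neg r i)))

  -ₚ-inverseʳ : ∀ p → p -ₚ p ≋ []
  -ₚ-inverseʳ p = mk≋ λ i → trans (coeff-- p p i) (-‿inverseʳ _)

  -ₚ-inverseˡ : ∀ p → (-ₚ p) +ₚ p ≋ []
  -ₚ-inverseˡ p = ≋-trans (+ₚ-comm (-ₚ p) p) (-ₚ-inverseʳ p)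

  +ₚ-abelianGroup : AbelianGroup 0ℓ 0ℓ
  +ₚ-abelianGroup = record
    { Carrier = Pol ; _≈_ = _≋_ ; _∙_ = _+ₚ_ ; ε = [] ; _⁻¹ = -ₚ_
    ; isAbelianGroup = record
      { isGroup = record
        { isMonoid = record
          { isSemigroup = record
            { isMagma = record
              { isEquivalence = record { refl = ≋-refl ; sym = ≋-sym ; trans = ≋-trans }
              ; ∙-cong = +ₚ-cong }
            ; assoc = +ₚ-assoc }
          ; identity = (λ _ → ≋-refl) , +ₚ-identityʳ }
        ; inverse = -ₚ-inverseˡ , -ₚ-inverseʳ
        ; ⁻¹-cong = -ₚ-cong }
      ; comm = +ₚ-comm } }

  open CommutativeSemigroupProperties (AbelianGroup.commutativeSemigroup +ₚ-abelianGroup)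
    using (interchange; x∙yz≈y∙xz)
  open SetoidReasoning (AbelianGroup.setoid +ₚ-abelianGroup)

  ·ₚ-cong : ∀ c {p r} → p ≋ r → c ·ₚ p ≋ c ·ₚ r
  ·ₚ-cong c {p} {r} e = mk≋ λ i →
    trans (coeff-· c p i) (trans (cong (c *_) (at e i)) (sym (coeff-· c r i)))

  ·ₚ-distribˡ : ∀ c p r → c ·ₚ (p +ₚ r) ≋ (c ·ₚ p) +ₚ (c ·ₚ r)
  ·ₚ-distribˡ c p r = mk≋ λ i →
    trans (coeff-· c (p +ₚ r) i) (trans (cong (c *_) (coeff-+ p r i)) (trans (distribˡ c _ _)
      (sym (trans (coeff-+ (c ·ₚ p) (c ·ₚ r) i) (cong₂ _+_ (coeff-· c p i) (coeff-· c r i))))))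

  ·ₚ-distribʳ : ∀ c d p → (c + d) ·ₚ p ≋ (c ·ₚ p) +ₚ (d ·ₚ p)
  ·ₚ-distribʳ c d p = mk≋ λ i →
    trans (coeff-· (c + d) p i) (trans (distribʳ _ c d)
      (sym (trans (coeff-+ (c ·ₚ p) (d ·ₚ p) i) (cong₂ _+_ (coeff-· c p i) (coeff-· d p i)))))

  ·ₚ-assoc : ∀ c d p → (c * d) ·ₚ p ≋ c ·ₚ (d ·ₚ p)
  ·ₚ-assoc c d p = mk≋ λ i →
    trans (coeff-· (c * d) p i) (trans (*-assoc c d _)
      (sym (trans (coeff-· c (d ·ₚ p) i) (cong (c *_) (coeff-· d p i)))))

  ·ₚ-zeroˡ : ∀ p → 0# ·ₚ p ≋ []
  ·ₚ-zeroˡ p = mk≋ λ i → trans (coeff-· 0# p i) (zeroˡ _)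

  ·ₚ-identity : ∀ p → 1# ·ₚ p ≋ p
  ·ₚ-identity p = mk≋ λ i → trans (coeff-· 1# p i) (*-identityˡ _)

  0∷-+ : ∀ p r → 0# ∷ (p +ₚ r) ≋ (0# ∷ p) +ₚ (0# ∷ r)
  0∷-+ p r = ∷-cong (sym (+-identityˡ 0#)) ≋-refl

  *ₚ-distribʳ : ∀ r p q → (p +ₚ q) *ₚ r ≋ p *ₚ r +ₚ q *ₚ r
  *ₚ-distribʳ r []      q       = ≋-refl
  *ₚ-distribʳ r (a ∷ p) []      = ≋-sym (+ₚ-identityʳ _)
  *ₚ-distribʳ r (a ∷ p) (b ∷ q) = begin
    ((a + b) ·ₚ r) +ₚ (0# ∷ (p +ₚ q) *ₚ r)
      ≈⟨ +ₚ-cong (·ₚ-distribʳ a b r)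
           (≋-trans (∷-cong refl (*ₚ-distribʳ r p q)) (0∷-+ (p *ₚ r) (q *ₚ r))) ⟩
    ((a ·ₚ r) +ₚ (b ·ₚ r)) +ₚ ((0# ∷ p *ₚ r) +ₚ (0# ∷ q *ₚ r))
      ≈⟨ interchange (a ·ₚ r) (b ·ₚ r) (0# ∷ p *ₚ r) (0# ∷ q *ₚ r) ⟩
    (a ∷ p) *ₚ r +ₚ (b ∷ q) *ₚ r ∎

  *ₚ-zeroʳ : ∀ p → p *ₚ [] ≋ []
  *ₚ-zeroʳ []      = ≋-refl
  *ₚ-zeroʳ (a ∷ p) = ∷-zero (*ₚ-zeroʳ p)

  0∷-* : ∀ p r → (0# ∷ p) *ₚ r ≋ 0# ∷ p *ₚ r
  0∷-* p r = +ₚ-cong (·ₚ-zeroˡ r) ≋-refl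

  [c]-* : ∀ c r → (c ∷ []) *ₚ r ≋ c ·ₚ r
  [c]-* c r = ≋-trans (+ₚ-cong ≋-refl (∷-zero ≋-refl)) (+ₚ-identityʳ _)

  -- Multiplication recurses on its left factor; this expansion along the right factor is what makes
  -- commutativity an induction.
  *ₚ-∷ : ∀ p b r → p *ₚ (b ∷ r) ≋ (b ·ₚ p) +ₚ (0# ∷ p *ₚ r)
  *ₚ-∷ []      b r = ≋-sym (∷-zero ≋-refl)
  *ₚ-∷ (a ∷ p) b r = ∷-cong (cong (_+ 0#) (*-comm a b)) (begin
    (a ·ₚ r) +ₚ p *ₚ (b ∷ r)                  ≈⟨ +ₚ-cong ≋-refl (*ₚ-∷ p b r) ⟩
    (a ·ₚ r) +ₚ ((b ·ₚ p) +ₚ (0# ∷ p *ₚ r))   ≈⟨ x∙yz≈y∙xz (a ·ₚ r) (b ·ₚ p) (0# ∷ p *ₚ r) ⟩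
    (b ·ₚ p) +ₚ ((a ·ₚ r) +ₚ (0# ∷ p *ₚ r))   ∎)

  *ₚ-comm : ∀ p r → p *ₚ r ≋ r *ₚ p
  *ₚ-comm []      r = ≋-sym (*ₚ-zeroʳ r)
  *ₚ-comm (a ∷ p) r = begin
    (a ·ₚ r) +ₚ (0# ∷ p *ₚ r) ≈⟨ +ₚ-cong ≋-refl (∷-cong refl (*ₚ-comm p r)) ⟩
    (a ·ₚ r) +ₚ (0# ∷ r *ₚ p) ≈⟨ *ₚ-∷ r a p ⟨
    r *ₚ (a ∷ p)              ∎

  *ₚ-congˡ : ∀ p {r r′} → r ≋ r′ → p *ₚ r ≋ p *ₚ r′
  *ₚ-congˡ []      e = ≋-refl
  *ₚ-congˡ (a ∷ p) e = +ₚ-cong (·ₚ-cong a e) (∷-cong refl (*ₚ-congˡ p e))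

  *ₚ-cong : ∀ {p p′ r r′} → p ≋ p′ → r ≋ r′ → p *ₚ r ≋ p′ *ₚ r′
  *ₚ-cong {p} {p′} {r} {r′} d e = begin
    p *ₚ r    ≈⟨ *ₚ-congˡ p e ⟩
    p *ₚ r′   ≈⟨ *ₚ-comm p r′ ⟩
    r′ *ₚ p   ≈⟨ *ₚ-congˡ r′ d ⟩
    r′ *ₚ p′  ≈⟨ *ₚ-comm r′ p′ ⟩
    p′ *ₚ r′  ∎

  ·ₚ-*-assoc : ∀ c p r → (c ·ₚ p) *ₚ r ≋ c ·ₚ (p *ₚ r)
  ·ₚ-*-assoc c []      r = ≋-refl
  ·ₚ-*-assoc c (a ∷ p) r = begin
    ((c * a) ·ₚ r) +ₚ (0# ∷ (c ·ₚ p) *ₚ r)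
      ≈⟨ +ₚ-cong (·ₚ-assoc c a r) (∷-cong (sym (zeroʳ c)) (·ₚ-*-assoc c p r)) ⟩
    (c ·ₚ (a ·ₚ r)) +ₚ (c ·ₚ (0# ∷ p *ₚ r))
      ≈⟨ ·ₚ-distribˡ c (a ·ₚ r) (0# ∷ p *ₚ r) ⟨
    c ·ₚ ((a ∷ p) *ₚ r) ∎

  *ₚ-assoc : ∀ p q r → (p *ₚ q) *ₚ r ≋ p *ₚ (q *ₚ r)
  *ₚ-assoc []      q r = ≋-refl
  *ₚ-assoc (a ∷ p) q r = begin
    ((a ·ₚ q) +ₚ (0# ∷ p *ₚ q)) *ₚ r      ≈⟨ *ₚ-distribʳ r (a ·ₚ q) (0# ∷ p *ₚ q) ⟩
    (a ·ₚ q) *ₚ r +ₚ (0# ∷ p *ₚ q) *ₚ r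
      ≈⟨ +ₚ-cong (·ₚ-*-assoc a q r) (≋-trans (0∷-* (p *ₚ q) r) (∷-cong refl (*ₚ-assoc p q r))) ⟩
    (a ∷ p) *ₚ (q *ₚ r) ∎

  *ₚ-identityˡ : ∀ p → 1ₚ *ₚ p ≋ p
  *ₚ-identityˡ p = ≋-trans ([c]-* 1# p) (·ₚ-identity p)

  *ₚ-identityʳ : ∀ p → p *ₚ 1ₚ ≋ p
  *ₚ-identityʳ p = ≋-trans (*ₚ-comm p 1ₚ) (*ₚ-identityˡ p)

  *ₚ-distribˡ : ∀ r p q → r *ₚ (p +ₚ q) ≋ r *ₚ p +ₚ r *ₚ q
  *ₚ-distribˡ r p q = ≋-trans (*ₚ-comm r (p +ₚ q))
    (≋-trans (*ₚ-distribʳ r p q) (+ₚ-cong (*ₚ-comm p r) (*ₚ-comm q r)))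

  polyRing : CommutativeRing 0ℓ 0ℓ
  polyRing = record
    { Carrier = Pol ; _≈_ = _≋_ ; _+_ = _+ₚ_ ; _*_ = _*ₚ_ ; -_ = -ₚ_ ; 0# = [] ; 1# = 1ₚ
    ; isCommutativeRing = record
      { isRing = record
        { +-isAbelianGroup = AbelianGroup.isAbelianGroup +ₚ-abelianGroup
        ; *-cong = *ₚ-cong
        ; *-assoc = *ₚ-assoc
        ; *-identity = *ₚ-identityˡ , *ₚ-identityʳ
        ; distrib = *ₚ-distribˡ , *ₚ-distribʳ }
      ; *-comm = *ₚ-comm } }

  module PSolver = NatSolver (CommutativeRing.commutativeSemiring polyRing)
  module PRing = RingProperties (CommutativeRing.ring polyRing)
  module ≋-Reasoning = SetoidReasoning (CommutativeRing.setoid polyRing)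

-- Leading coefficients, cancellation and division with remainder.

module PolyDegree (F : FiniteField) where
  open FiniteField F
  open Poly F hiding (_*)
  open FieldProperties F
  open PolyProperties F

  -- c is not required to be nonzero, so d is in general only a bound on the degree.
  Top : Pol → ℕ → Carrier → Set
  Top p d c = coeff p d ≡ c × (∀ i → d < i → coeff p i ≡ 0#)

  -- Induction on the bound d. At d = 0 the tail of the left factor is zero, so it acts as the
  -- scalar x. Otherwise `x ·ₚ r` has no coefficient above e, and the top coefficient is that of the
  -- shifted product of the tail with r.
  Top-* : ∀ p r {d e a b} → Top p d a → Top r e b → Top (p *ₚ r) (d +ℕ e) (a * b)
  Top-* [] r {b = b} (0≡a , _) _ = sym (trans (cong (_* b) (sym 0≡a)) (zeroˡ b)) , λ _ _ → refl
  Top-* (x ∷ p) r {zero} {e} {a} {b} (x≡a , above) (lead , above′) =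
    trans (coeffs e) (cong₂ _*_ x≡a lead) ,
    λ i e<i → trans (coeffs i) (trans (cong (x *_) (above′ i e<i)) (zeroʳ x))
    where
    p≋0 : p ≋ []
    p≋0 = mk≋ λ i → above (suc i) (s≤s z≤n)
    coeffs : ∀ i → coeff ((x ∷ p) *ₚ r) i ≡ x * coeff r i
    coeffs i = trans (at (≋-trans (+ₚ-cong {x ·ₚ r} ≋-refl (∷-cong refl (*ₚ-cong p≋0 (≋-refl {r})))) ([c]-* x r)) i)
      (coeff-· x r i)
  Top-* (x ∷ p) r {suc d} {e} {a} {b} (lead , above) (lead′ , above′) =
    trans (coeffs (d +ℕ e)) (trans (cong₂ _+_ (vanish _ (s≤s (ℕₚ.m≤n+m e d))) (proj₁ rec)) (+-identityˡ _)) ,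
    λ { (suc i) (s≤s de<i) → trans (coeffs i)
          (trans (cong₂ _+_ (vanish _ (s≤s (ℕₚ.≤-trans (ℕₚ.m≤n+m e d) (ℕₚ.<⇒≤ de<i)))) (proj₂ rec i de<i)) (+-identityˡ _)) }
    where
    rec : Top (p *ₚ r) (d +ℕ e) (a * b)
    rec = Top-* p r (lead , λ i d<i → above (suc i) (s≤s d<i)) (lead′ , above′)
    vanish : ∀ i → e < i → x * coeff r i ≡ 0#
    vanish i e<i = trans (cong (x *_) (above′ i e<i)) (zeroʳ x)
    coeffs : ∀ i → coeff ((x ∷ p) *ₚ r) (suc i) ≡ x * coeff r (suc i) + coeff (p *ₚ r) i
    coeffs i = trans (coeff-+ (x ·ₚ r) (0# ∷ p *ₚ r) (suc i)) (cong (_+ _) (coeff-· x r (suc i)))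

  Top-unique : ∀ {p r d e a b} → p ≋ r → Top p d a → Top r e b → ¬ (a ≡ 0#) → ¬ (b ≡ 0#) → d ≡ e × a ≡ b
  Top-unique {d = d} {e} p≋r (lead , above) (lead′ , above′) a≢0 b≢0 with ℕₚ.<-cmp d e
  ... | tri< d<e _ _ = ⊥-elim (b≢0 (trans (sym lead′) (trans (sym (at p≋r e)) (above e d<e))))
  ... | tri> _ _ e<d = ⊥-elim (a≢0 (trans (sym lead) (trans (at p≋r d) (above′ d e<d))))
  ... | tri≈ _ refl _ = refl , trans (sym lead) (trans (at p≋r d) lead′)

  private
    normalize-spec : ∀ p → (normalize p ≡ [] × p ≋ []) ⊎
      (∃ λ d → length (normalize p) ≡ suc d × Top p d (coeff p d) × ¬ (coeff p d ≡ 0#))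
    normalize-spec [] = inj₁ (refl , ≋-refl)
    normalize-spec (a ∷ p) with normalize p | normalize-spec p
    ... | [] | inj₁ (_ , p≋0) with a ≟ 0#
    ...   | yes a≡0 = inj₁ (refl , ≋-trans (∷-cong a≡0 ≋-refl) (∷-zero p≋0))
    ...   | no a≢0  = inj₂ (0 , refl , (refl , λ { (suc i) _ → at p≋0 i }) , a≢0)
    normalize-spec (a ∷ p) | b ∷ r | inj₂ (d , len , (_ , above) , lead≢0) =
      inj₂ (suc d , cong suc len , (refl , λ { (suc i) (s≤s d<i) → above i d<i }) , lead≢0)

  -- The zero polynomial is a separate alternative: `deg` assigns it degree 0, although its
  -- coefficient there vanishes.
  deg-spec : ∀ p → p ≋ [] ⊎ (Top p (deg p) (coeff p (deg p)) × ¬ (coeff p (deg p) ≡ 0#))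
  deg-spec p with normalize-spec p
  ... | inj₁ (_ , p≋0) = inj₁ p≋0
  ... | inj₂ (d , len , top , lead≢0) = inj₂ (subst (λ e → Top p e (coeff p e) × ¬ (coeff p e ≡ 0#)) (cong (_∸ 1) (sym len)) (top , lead≢0))

  nonzero-product : ∀ {a b} → ¬ (a ≡ 0#) → ¬ (b ≡ 0#) → ¬ (a * b ≡ 0#)
  nonzero-product {a} {b} a≢0 b≢0 ab≡0 with integral a b ab≡0
  ... | inj₁ a≡0 = a≢0 a≡0
  ... | inj₂ b≡0 = b≢0 b≡0

  *ₚ-cancel-zero : ∀ p w {d c} → Top p d c → ¬ (c ≡ 0#) → p *ₚ w ≋ [] → w ≋ []
  *ₚ-cancel-zero p w top c≢0 pw≋0 with deg-spec w
  ... | inj₁ w≋0 = w≋0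
  ... | inj₂ (top′ , b≢0) = ⊥-elim (nonzero-product c≢0 b≢0
          (trans (sym (proj₁ (Top-* p w top top′))) (at pw≋0 _)))

  *ₚ-cancelˡ : ∀ p w w′ {d c} → Top p d c → ¬ (c ≡ 0#) → p *ₚ w ≋ p *ₚ w′ → w ≋ w′
  *ₚ-cancelˡ p w w′ top c≢0 e = PRing.x∙y⁻¹≈ε⇒x≈y w w′
    (*ₚ-cancel-zero p (w -ₚ w′) top c≢0
      (≋-trans (PRing.x[y-z]≈xy-xz p w w′) (PRing.x≈y⇒x∙y⁻¹≈ε e)))

  constant : ∀ p {c} → Top p 0 c → p ≋ c ∷ []
  constant p (lead , above) = mk≋ λ { zero → lead ; (suc i) → above (suc i) (s≤s z≤n) }

  module Division (u : Pol) (d : ℕ) (c c⁻¹ : Carrier) (top : Top u d c) (cc⁻¹≡1 : c * c⁻¹ ≡ 1#) where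

    -- Long division by recursion on the dividend. If p leaves the remainder r, then a + x p leaves
    -- a + x r, of degree at most d, and one multiple of u clears the coefficient at d.
    rem : Pol → Pol
    rem []      = []
    rem (a ∷ p) = (a ∷ rem p) -ₚ ((coeff (a ∷ rem p) d * c⁻¹) ·ₚ u)

    quot : Pol → Pol
    quot []      = []
    quot (a ∷ p) = (coeff (a ∷ rem p) d * c⁻¹) ∷ quot p

    division : ∀ p → p ≋ rem p +ₚ u *ₚ quot p
    division []      = ≋-sym (*ₚ-zeroʳ u)
    division (a ∷ p) = begin
      a ∷ p                                     ≈⟨ ∷-cong (sym (+-identityʳ a)) (division p) ⟩
      r +ₚ t                                    ≈⟨ +ₚ-cong (+ₚ-identityʳ r) (≋-refl {t}) ⟨
      (r +ₚ []) +ₚ t                            ≈⟨ +ₚ-cong (+ₚ-cong (≋-refl {r}) (-ₚ-inverseˡ ku)) (≋-refl {t}) ⟨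
      (r +ₚ ((-ₚ ku) +ₚ ku)) +ₚ t               ≈⟨ PSolver.solve 4 (λ x y z w → (x :+ (y :+ z)) :+ w := (x :+ y) :+ (z :+ w)) ≋-refl r (-ₚ ku) ku t ⟩
      (r -ₚ ku) +ₚ (ku +ₚ t)                    ≈⟨ +ₚ-cong (≋-refl {r -ₚ ku}) (*ₚ-∷ u k (quot p)) ⟨
      rem (a ∷ p) +ₚ u *ₚ quot (a ∷ p)          ∎
      where
      open ≋-Reasoning
      open PSolver using (_:+_; _:=_)
      r t ku : Pol
      r  = a ∷ rem p
      t  = 0# ∷ u *ₚ quot p
      k : Carrier
      k  = coeff r d * c⁻¹
      ku = k ·ₚ u

    rem-bound : ∀ p i → d ≤ i → coeff (rem p) i ≡ 0#
    rem-bound []      i d≤i = refl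
    rem-bound (a ∷ p) i d≤i = begin
      coeff (rem (a ∷ p)) i               ≡⟨ coeff-- r (k ·ₚ u) i ⟩
      coeff r i + - coeff (k ·ₚ u) i      ≡⟨ cong (λ z → coeff r i + - z) (coeff-· k u i) ⟩
      coeff r i + - (k * coeff u i)       ≡⟨ x≈y⇒x-y≈0 (agree (ℕₚ.m≤n⇒m<n∨m≡n d≤i)) ⟩
      0#                                  ∎
      where
      open ≡-Reasoning
      r : Pol
      r = a ∷ rem p
      k : Carrier
      k = coeff r d * c⁻¹
      r-above : ∀ i → d < i → coeff r i ≡ 0#
      r-above (suc i) (s≤s d≤i) = rem-bound p i d≤i
      agree : ∀ {i} → d < i ⊎ d ≡ i → coeff r i ≡ k * coeff u i
      agree {i} (inj₁ d<i) = trans (r-above i d<i) (sym (trans (cong (k *_) (proj₂ top i d<i)) (zeroʳ k)))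
      agree (inj₂ refl) = sym (begin
        coeff r d * c⁻¹ * coeff u d   ≡⟨ cong (coeff r d * c⁻¹ *_) (proj₁ top) ⟩
        coeff r d * c⁻¹ * c           ≡⟨ *-assoc _ _ _ ⟩
        coeff r d * (c⁻¹ * c)         ≡⟨ cong (coeff r d *_) (trans (*-comm c⁻¹ c) cc⁻¹≡1) ⟩
        coeff r d * 1#                ≡⟨ *-identityʳ _ ⟩
        coeff r d                     ∎)

-- The operator x d/dx and the reciprocal of the derivative of the reciprocal.

module EulerOperator (F : FiniteField) where
  open FiniteField F
  open Poly F hiding (_*)
  open FieldProperties F
  open PolyProperties F

  -- D p = x p′
  D : Pol → Pol
  D []      = []
  D (a ∷ p) = 0# ∷ (D p +ₚ p)

  coeff-D : ∀ p i → coeff (D p) i ≡ fromℕ i * coeff p i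
  coeff-D []      i       = sym (zeroʳ _)
  coeff-D (a ∷ p) zero    = sym (zeroˡ a)
  coeff-D (a ∷ p) (suc i) = begin
    coeff (D p +ₚ p) i                     ≡⟨ coeff-+ (D p) p i ⟩
    coeff (D p) i + coeff p i              ≡⟨ cong (_+ coeff p i) (coeff-D p i) ⟩
    fromℕ i * coeff p i + coeff p i        ≡⟨ +-comm _ _ ⟩
    coeff p i + fromℕ i * coeff p i        ≡⟨ cong (_+ fromℕ i * coeff p i) (*-identityˡ _) ⟨
    1# * coeff p i + fromℕ i * coeff p i   ≡⟨ distribʳ _ _ _ ⟨
    (1# + fromℕ i) * coeff p i             ∎
    where open ≡-Reasoning

  D-cong : ∀ {p r} → p ≋ r → D p ≋ D r
  D-cong {p} {r} e = mk≋ λ i → trans (coeff-D p i) (trans (cong (fromℕ i *_) (at e i)) (sym (coeff-D r i)))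

  D-+ : ∀ p r → D (p +ₚ r) ≋ D p +ₚ D r
  D-+ p r = mk≋ λ i → begin
    coeff (D (p +ₚ r)) i                            ≡⟨ coeff-D (p +ₚ r) i ⟩
    fromℕ i * coeff (p +ₚ r) i                      ≡⟨ cong (fromℕ i *_) (coeff-+ p r i) ⟩
    fromℕ i * (coeff p i + coeff r i)               ≡⟨ distribˡ _ _ _ ⟩
    fromℕ i * coeff p i + fromℕ i * coeff r i       ≡⟨ cong₂ _+_ (coeff-D p i) (coeff-D r i) ⟨
    coeff (D p) i + coeff (D r) i                   ≡⟨ coeff-+ (D p) (D r) i ⟨
    coeff (D p +ₚ D r) i                            ∎
    where open ≡-Reasoning

  D-· : ∀ c p → D (c ·ₚ p) ≋ c ·ₚ D p
  D-· c p = mk≋ λ i → begin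
    coeff (D (c ·ₚ p)) i         ≡⟨ coeff-D (c ·ₚ p) i ⟩
    fromℕ i * coeff (c ·ₚ p) i   ≡⟨ cong (fromℕ i *_) (coeff-· c p i) ⟩
    fromℕ i * (c * coeff p i)    ≡⟨ *-swap (fromℕ i) c (coeff p i) ⟩
    c * (fromℕ i * coeff p i)    ≡⟨ cong (c *_) (coeff-D p i) ⟨
    c * coeff (D p) i            ≡⟨ coeff-· c (D p) i ⟨
    coeff (c ·ₚ D p) i           ∎
    where open ≡-Reasoning

  -- Multiplication by x turns the derivative into a derivation that preserves exponents. The rule
  -- D(a + x p) = x (D p + p) then carries the induction without any shift of indices.
  D-* : ∀ p r → D (p *ₚ r) ≋ D p *ₚ r +ₚ p *ₚ D r
  D-* []      r = ≋-refl
  D-* (a ∷ p) r = begin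
    D ((a ·ₚ r) +ₚ (0# ∷ p *ₚ r))
      ≈⟨ D-+ (a ·ₚ r) (0# ∷ p *ₚ r) ⟩
    D (a ·ₚ r) +ₚ (0# ∷ (D (p *ₚ r) +ₚ p *ₚ r))
      ≈⟨ +ₚ-cong (D-· a r) (∷-cong refl (begin
           D (p *ₚ r) +ₚ p *ₚ r                     ≈⟨ +ₚ-cong (D-* p r) (≋-refl {p *ₚ r}) ⟩
           (D p *ₚ r +ₚ p *ₚ D r) +ₚ p *ₚ r         ≈⟨ PSolver.solve 4 (λ x y z w → (x :* y :+ z :* w) :+ z :* y := (x :+ z) :* y :+ z :* w) ≋-refl (D p) r p (D r) ⟩
           (D p +ₚ p) *ₚ r +ₚ p *ₚ D r              ∎)) ⟩
    (a ·ₚ D r) +ₚ (0# ∷ ((D p +ₚ p) *ₚ r +ₚ p *ₚ D r))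
      ≈⟨ +ₚ-cong (≋-refl {a ·ₚ D r}) (0∷-+ ((D p +ₚ p) *ₚ r) (p *ₚ D r)) ⟩
    (a ·ₚ D r) +ₚ ((0# ∷ (D p +ₚ p) *ₚ r) +ₚ (0# ∷ p *ₚ D r))
      ≈⟨ PSolver.solve 3 (λ x y z → x :+ (y :+ z) := y :+ (x :+ z)) ≋-refl (a ·ₚ D r) (0# ∷ (D p +ₚ p) *ₚ r) (0# ∷ p *ₚ D r) ⟩
    (0# ∷ (D p +ₚ p) *ₚ r) +ₚ ((a ·ₚ D r) +ₚ (0# ∷ p *ₚ D r))
      ≈⟨ +ₚ-cong (0∷-* (D p +ₚ p) r) (≋-refl {(a ∷ p) *ₚ D r}) ⟨
    D (a ∷ p) *ₚ r +ₚ (a ∷ p) *ₚ D r ∎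
    where
    open ≋-Reasoning
    open PSolver using (_:*_; _:+_; _:=_)

  D-X^ : ∀ k → D (X^ k) ≋ fromℕ k ·ₚ X^ k
  D-X^ zero    = ∷-cong (sym (zeroˡ 1#)) ≋-refl
  D-X^ (suc k) = ∷-cong (sym (zeroʳ _)) (begin
    D (X^ k) +ₚ X^ k                        ≈⟨ +ₚ-cong (D-X^ k) (≋-sym (·ₚ-identity (X^ k))) ⟩
    (fromℕ k ·ₚ X^ k) +ₚ (1# ·ₚ X^ k)       ≈⟨ +ₚ-comm (fromℕ k ·ₚ X^ k) (1# ·ₚ X^ k) ⟩
    (1# ·ₚ X^ k) +ₚ (fromℕ k ·ₚ X^ k)       ≈⟨ ·ₚ-distribʳ 1# (fromℕ k) (X^ k) ⟨
    (1# + fromℕ k) ·ₚ X^ k                  ∎)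
    where open ≋-Reasoning

  D-[Xⁿ-1] : ∀ k → D (X^ k -ₚ 1ₚ) ≋ fromℕ k ·ₚ X^ k
  D-[Xⁿ-1] k = ≋-trans (D-+ (X^ k) (-ₚ 1ₚ))
    (≋-trans (+ₚ-cong (D-X^ k) (∷-zero ≋-refl)) (+ₚ-identityʳ _))

  private
    coeff-applyUpTo-< : ∀ (g : ℕ → Carrier) m i → i < m → coeff (applyUpTo g m) i ≡ g i
    coeff-applyUpTo-< g (suc m) zero    _         = refl
    coeff-applyUpTo-< g (suc m) (suc i) (s≤s i<m) = coeff-applyUpTo-< (λ j → g (suc j)) m i i<m

    coeff-applyUpTo-≥ : ∀ (g : ℕ → Carrier) m i → m ≤ i → coeff (applyUpTo g m) i ≡ 0#
    coeff-applyUpTo-≥ g zero    i       _         = refl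
    coeff-applyUpTo-≥ g (suc m) (suc i) (s≤s m≤i) = coeff-applyUpTo-≥ (λ j → g (suc j)) m i m≤i

    rev-applyUpTo : ∀ k p → rev k p ≡ applyUpTo (λ i → coeff p (k ∸ i)) (suc k)
    rev-applyUpTo k p = Listₚ.map-applyUpTo (λ i → i) (λ i → coeff p (k ∸ i)) (suc k)

    coeff-derivAux : ∀ k p i → coeff (derivAux k p) i ≡ fromℕ (k +ℕ i) * coeff p i
    coeff-derivAux k []      i       = sym (zeroʳ _)
    coeff-derivAux k (b ∷ p) zero    = cong (λ j → fromℕ j * b) (sym (ℕₚ.+-identityʳ k))
    coeff-derivAux k (b ∷ p) (suc i) = trans (coeff-derivAux (suc k) p i)
      (cong (λ j → fromℕ j * coeff p i) (sym (ℕₚ.+-suc k i)))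

  coeff-rev-≤ : ∀ k p i → i ≤ k → coeff (rev k p) i ≡ coeff p (k ∸ i)
  coeff-rev-≤ k p i i≤k = trans (cong (λ r → coeff r i) (rev-applyUpTo k p)) (coeff-applyUpTo-< (λ j → coeff p (k ∸ j)) (suc k) i (s≤s i≤k))

  coeff-rev-> : ∀ k p i → k < i → coeff (rev k p) i ≡ 0#
  coeff-rev-> k p i k<i = trans (cong (λ r → coeff r i) (rev-applyUpTo k p)) (coeff-applyUpTo-≥ (λ j → coeff p (k ∸ j)) (suc k) i k<i)

  coeff-deriv : ∀ p i → coeff (deriv p) i ≡ fromℕ (suc i) * coeff p (suc i)
  coeff-deriv []      i = sym (zeroʳ _)
  coeff-deriv (a ∷ p) i = coeff-derivAux 1 p i

  fromℕ-+ : ∀ m k → fromℕ (m +ℕ k) ≡ fromℕ m + fromℕ k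
  fromℕ-+ zero    k = sym (+-identityˡ _)
  fromℕ-+ (suc m) k = trans (cong (1# +_) (fromℕ-+ m k)) (sym (+-assoc _ _ _))

  -- ((f*)′)* = k f − x f′, moved to a form without subtraction.
  reciprocal-derivative : ∀ f k → 1 ≤ k → (∀ i → k < i → coeff f i ≡ 0#) →
    rev (k ∸ 1) (deriv (rev k f)) +ₚ D f ≋ fromℕ k ·ₚ f
  reciprocal-derivative f (suc k) _ above = mk≋ λ i →
    trans (coeff-+ A (D f) i) (trans (cong (coeff A i +_) (coeff-D f i))
      (trans (go i (i ℕₚ.≤? k)) (sym (coeff-· (fromℕ (suc k)) f i))))
    where
    open ≡-Reasoning
    A A′ : Pol
    A′ = deriv (rev (suc k) f)
    A  = rev k A′
    go : ∀ i → Dec (i ≤ k) → coeff A i + fromℕ i * coeff f i ≡ fromℕ (suc k) * coeff f i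
    go i (yes i≤k) = begin
      coeff A i + fromℕ i * coeff f i
        ≡⟨ cong (_+ _) (coeff-rev-≤ k A′ i i≤k) ⟩
      coeff (deriv (rev (suc k) f)) (k ∸ i) + fromℕ i * coeff f i
        ≡⟨ cong (_+ _) (coeff-deriv (rev (suc k) f) (k ∸ i)) ⟩
      fromℕ (suc (k ∸ i)) * coeff (rev (suc k) f) (suc (k ∸ i)) + fromℕ i * coeff f i
        ≡⟨ cong (λ z → fromℕ (suc (k ∸ i)) * z + fromℕ i * coeff f i)
             (trans (coeff-rev-≤ (suc k) f (suc (k ∸ i)) (s≤s (ℕₚ.m∸n≤m k i)))
               (cong (coeff f) (ℕₚ.m∸[m∸n]≡n i≤k))) ⟩
      fromℕ (suc (k ∸ i)) * coeff f i + fromℕ i * coeff f i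
        ≡⟨ distribʳ _ _ _ ⟨
      (fromℕ (suc (k ∸ i)) + fromℕ i) * coeff f i
        ≡⟨ cong (_* coeff f i) (fromℕ-+ (suc (k ∸ i)) i) ⟨
      fromℕ (suc (k ∸ i +ℕ i)) * coeff f i
        ≡⟨ cong (λ j → fromℕ (suc j) * coeff f i) (ℕₚ.m∸n+n≡m i≤k) ⟩
      fromℕ (suc k) * coeff f i ∎
    go i (no i≰k) = begin
      coeff A i + fromℕ i * coeff f i   ≡⟨ cong (_+ _) (coeff-rev-> k A′ i k<i) ⟩
      0# + fromℕ i * coeff f i          ≡⟨ +-identityˡ _ ⟩
      fromℕ i * coeff f i               ≡⟨ agree (ℕₚ.m≤n⇒m<n∨m≡n k<i) ⟩
      fromℕ (suc k) * coeff f i         ∎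
      where
      k<i : k < i
      k<i = ℕₚ.≰⇒> i≰k
      -- At i = deg f the outer reciprocal, taken in degree deg f - 1, has no coefficient, and x f′
      -- alone contributes deg f times the leading coefficient. Beyond that both sides vanish.
      agree : suc k < i ⊎ suc k ≡ i → fromℕ i * coeff f i ≡ fromℕ (suc k) * coeff f i
      agree (inj₁ sk<i) = trans (cong (fromℕ i *_) (above i sk<i))
        (trans (zeroʳ _) (sym (trans (cong (fromℕ (suc k) *_) (above i sk<i)) (zeroʳ _))))
      agree (inj₂ refl) = refl

-- Evaluation of polynomials over F at points of an extension, and extension of scalars.

module Evaluation (F K : FiniteField) (ι : FiniteField.Carrier F → FiniteField.Carrier K) (hom : IsFieldHom F K ι) where
  private
    module F = FiniteField F
    module Fₚ = FieldProperties F
  open FiniteField K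
  open Poly F using (Pol; _+ₚ_; _·ₚ_; _*ₚ_; -ₚ_; _-ₚ_; X^; 1ₚ; coeff)
  open PolyProperties F
  open FieldProperties K
  open IsFieldHom hom public
  private
    module PK = Poly K
    module PPK = PolyProperties K

  hom-0 : ι F.0# ≡ 0#
  hom-0 = +-cancelˡ (ι F.0#) (ι F.0#) 0# (trans (sym (hom-+ _ _)) (trans (cong ι (Fₚ.+-identityˡ _)) (sym (+-identityʳ _))))

  hom-neg : ∀ a → ι (F.- a) ≡ - ι a
  hom-neg a = +-inverseʳ-unique (ι a) (ι (F.- a)) (trans (sym (hom-+ _ _)) (trans (cong ι (Fₚ.-‿inverseʳ a)) hom-0))

  ev : Carrier → Pol → Carrier
  ev β []      = 0#
  ev β (a ∷ p) = ι a + β * ev β p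

  module _ (β : Carrier) where
    open ≡-Reasoning

    ev-∷-zero : ∀ {x y} → x ≡ 0# → y ≡ 0# → x + β * y ≡ 0#
    ev-∷-zero refl refl = trans (+-identityˡ _) (zeroʳ β)

    ev-zero : ∀ {p} → p ≋ [] → ev β p ≡ 0#
    ev-zero {[]}    e = refl
    ev-zero {a ∷ p} e = ev-∷-zero (trans (cong ι (at e 0)) hom-0) (ev-zero (tail-zero e))

    ev-cong : ∀ {p r} → p ≋ r → ev β p ≡ ev β r
    ev-cong {[]}    {r}     e = sym (ev-zero (≋-sym e))
    ev-cong {a ∷ p} {[]}    e = ev-zero e
    ev-cong {a ∷ p} {b ∷ r} e = cong₂ (λ x y → ι x + β * y) (at e 0) (ev-cong (tail-cong e))

    ev-+ : ∀ p r → ev β (p +ₚ r) ≡ ev β p + ev β r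
    ev-+ []      r       = sym (+-identityˡ _)
    ev-+ (a ∷ p) []      = sym (+-identityʳ _)
    ev-+ (a ∷ p) (b ∷ r) = begin
      ι (a F.+ b) + β * ev β (p +ₚ r)              ≡⟨ cong₂ (λ x y → x + β * y) (hom-+ a b) (ev-+ p r) ⟩
      (ι a + ι b) + β * (ev β p + ev β r)          ≡⟨ Solver.solve 5 (λ x y z u v → (x :+ y) :+ z :* (u :+ v) := (x :+ z :* u) :+ (y :+ z :* v)) refl (ι a) (ι b) β (ev β p) (ev β r) ⟩
      (ι a + β * ev β p) + (ι b + β * ev β r)      ∎
      where open Solver using (_:*_; _:+_; _:=_)

    ev-· : ∀ c p → ev β (c ·ₚ p) ≡ ι c * ev β p
    ev-· c []      = sym (zeroʳ _)
    ev-· c (a ∷ p) = begin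
      ι (c F.* a) + β * ev β (c ·ₚ p)      ≡⟨ cong₂ (λ x y → x + β * y) (hom-* c a) (ev-· c p) ⟩
      ι c * ι a + β * (ι c * ev β p)       ≡⟨ Solver.solve 4 (λ x y z u → x :* y :+ z :* (x :* u) := x :* (y :+ z :* u)) refl (ι c) (ι a) β (ev β p) ⟩
      ι c * (ι a + β * ev β p)             ∎
      where open Solver using (_:*_; _:+_; _:=_)

    ev-* : ∀ p r → ev β (p *ₚ r) ≡ ev β p * ev β r
    ev-* []      r = sym (zeroˡ _)
    ev-* (a ∷ p) r = begin
      ev β ((a ·ₚ r) +ₚ (F.0# ∷ p *ₚ r))                   ≡⟨ ev-+ (a ·ₚ r) (F.0# ∷ p *ₚ r) ⟩
      ev β (a ·ₚ r) + (ι F.0# + β * ev β (p *ₚ r))         ≡⟨ cong₂ _+_ (ev-· a r) (trans (cong₂ _+_ hom-0 (cong (β *_) (ev-* p r))) (+-identityˡ _)) ⟩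
      ι a * ev β r + β * (ev β p * ev β r)                 ≡⟨ Solver.solve 4 (λ x y z u → x :* y :+ z :* (u :* y) := (x :+ z :* u) :* y) refl (ι a) (ev β r) β (ev β p) ⟩
      (ι a + β * ev β p) * ev β r                          ∎
      where open Solver using (_:*_; _:+_; _:=_)

    ev-const : ∀ c → ev β (c ∷ []) ≡ ι c
    ev-const c = trans (cong (ι c +_) (zeroʳ β)) (+-identityʳ _)

    ev-neg : ∀ p → ev β (-ₚ p) ≡ - ev β p
    ev-neg p = +-inverseʳ-unique (ev β p) (ev β (-ₚ p)) (trans (sym (ev-+ p (-ₚ p))) (ev-zero (-ₚ-inverseʳ p)))

    ev-1 : ev β 1ₚ ≡ 1#
    ev-1 = trans (ev-const F.1#) hom-1

    ev-X^ : ∀ k → ev β (X^ k) ≡ β ^ k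
    ev-X^ zero    = ev-1
    ev-X^ (suc k) = trans (cong₂ _+_ hom-0 (cong (β *_) (ev-X^ k))) (+-identityˡ _)

    ev-[Xᵏ-1] : ∀ k → ev β (X^ k -ₚ 1ₚ) ≡ β ^ k + - 1#
    ev-[Xᵏ-1] k = trans (ev-+ (X^ k) (-ₚ 1ₚ)) (cong₂ _+_ (ev-X^ k) (trans (ev-neg 1ₚ) (cong -_ ev-1)))

  coeff-map : ∀ p i → PK.coeff (map ι p) i ≡ ι (coeff p i)
  coeff-map []      i       = sym hom-0
  coeff-map (a ∷ p) zero    = refl
  coeff-map (a ∷ p) (suc i) = coeff-map p i

  map-cong : ∀ {p r} → p ≋ r → map ι p PPK.≋ map ι r
  map-cong {p} {r} e = PPK.mk≋ λ i → trans (coeff-map p i) (trans (cong ι (at e i)) (sym (coeff-map r i)))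

  map-+ : ∀ p r → map ι (p +ₚ r) ≡ map ι p PK.+ₚ map ι r
  map-+ []      r       = refl
  map-+ (a ∷ p) []      = refl
  map-+ (a ∷ p) (b ∷ r) = cong₂ _∷_ (hom-+ a b) (map-+ p r)

  map-· : ∀ c p → map ι (c ·ₚ p) ≡ ι c PK.·ₚ map ι p
  map-· c []      = refl
  map-· c (a ∷ p) = cong₂ _∷_ (hom-* c a) (map-· c p)

  map-* : ∀ p r → map ι (p *ₚ r) ≡ map ι p PK.*ₚ map ι r
  map-* []      r = refl
  map-* (a ∷ p) r = trans (map-+ (a ·ₚ r) (F.0# ∷ p *ₚ r))
    (cong₂ PK._+ₚ_ (map-· a r) (cong₂ _∷_ hom-0 (map-* p r)))

  map-neg : ∀ p → map ι (-ₚ p) ≡ PK.-ₚ (map ι p)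
  map-neg []      = refl
  map-neg (a ∷ p) = cong₂ _∷_ (hom-neg a) (map-neg p)

  map-X^ : ∀ k → map ι (X^ k) ≡ PK.X^ k
  map-X^ zero    = cong (_∷ []) hom-1
  map-X^ (suc k) = cong₂ _∷_ hom-0 (map-X^ k)

  map-[Xᵏ-1] : ∀ k → map ι (X^ k -ₚ 1ₚ) ≡ PK.X^ k PK.-ₚ PK.1ₚ
  map-[Xᵏ-1] k = trans (map-+ (X^ k) (-ₚ 1ₚ))
    (cong₂ PK._+ₚ_ (map-X^ k) (trans (map-neg 1ₚ) (cong (λ c → PK.-ₚ (c ∷ [])) hom-1)))

idHom : (K : FiniteField) → IsFieldHom K K (λ a → a)
idHom K = record { hom-+ = λ _ _ → refl ; hom-* = λ _ _ → refl ; hom-1 = refl }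

-- Coefficient vectors of fixed length, and their enumeration.

module VectorPolynomial (F : FiniteField) where
  open FiniteField F
  open Poly F using (coeff)

  coeff-toList-≥ : ∀ {k} (v : Vec Carrier k) i → k ≤ i → coeff (Vec.toList v) i ≡ 0#
  coeff-toList-≥ Vec.[]       i       _         = refl
  coeff-toList-≥ (a Vec.∷ v) (suc i) (s≤s k≤i) = coeff-toList-≥ v i k≤i

  coeff-tabulate-< : ∀ k (g : ℕ → Carrier) i → i < k → coeff (Vec.toList (Vec.tabulate {n = k} (λ j → g (toℕ j)))) i ≡ g i
  coeff-tabulate-< (suc k) g zero    _         = refl
  coeff-tabulate-< (suc k) g (suc i) (s≤s i<k) = coeff-tabulate-< k (λ j → g (suc j)) i i<k

  tabulate-coeff : ∀ {k} (v : Vec Carrier k) → Vec.tabulate (λ j → coeff (Vec.toList v) (toℕ j)) ≡ v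
  tabulate-coeff Vec.[]       = refl
  tabulate-coeff (a Vec.∷ v) = cong (a Vec.∷_) (tabulate-coeff v)

  -- A `FiniteField` carries an enumeration of its elements. Residues modulo f will be vectors of
  -- deg f coefficients, so this supplies the one for K.
  vec-enum : ∀ k → Fin (size ^ℕ k) ↔ Vec Carrier k
  vec-enum zero    = mk↔ₛ′ (λ _ → Vec.[]) (λ _ → Fin.zero) (λ { Vec.[] → refl }) (λ { Fin.zero → refl ; (Fin.suc ()) })
  vec-enum (suc k) =
    Fin (size *ℕ size ^ℕ k)       ↔⟨ Finₚ.*↔× ⟩
    (Fin size × Fin (size ^ℕ k))  ↔⟨ enum ×-↔ vec-enum k ⟩
    (Carrier × Vec Carrier k)     ↔⟨ mk↔ₛ′ (λ av → proj₁ av Vec.∷ proj₂ av) (λ v → Vec.head v , Vec.tail v)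
                                       (λ { (a Vec.∷ v) → refl }) (λ _ → refl) ⟩
    Vec Carrier (suc k)           ∎
    where open EquationalReasoning

-- The field K of residues modulo a monic irreducible f, with α the class of x.

module QuotientField (F : FiniteField) (f : Poly.Pol F)
  (f-top : PolyDegree.Top F f (Poly.deg F f) (FiniteField.1# F)) (f-irr : Poly.Irreducible F f) where
  open FiniteField F
  open Poly F hiding (_*)
  open FieldProperties F
  open PolyProperties F
  open PolyDegree F
  open VectorPolynomial F
  open PSolver using (_:+_; _:*_; _:=_)

  k : ℕ
  k = deg f

  open Division f k 1# 1# f-top (*-identityˡ 1#)

  infix 4 _~_
  record _~_ (p r : Pol) : Set where
    constructor mk~
    field
      factor : Pol
      equation : p ≋ r +ₚ f *ₚ factor

  ≋⇒~ : ∀ {p r} → p ≋ r → p ~ r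
  ≋⇒~ {p} {r} e = mk~ [] (≋-trans e (≋-sym (≋-trans (+ₚ-cong (≋-refl {r}) (*ₚ-zeroʳ f)) (+ₚ-identityʳ r))))

  ~-refl : ∀ {p} → p ~ p
  ~-refl = ≋⇒~ ≋-refl

  ~-sym : ∀ {p r} → p ~ r → r ~ p
  ~-sym {p} {r} (mk~ m e) = mk~ (-ₚ m) (begin
    r                                     ≈⟨ +ₚ-identityʳ r ⟨
    r +ₚ []                               ≈⟨ +ₚ-cong (≋-refl {r}) (-ₚ-inverseʳ (f *ₚ m)) ⟨
    r +ₚ (f *ₚ m +ₚ (-ₚ (f *ₚ m)))        ≈⟨ +ₚ-assoc r (f *ₚ m) (-ₚ (f *ₚ m)) ⟨
    (r +ₚ f *ₚ m) +ₚ (-ₚ (f *ₚ m))        ≈⟨ +ₚ-cong (≋-sym e) (PRing.-‿distribʳ-* f m) ⟩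
    p +ₚ f *ₚ (-ₚ m)                      ∎)
    where open ≋-Reasoning

  ~-trans : ∀ {p q r} → p ~ q → q ~ r → p ~ r
  ~-trans {p} {q} {r} (mk~ m e) (mk~ m′ e′) = mk~ (m′ +ₚ m)
    (≋-trans e (≋-trans (+ₚ-cong e′ (≋-refl {f *ₚ m}))
      (PSolver.solve 4 (λ r f m m′ → (r :+ f :* m′) :+ f :* m := r :+ f :* (m′ :+ m)) ≋-refl r f m m′)))

  ~-+-cong : ∀ {p p′ r r′} → p ~ p′ → r ~ r′ → p +ₚ r ~ p′ +ₚ r′
  ~-+-cong {p} {p′} {r} {r′} (mk~ m e) (mk~ m′ e′) = mk~ (m +ₚ m′) (≋-trans (+ₚ-cong e e′)
    (PSolver.solve 5 (λ p r f m m′ → (p :+ f :* m) :+ (r :+ f :* m′) := (p :+ r) :+ f :* (m :+ m′)) ≋-refl p′ r′ f m m′))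

  ~-*-cong : ∀ {p p′ r r′} → p ~ p′ → r ~ r′ → p *ₚ r ~ p′ *ₚ r′
  ~-*-cong {p} {p′} {r} {r′} (mk~ m e) (mk~ m′ e′) = mk~ (m *ₚ r′ +ₚ p′ *ₚ m′ +ₚ f *ₚ (m *ₚ m′)) (≋-trans (*ₚ-cong e e′)
    (PSolver.solve 5 (λ p r f m m′ → (p :+ f :* m) :* (r :+ f :* m′) := (p :* r) :+ f :* (m :* r :+ p :* m′ :+ f :* (m :* m′))) ≋-refl p′ r′ f m m′))

  ~-neg-cong : ∀ {p r} → p ~ r → -ₚ p ~ -ₚ r
  ~-neg-cong {p} {r} (mk~ m e) = mk~ (-ₚ m) (≋-trans (-ₚ-cong e)
    (≋-trans (≋-sym (PRing.-‿+-comm r (f *ₚ m))) (+ₚ-cong (≋-refl { -ₚ r}) (PRing.-‿distribʳ-* f m))))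

  ~-setoid : Setoid 0ℓ 0ℓ
  ~-setoid = record
    { Carrier = Pol ; _≈_ = _~_
    ; isEquivalence = record { refl = ~-refl ; sym = ~-sym ; trans = ~-trans } }

  module ~-Reasoning = SetoidReasoning ~-setoid

  -- Since f is monic, a multiple f m with m nonzero has the leading coefficient of m at position k
  -- + deg m. A multiple of f with no coefficient from k on is therefore zero.
  ~0⇒≋0 : ∀ p → (∀ i → k ≤ i → coeff p i ≡ 0#) → p ~ [] → p ≋ []
  ~0⇒≋0 p bound (mk~ m e) with deg-spec m
  ... | inj₁ m≋0 = ≋-trans e (≋-trans (*ₚ-cong (≋-refl {f}) m≋0) (*ₚ-zeroʳ f))
  ... | inj₂ (m-top , lead≢0) = ⊥-elim (lead≢0 (begin
      coeff m (deg m)                   ≡⟨ *-identityˡ _ ⟨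
      1# * coeff m (deg m)              ≡⟨ proj₁ (Top-* f m f-top m-top) ⟨
      coeff (f *ₚ m) (k +ℕ deg m)       ≡⟨ at e (k +ℕ deg m) ⟨
      coeff p (k +ℕ deg m)              ≡⟨ bound (k +ℕ deg m) (ℕₚ.m≤m+n k (deg m)) ⟩
      0#                                ∎))
    where open ≡-Reasoning

  ~⇒≋ : ∀ {p r} → (∀ i → k ≤ i → coeff p i ≡ 0#) → (∀ i → k ≤ i → coeff r i ≡ 0#) → p ~ r → p ≋ r
  ~⇒≋ {p} {r} bp br p~r = PRing.x∙y⁻¹≈ε⇒x≈y p r (~0⇒≋0 (p -ₚ r)
    (λ i k≤i → trans (coeff-- p r i) (x≈y⇒x-y≈0 (trans (bp i k≤i) (sym (br i k≤i)))))
    (~-trans (~-+-cong p~r (~-refl { -ₚ r})) (≋⇒~ (-ₚ-inverseʳ r))))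

  rem-~ : ∀ p → rem p ~ p
  rem-~ p = ~-sym (mk~ (quot p) (division p))

  abstract
    -- The field laws are required up to propositional equality, so every class needs a canonical
    -- representative: the vector of the k coefficients of its remainder.
    red : Pol → Vec Carrier k
    red p = Vec.tabulate (λ i → coeff (rem p) (toℕ i))

    toPol : Vec Carrier k → Pol
    toPol = Vec.toList

    toPol-red-≋ : ∀ p → toPol (red p) ≋ rem p
    toPol-red-≋ p = mk≋ λ i → go i (k ℕₚ.≤? i)
      where
      go : ∀ i → Dec (k ≤ i) → coeff (toPol (red p)) i ≡ coeff (rem p) i
      go i (yes k≤i) = trans (coeff-toList-≥ (red p) i k≤i) (sym (rem-bound p i k≤i))
      go i (no k≰i)  = coeff-tabulate-< k (coeff (rem p)) i (ℕₚ.≰⇒> k≰i)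

    toPol-red : ∀ p → toPol (red p) ~ p
    toPol-red p = ~-trans (≋⇒~ (toPol-red-≋ p)) (rem-~ p)

    red-cong : ∀ {p r} → p ~ r → red p ≡ red r
    red-cong {p} {r} p~r = Vecₚ.tabulate-cong λ i →
      at (~⇒≋ (rem-bound p) (rem-bound r) (~-trans (rem-~ p) (~-trans p~r (~-sym (rem-~ r))))) (toℕ i)

    red-toPol : ∀ v → red (toPol v) ≡ v
    red-toPol v = trans
      (Vecₚ.tabulate-cong λ i → at (~⇒≋ (rem-bound (toPol v)) (coeff-toList-≥ v) (rem-~ (toPol v))) (toℕ i))
      (tabulate-coeff v)

    toPol-bound : ∀ v i → k ≤ i → coeff (toPol v) i ≡ 0#
    toPol-bound = coeff-toList-≥

  red-injective : ∀ {p r} → red p ≡ red r → p ~ r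
  red-injective {p} {r} e = ~-trans (~-sym (toPol-red p)) (subst (λ v → toPol v ~ r) (sym e) (toPol-red r))

  infixl 6 _⊕_
  infixl 7 _⊗_
  _⊕_ _⊗_ : Vec Carrier k → Vec Carrier k → Vec Carrier k
  u ⊕ v = red (toPol u +ₚ toPol v)
  u ⊗ v = red (toPol u *ₚ toPol v)

  ⊖_ : Vec Carrier k → Vec Carrier k
  ⊖ u = red (-ₚ toPol u)

  red-+ : ∀ p r → red (p +ₚ r) ≡ red p ⊕ red r
  red-+ p r = red-cong (~-sym (~-+-cong (toPol-red p) (toPol-red r)))

  red-* : ∀ p r → red (p *ₚ r) ≡ red p ⊗ red r
  red-* p r = red-cong (~-sym (~-*-cong (toPol-red p) (toPol-red r)))

  private
    ⊕-assoc : ∀ u v w → (u ⊕ v) ⊕ w ≡ u ⊕ (v ⊕ w)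
    ⊕-assoc u v w = red-cong (begin
      toPol (u ⊕ v) +ₚ toPol w          ≈⟨ ~-+-cong (toPol-red _) ~-refl ⟩
      (toPol u +ₚ toPol v) +ₚ toPol w   ≈⟨ ≋⇒~ (+ₚ-assoc (toPol u) (toPol v) (toPol w)) ⟩
      toPol u +ₚ (toPol v +ₚ toPol w)   ≈⟨ ~-+-cong (~-refl {toPol u}) (toPol-red _) ⟨
      toPol u +ₚ toPol (v ⊕ w)          ∎)
      where open ~-Reasoning

    ⊗-assoc : ∀ u v w → (u ⊗ v) ⊗ w ≡ u ⊗ (v ⊗ w)
    ⊗-assoc u v w = red-cong (begin
      toPol (u ⊗ v) *ₚ toPol w          ≈⟨ ~-*-cong (toPol-red _) ~-refl ⟩
      (toPol u *ₚ toPol v) *ₚ toPol w   ≈⟨ ≋⇒~ (*ₚ-assoc (toPol u) (toPol v) (toPol w)) ⟩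
      toPol u *ₚ (toPol v *ₚ toPol w)   ≈⟨ ~-*-cong (~-refl {toPol u}) (toPol-red _) ⟨
      toPol u *ₚ toPol (v ⊗ w)          ∎)
      where open ~-Reasoning

    ⊕-comm : ∀ u v → u ⊕ v ≡ v ⊕ u
    ⊕-comm u v = red-cong (≋⇒~ (+ₚ-comm (toPol u) (toPol v)))

    ⊗-comm : ∀ u v → u ⊗ v ≡ v ⊗ u
    ⊗-comm u v = red-cong (≋⇒~ (*ₚ-comm (toPol u) (toPol v)))

    ⊕-identityˡ : ∀ u → red [] ⊕ u ≡ u
    ⊕-identityˡ u = trans (red-cong (~-+-cong (toPol-red []) (~-refl {toPol u}))) (red-toPol u)

    ⊗-identityˡ : ∀ u → red 1ₚ ⊗ u ≡ u
    ⊗-identityˡ u = trans (red-cong (~-trans (~-*-cong (toPol-red 1ₚ) (~-refl {toPol u})) (≋⇒~ (*ₚ-identityˡ (toPol u))))) (red-toPol u)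

    ⊖-inverseˡ : ∀ u → ⊖ u ⊕ u ≡ red []
    ⊖-inverseˡ u = red-cong (~-trans (~-+-cong (toPol-red (-ₚ toPol u)) (~-refl {toPol u})) (≋⇒~ (-ₚ-inverseˡ (toPol u))))

    ⊗-distribˡ : ∀ u v w → u ⊗ (v ⊕ w) ≡ u ⊗ v ⊕ u ⊗ w
    ⊗-distribˡ u v w = trans
      (red-cong (~-trans (~-*-cong (~-refl {toPol u}) (toPol-red _)) (≋⇒~ (*ₚ-distribˡ (toPol u) (toPol v) (toPol w)))))
      (red-+ (toPol u *ₚ toPol v) (toPol u *ₚ toPol w))

    -- A Euclidean descent in which N bounds the degree. Write f = r + p q. If r = 0, irreducibility
    -- makes p constant. Otherwise r has smaller degree than p and is congruent to -p q, so an
    -- inverse w of r yields the inverse -q w of p.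
    invert : ∀ N p → deg p < N → Top p (deg p) (coeff p (deg p)) → ¬ (coeff p (deg p) ≡ 0#) →
      deg p < k → ∃ λ w → p *ₚ w ~ 1ₚ
    invert (suc N) p (s≤s deg≤N) p-top lead≢0 deg<k with inverse _ lead≢0
    ... | c⁻¹ , cc⁻¹≡1 = go (deg-spec r)
      where
      module P = Division p (deg p) (coeff p (deg p)) c⁻¹ p-top cc⁻¹≡1
      r q : Pol
      r = P.rem f
      q = P.quot f
      go : r ≋ [] ⊎ (Top r (deg r) (coeff r (deg r)) × ¬ (coeff r (deg r) ≡ 0#)) → ∃ λ w → p *ₚ w ~ 1ₚ
      go (inj₁ r≋0) = exact (proj₂ f-irr p q (at (≋-sym f≋pq)))
        where
        f≋pq : f ≋ p *ₚ q
        f≋pq = ≋-trans (P.division f) (+ₚ-cong r≋0 (≋-refl {p *ₚ q}))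
        exact : deg p ≡ 0 ⊎ deg q ≡ 0 → ∃ λ w → p *ₚ w ~ 1ₚ
        exact (inj₁ deg≡0) = c⁻¹ ∷ [] , ≋⇒~ (≋-trans
          (*ₚ-cong (constant p (subst (λ d → Top p d (coeff p (deg p))) deg≡0 p-top)) (≋-refl {c⁻¹ ∷ []}))
          (∷-cong (trans (+-identityʳ _) cc⁻¹≡1) ≋-refl))
        -- A constant q is impossible: q = 0 would make f zero, and a nonzero constant would give
        -- deg f = deg p, against deg p < k.
        exact (inj₂ deg≡0) with deg-spec q
        ... | inj₁ q≋0 = ⊥-elim (0≢1 (trans (sym (at (≋-trans f≋pq (≋-trans (*ₚ-cong (≋-refl {p}) q≋0) (*ₚ-zeroʳ p))) k)) (proj₁ f-top)))
        ... | inj₂ (q-top , q≢0) = ⊥-elim (ℕₚ.<-irrefl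
          (sym (trans (proj₁ (Top-unique f≋pq f-top (Top-* p q p-top q-top) (λ e → 0≢1 (sym e)) (nonzero-product lead≢0 q≢0)))
            (trans (cong (deg p +ℕ_) deg≡0) (ℕₚ.+-identityʳ _)))) deg<k)
      go (inj₂ (r-top , r≢0)) = -ₚ (q *ₚ w) , (begin
        p *ₚ (-ₚ (q *ₚ w))                 ≈⟨ ≋⇒~ (≋-sym (PRing.-‿distribʳ-* p (q *ₚ w))) ⟩
        -ₚ (p *ₚ (q *ₚ w))                 ≈⟨ ~-neg-cong (≋⇒~ (≋-sym (*ₚ-assoc p q w))) ⟩
        -ₚ ((p *ₚ q) *ₚ w)                 ≈⟨ ≋⇒~ (PRing.-‿distribˡ-* (p *ₚ q) w) ⟩
        (-ₚ (p *ₚ q)) *ₚ w                 ≈⟨ ~-*-cong r~-pq (~-refl {w}) ⟨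
        r *ₚ w                             ≈⟨ proj₂ rec ⟩
        1ₚ                                 ∎)
        where
        open ~-Reasoning
        deg-r<deg-p : deg r < deg p
        deg-r<deg-p = ℕₚ.≰⇒> λ deg-p≤deg-r → r≢0 (P.rem-bound f (deg r) deg-p≤deg-r)
        rec : ∃ λ w → r *ₚ w ~ 1ₚ
        rec = invert N r (ℕₚ.≤-trans deg-r<deg-p deg≤N) r-top r≢0 (ℕₚ.<-trans deg-r<deg-p deg<k)
        w : Pol
        w = proj₁ rec
        r+pq~0 : r +ₚ p *ₚ q ~ []
        r+pq~0 = mk~ 1ₚ (≋-trans (≋-sym (P.division f)) (≋-sym (*ₚ-identityʳ f)))
        r~-pq : r ~ -ₚ (p *ₚ q)
        r~-pq = begin
          r                                     ≈⟨ ≋⇒~ (+ₚ-identityʳ r) ⟨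
          r +ₚ []                               ≈⟨ ≋⇒~ (+ₚ-cong (≋-refl {r}) (-ₚ-inverseʳ (p *ₚ q))) ⟨
          r +ₚ (p *ₚ q +ₚ (-ₚ (p *ₚ q)))        ≈⟨ ≋⇒~ (+ₚ-assoc r (p *ₚ q) (-ₚ (p *ₚ q))) ⟨
          (r +ₚ p *ₚ q) +ₚ (-ₚ (p *ₚ q))        ≈⟨ ~-+-cong r+pq~0 (~-refl { -ₚ (p *ₚ q)}) ⟩
          -ₚ (p *ₚ q)                           ∎

    ⊗-inverse : ∀ u → ¬ (u ≡ red []) → ∃ λ v → u ⊗ v ≡ red 1ₚ
    ⊗-inverse u u≢0 with deg-spec (toPol u)
    ... | inj₁ u≋0 = ⊥-elim (u≢0 (trans (sym (red-toPol u)) (red-cong (≋⇒~ u≋0))))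
    ... | inj₂ (top , lead≢0) with invert (suc (deg (toPol u))) (toPol u) ℕₚ.≤-refl top lead≢0
                                    (ℕₚ.≰⇒> λ k≤deg → lead≢0 (toPol-bound u _ k≤deg))
    ...   | w , uw~1 = red w , red-cong (~-trans (~-*-cong (~-refl {toPol u}) (toPol-red w)) uw~1)

    -- As deg f is at least 1, the polynomial 1 is already reduced; if it were congruent to 0 it
    -- would be 0 in F[x].
    red0≢red1 : ¬ (red [] ≡ red 1ₚ)
    red0≢red1 e = 0≢1 (sym (at (~0⇒≋0 1ₚ bound (red-injective (sym e))) 0))
      where
      bound : ∀ i → k ≤ i → coeff 1ₚ i ≡ 0#
      bound zero    k≤0 = ⊥-elim (ℕₚ.<-irrefl refl (ℕₚ.≤-trans (proj₁ f-irr) k≤0))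
      bound (suc i) _   = refl

  K : FiniteField
  K = record
    { Carrier = Vec Carrier k ; _+_ = _⊕_ ; _*_ = _⊗_ ; -_ = ⊖_ ; 0# = red [] ; 1# = red 1ₚ
    ; isCommutativeRing = record
      { isRing = record
        { +-isAbelianGroup = record
          { isGroup = record
            { isMonoid = record
              { isSemigroup = record
                { isMagma = record { isEquivalence = isEquivalence ; ∙-cong = cong₂ _⊕_ }
                ; assoc = ⊕-assoc }
              ; identity = ⊕-identityˡ , λ u → trans (⊕-comm u (red [])) (⊕-identityˡ u) }
            ; inverse = ⊖-inverseˡ , λ u → trans (⊕-comm u (⊖ u)) (⊖-inverseˡ u)
            ; ⁻¹-cong = cong ⊖_ }
          ; comm = ⊕-comm }
        ; *-cong = cong₂ _⊗_
        ; *-assoc = ⊗-assoc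
        ; *-identity = ⊗-identityˡ , λ u → trans (⊗-comm u (red 1ₚ)) (⊗-identityˡ u)
        ; distrib = ⊗-distribˡ , λ u v w → trans (⊗-comm (v ⊕ w) u)
            (trans (⊗-distribˡ u v w) (cong₂ _⊕_ (⊗-comm u v) (⊗-comm u w))) }
      ; *-comm = ⊗-comm }
    ; 0≢1 = red0≢red1
    ; inverse = ⊗-inverse
    ; _≟_ = Vecₚ.≡-dec _≟_
    ; size = size ^ℕ k
    ; enum = vec-enum k }

  ι : Carrier → Vec Carrier k
  ι a = red (a ∷ [])

  ι-hom : IsFieldHom F K ι
  ι-hom = record
    { hom-+ = λ a b → red-+ (a ∷ []) (b ∷ [])
    ; hom-* = λ a b → trans (red-cong (≋⇒~ (∷-cong (sym (+-identityʳ (a * b))) ≋-refl))) (red-* (a ∷ []) (b ∷ []))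
    ; hom-1 = refl }

  α : Vec Carrier k
  α = red (0# ∷ 1# ∷ [])

  open Evaluation F K ι ι-hom using (ev)

  -- Evaluation at α is reduction modulo f. Hence every element of K is a polynomial in α, and the
  -- polynomials vanishing at α are the multiples of f.
  ev-α : ∀ p → ev α p ≡ red p
  ev-α []      = refl
  ev-α (a ∷ p) = begin
    red (a ∷ []) ⊕ (α ⊗ ev α p)                   ≡⟨ cong (λ z → red (a ∷ []) ⊕ (α ⊗ z)) (ev-α p) ⟩
    red (a ∷ []) ⊕ (α ⊗ red p)                    ≡⟨ cong (red (a ∷ []) ⊕_) (red-* (0# ∷ 1ₚ) p) ⟨
    red (a ∷ []) ⊕ red ((0# ∷ 1ₚ) *ₚ p)           ≡⟨ red-+ (a ∷ []) ((0# ∷ 1ₚ) *ₚ p) ⟨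
    red ((a ∷ []) +ₚ (0# ∷ 1ₚ) *ₚ p)              ≡⟨ red-cong (≋⇒~ (≋-trans (+ₚ-cong (≋-refl {a ∷ []}) (≋-trans (0∷-* 1ₚ p) (∷-cong refl (*ₚ-identityˡ p))))
                                                       (∷-cong (+-identityʳ a) ≋-refl))) ⟩
    red (a ∷ p)                                   ∎
    where open ≡-Reasoning

  α-root : ev α f ≡ FiniteField.0# K
  α-root = trans (ev-α f) (red-cong (mk~ 1ₚ (≋-sym (*ₚ-identityʳ f))))

  α-surjective : ∀ v → ∃ λ p → ev α p ≡ v
  α-surjective v = toPol v , trans (ev-α (toPol v)) (red-toPol v)

  α-minimal : ∀ p → ev α p ≡ FiniteField.0# K → ∃ λ m → p ≋ f *ₚ m
  α-minimal p e with red-injective {p} {[]} (trans (sym (ev-α p)) e)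
  ... | mk~ m p≋fm = m , p≋fm

-- Roots and linear factors; the splitting of x^N - 1 for an element of order N.

module LinearFactors (K : FiniteField) where
  open FiniteField K
  open Poly K hiding (_*)
  open FieldProperties K
  open PolyProperties K
  open PolyDegree K
  open Evaluation K K (λ a → a) (idHom K) public
    using (ev; ev-cong; ev-*; ev-1; ev-[Xᵏ-1])

  lin : Carrier → Pol
  lin a = (- a) ∷ 1# ∷ []

  ev-lin : ∀ b a → ev b (lin a) ≡ b + - a
  ev-lin b a = trans (cong (λ z → - a + b * z) (ev-1 b)) (trans (cong (- a +_) (*-identityʳ b)) (+-comm _ _))

  lin-top : ∀ a → Top (lin a) 1 1#
  lin-top a = refl , λ { (suc (suc i)) _ → refl ; (suc zero) (s≤s ()) }

  const-top : ∀ c → Top (c ∷ []) 0 c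
  const-top c = refl , λ { (suc i) _ → refl }

  -- The case of constants is separate so that the quotient loses exactly one entry of the list.
  synth : Carrier → Pol → Pol
  synth a []          = []
  synth a (c ∷ [])    = []
  synth a (c ∷ d ∷ p) = ev a (d ∷ p) ∷ synth a (d ∷ p)

  length-synth : ∀ a c p → length (synth a (c ∷ p)) ≡ length p
  length-synth a c []      = refl
  length-synth a c (d ∷ p) = cong suc (length-synth a d p)

  -- Synthetic division by x - a: the coefficients of the quotient are the Horner values at a of the
  -- successive tails of p, and the remainder is the value of p itself.
  synth-spec : ∀ a p → p ≋ lin a *ₚ synth a p +ₚ (ev a p ∷ [])
  synth-spec a []          = ≋-sym (≋-trans (+ₚ-cong (*ₚ-zeroʳ (lin a)) (∷-zero ≋-refl)) ≋-refl)
  synth-spec a (c ∷ [])    = ≋-sym (≋-trans (+ₚ-cong (*ₚ-zeroʳ (lin a)) ≋-refl)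
    (∷-cong (trans (cong (c +_) (zeroʳ a)) (+-identityʳ c)) ≋-refl))
  synth-spec a (c ∷ d ∷ p) = ≋-sym (begin
    lin a *ₚ (e ∷ Q) +ₚ (c + a * e ∷ [])
      ≈⟨ +ₚ-cong (*ₚ-∷ (lin a) e Q) (≋-refl {c + a * e ∷ []}) ⟩
    ((e * - a ∷ e * 1# ∷ []) +ₚ (0# ∷ lin a *ₚ Q)) +ₚ (c + a * e ∷ [])
      ≈⟨ ∷-cong head-eq (begin
           ((e * 1# ∷ []) +ₚ lin a *ₚ Q) +ₚ []     ≈⟨ +ₚ-identityʳ ((e * 1# ∷ []) +ₚ lin a *ₚ Q) ⟩
           (e * 1# ∷ []) +ₚ lin a *ₚ Q             ≈⟨ +ₚ-comm (e * 1# ∷ []) (lin a *ₚ Q) ⟩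
           lin a *ₚ Q +ₚ (e * 1# ∷ [])             ≈⟨ +ₚ-cong (≋-refl {lin a *ₚ Q}) (∷-cong (*-identityʳ e) ≋-refl) ⟩
           lin a *ₚ Q +ₚ (e ∷ [])                  ≈⟨ synth-spec a (d ∷ p) ⟨
           d ∷ p                                   ∎) ⟩
    c ∷ d ∷ p ∎)
    where
    open ≋-Reasoning
    e : Carrier
    e = ev a (d ∷ p)
    Q : Pol
    Q = synth a (d ∷ p)
    head-eq : (e * - a + 0#) + (c + a * e) ≡ c
    head-eq = trans (cong (_+ (c + a * e)) (trans (+-identityʳ _) (trans (sym (-‿distribʳ-* e a)) (cong -_ (*-comm e a)))))
      (trans (+-comm _ _) (trans (+-assoc c _ _) (trans (cong (c +_) (-‿inverseʳ _)) (+-identityʳ c))))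

  factor-root : ∀ a p → ev a p ≡ 0# → p ≋ lin a *ₚ synth a p
  factor-root a p e = ≋-trans (synth-spec a p)
    (≋-trans (+ₚ-cong (≋-refl {lin a *ₚ synth a p}) (≋-trans (∷-cong e ≋-refl) (∷-zero ≋-refl))) (+ₚ-identityʳ _))

  -- The degree is tracked by the length of the coefficient list. Each division by x - a removes one
  -- entry and keeps the other roots, which differ from a; the single entry left at the end is the
  -- constant.
  split-by-roots : ∀ as p → Unique as → length p ≡ suc (length as) → (∀ a → a ∈ as → ev a p ≡ 0#) →
    ∃ λ c → p ≋ linProd as *ₚ (c ∷ [])
  split-by-roots [] (c ∷ []) _ _ _ = c , ≋-sym (*ₚ-identityˡ (c ∷ []))
  split-by-roots (a ∷ as) (x ∷ p) (a∉as AllPairs.∷ uniq) len roots =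
    proj₁ rec , ≋-trans factored
      (≋-trans (*ₚ-cong (≋-refl {lin a}) (proj₂ rec)) (≋-sym (*ₚ-assoc (lin a) (linProd as) (proj₁ rec ∷ []))))
    where
    open ≡-Reasoning
    Q : Pol
    Q = synth a (x ∷ p)
    factored : x ∷ p ≋ lin a *ₚ Q
    factored = factor-root a (x ∷ p) (roots a (here refl))
    product-root : ∀ b → b ∈ as → (b + - a) * ev b Q ≡ 0#
    product-root b b∈as = begin
      (b + - a) * ev b Q        ≡⟨ cong (_* ev b Q) (ev-lin b a) ⟨
      ev b (lin a) * ev b Q     ≡⟨ ev-* b (lin a) Q ⟨
      ev b (lin a *ₚ Q)         ≡⟨ ev-cong b factored ⟨
      ev b (x ∷ p)              ≡⟨ roots b (there b∈as) ⟩
      0#                        ∎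
    quotient-root : ∀ b → b ∈ as → ev b Q ≡ 0#
    quotient-root b b∈as =
      [ (λ b-a≡0 → ⊥-elim (All.lookup a∉as b∈as (sym (x-y≈0⇒x≈y b a b-a≡0)))) , (λ z → z) ]′
        (integral (b + - a) (ev b Q) (product-root b b∈as))
    rec : ∃ λ c → Q ≋ linProd as *ₚ (c ∷ [])
    rec = split-by-roots as Q uniq (trans (length-synth a x p) (cong (_∸ 1) len)) quotient-root

  -- Unique factorisation in the only form required. Each listed a is a root of u v, hence of u or
  -- of v; x - a is divided out of that factor and cancelled on both sides. When the list is
  -- exhausted u v is a nonzero constant, and so u is constant.
  divisor-splits : ∀ as u v c → ¬ (c ≡ 0#) → u *ₚ v ≋ linProd as *ₚ (c ∷ []) →
    ∃ λ bs → ∃ λ e → u ≋ linProd bs *ₚ (e ∷ [])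
  divisor-splits [] u v c c≢0 uv≋c with deg-spec u | deg-spec v
  ... | inj₁ u≋0 | _ = ⊥-elim (c≢0 (sym (at (≋-trans (*ₚ-cong (≋-sym u≋0) (≋-refl {v})) (≋-trans uv≋c (*ₚ-identityˡ (c ∷ [])))) 0)))
  ... | inj₂ _ | inj₁ v≋0 = ⊥-elim (c≢0 (sym (at (≋-trans (≋-trans (≋-sym (*ₚ-zeroʳ u)) (*ₚ-cong (≋-refl {u}) (≋-sym v≋0))) (≋-trans uv≋c (*ₚ-identityˡ (c ∷ [])))) 0)))
  ... | inj₂ (u-top , u≢0) | inj₂ (v-top , v≢0) =
    [] , coeff u (deg u) , ≋-trans (constant u (subst (λ d → Top u d (coeff u (deg u))) deg≡0 u-top)) (≋-sym (*ₚ-identityˡ _))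
    where
    deg≡0 : deg u ≡ 0
    deg≡0 = ℕₚ.m+n≡0⇒m≡0 (deg u) (proj₁ (Top-unique (≋-trans uv≋c (*ₚ-identityˡ (c ∷ [])))
      (Top-* u v u-top v-top) (const-top c) (nonzero-product u≢0 v≢0) c≢0))
  divisor-splits (a ∷ as) u v c c≢0 e =
    [ left , right ]′ (integral (ev a u) (ev a v) (trans (sym (ev-* a u v)) (trans (ev-cong a e′)
      (trans (ev-* a (lin a) P) (trans (cong (_* ev a P) (trans (ev-lin a a) (-‿inverseʳ a))) (zeroˡ _))))))
    where
    open ≋-Reasoning
    open PSolver using (_:*_; _:=_)
    P : Pol
    P = linProd as *ₚ (c ∷ [])
    e′ : u *ₚ v ≋ lin a *ₚ P
    e′ = ≋-trans e (*ₚ-assoc (lin a) (linProd as) (c ∷ []))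
    cancel : ∀ w → lin a *ₚ w ≋ u *ₚ v → w ≋ P
    cancel w eq = *ₚ-cancelˡ (lin a) w P (lin-top a) (λ z → 0≢1 (sym z)) (≋-trans eq e′)
    left : ev a u ≡ 0# → ∃ λ bs → ∃ λ d → u ≋ linProd bs *ₚ (d ∷ [])
    left u-root = let (bs , d , eq) = rec in a ∷ bs , d ,
      ≋-trans u-eq (≋-trans (*ₚ-cong (≋-refl {lin a}) eq) (≋-sym (*ₚ-assoc (lin a) (linProd bs) (d ∷ []))))
      where
      u-eq : u ≋ lin a *ₚ synth a u
      u-eq = factor-root a u u-root
      rec : ∃ λ bs → ∃ λ d → synth a u ≋ linProd bs *ₚ (d ∷ [])
      rec = divisor-splits as (synth a u) v c c≢0 (cancel (synth a u *ₚ v) (begin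
        lin a *ₚ (synth a u *ₚ v)           ≈⟨ *ₚ-assoc (lin a) (synth a u) v ⟨
        (lin a *ₚ synth a u) *ₚ v           ≈⟨ *ₚ-cong u-eq (≋-refl {v}) ⟨
        u *ₚ v                              ∎))
    right : ev a v ≡ 0# → ∃ λ bs → ∃ λ d → u ≋ linProd bs *ₚ (d ∷ [])
    right v-root = divisor-splits as u (synth a v) c c≢0 (cancel (u *ₚ synth a v) (begin
      lin a *ₚ (u *ₚ synth a v)           ≈⟨ PSolver.solve 3 (λ x y z → x :* (y :* z) := y :* (x :* z)) ≋-refl (lin a) u (synth a v) ⟩
      u *ₚ (lin a *ₚ synth a v)           ≈⟨ *ₚ-cong (≋-refl {u}) (factor-root a v v-root) ⟨
      u *ₚ v                              ∎))

  linProd-top : ∀ as → Top (linProd as) (length as) 1#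
  linProd-top []       = const-top 1#
  linProd-top (a ∷ as) = subst (Top (linProd (a ∷ as)) _) (*-identityˡ 1#) (Top-* (lin a) (linProd as) (lin-top a) (linProd-top as))

  monic-split : ∀ u d bs e → Top u d 1# → u ≋ linProd bs *ₚ (e ∷ []) → u ≋ linProd bs
  monic-split u d bs e u-top eq with e ≟ 0#
  ... | yes e≡0 = ⊥-elim (0≢1 (trans (sym (at (≋-trans eq (≋-trans (*ₚ-cong (≋-refl {linProd bs})
                    (≋-trans (∷-cong e≡0 ≋-refl) (∷-zero ≋-refl))) (*ₚ-zeroʳ (linProd bs)))) d)) (proj₁ u-top)))
  ... | no e≢0 = ≋-trans eq (≋-trans (*ₚ-cong (≋-refl {linProd bs}) (∷-cong (sym 1≡e) ≋-refl)) (*ₚ-identityʳ (linProd bs)))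
    where
    1≡e : 1# ≡ e
    1≡e = trans (proj₂ (Top-unique eq u-top (Top-* (linProd bs) (e ∷ []) (linProd-top bs) (const-top e))
      (λ z → 0≢1 (sym z)) (nonzero-product (λ z → 0≢1 (sym z)) e≢0))) (*-identityˡ e)

  root⇒∈ : ∀ a as → ev a (linProd as) ≡ 0# → a ∈ as
  root⇒∈ a []       e = ⊥-elim (0≢1 (trans (sym e) (ev-1 a)))
  root⇒∈ a (b ∷ as) e =
    [ (λ z → here (x-y≈0⇒x≈y a b (trans (sym (ev-lin a b)) z))) , (λ z → there (root⇒∈ a as z)) ]′
      (integral (ev a (lin b)) (ev a (linProd as)) (trans (sym (ev-* a (lin b) (linProd as))) e))

  ∈⇒root : ∀ a as → a ∈ as → ev a (linProd as) ≡ 0#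
  ∈⇒root a (b ∷ as) (here refl) = trans (ev-* a (lin a) (linProd as))
    (trans (cong (_* ev a (linProd as)) (trans (ev-lin a a) (-‿inverseʳ a))) (zeroˡ _))
  ∈⇒root a (b ∷ as) (there a∈as) = trans (ev-* a (lin b) (linProd as))
    (trans (cong (ev a (lin b) *_) (∈⇒root a as a∈as)) (zeroʳ _))

  -- The order is `suc N`, so that N ranges over all of ℕ. The descent replaces an exponent by any
  -- smaller positive one that works, until none is left.
  order : ∀ a n .{{_ : NonZero n}} → a ^ n ≡ 1# →
    ∃ λ N → a ^ suc N ≡ 1# × (∀ m → m < N → ¬ (a ^ suc m ≡ 1#))
  order a (suc n) = <-rec (λ n → a ^ suc n ≡ 1# → ∃ λ N → a ^ suc N ≡ 1# × (∀ m → m < N → ¬ (a ^ suc m ≡ 1#)))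
    step n
    where
    step : ∀ n → (∀ {m} → m < n → a ^ suc m ≡ 1# → ∃ λ N → a ^ suc N ≡ 1# × (∀ m → m < N → ¬ (a ^ suc m ≡ 1#))) →
      a ^ suc n ≡ 1# → ∃ λ N → a ^ suc N ≡ 1# × (∀ m → m < N → ¬ (a ^ suc m ≡ 1#))
    step n rec e with ℕₚ.anyUpTo? (λ m → (a ^ suc m) ≟ 1#) n
    ... | yes (m , m<n , e′) = rec m<n e′
    ... | no minimal = n , e , λ m m<n e′ → minimal (m , m<n , e′)

  powers : Carrier → ℕ → List Carrier
  powers a N = applyUpTo (a ^_) N

  -- Cancelling a^i from a^i = a^j with i < j leaves a^(j - i) = 1, where j - i is positive and at
  -- most N, hence below the order.
  powers-unique : ∀ a N → ¬ (a ≡ 0#) → (∀ m → m < N → ¬ (a ^ suc m ≡ 1#)) → Unique (powers a (suc N))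
  powers-unique a N a≢0 minimal = Uniqueₚ.applyUpTo⁺₁ (a ^_) (suc N) distinct
    where
    distinct : ∀ {i j} → i < j → j < suc N → ¬ (a ^ i ≡ a ^ j)
    distinct {i} {j} i<j (s≤s j≤N) e with ℕₚ.m≤n⇒∃[o]m+o≡n i<j
    ... | o , refl = minimal o (ℕₚ.≤-trans (s≤s (ℕₚ.m≤n+m o i)) j≤N)
      (sym (*-cancelˡ (a ^ i) (^-≢0 a a≢0 i) (trans (*-identityʳ _)
        (trans e (trans (cong (a ^_) (sym (ℕₚ.+-suc i o))) (^-+ a i (suc o)))))))

  length-+ₚ : ∀ p c d → length ((c ∷ p) +ₚ (d ∷ [])) ≡ suc (length p)
  length-+ₚ []      c d = refl
  length-+ₚ (_ ∷ _) c d = refl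

  length-[Xⁿ-1] : ∀ N → length (X^ (suc N) -ₚ 1ₚ) ≡ suc (suc N)
  length-[Xⁿ-1] N = trans (length-+ₚ (X^ N) 0# (- 1#)) (cong suc (length-X^ N))
    where
    length-X^ : ∀ N → length (X^ N) ≡ suc N
    length-X^ zero    = refl
    length-X^ (suc N) = cong suc (length-X^ N)

  lead-X^ : ∀ N → coeff (X^ N) N ≡ 1#
  lead-X^ zero    = refl
  lead-X^ (suc N) = lead-X^ N

  -- Because the exponent is the exact order of a, the powers of a are `suc N` distinct roots, as
  -- many as the degree. The constant c is nonzero since x^(N + 1) - 1 has leading coefficient 1.
  [Xⁿ-1]-splits : ∀ a N → ¬ (a ≡ 0#) → a ^ suc N ≡ 1# → (∀ m → m < N → ¬ (a ^ suc m ≡ 1#)) →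
    ∃ λ c → ¬ (c ≡ 0#) × X^ (suc N) -ₚ 1ₚ ≋ linProd (powers a (suc N)) *ₚ (c ∷ [])
  [Xⁿ-1]-splits a N a≢0 aᴺ≡1 minimal = proj₁ split , c≢0 , proj₂ split
    where
    open ≡-Reasoning
    P : Pol
    P = linProd (powers a (suc N))
    roots : ∀ b → b ∈ powers a (suc N) → ev b (X^ (suc N) -ₚ 1ₚ) ≡ 0#
    roots b b∈ with ∈ₚ.∈-applyUpTo⁻ (a ^_) b∈
    ... | i , _ , refl = trans (ev-[Xᵏ-1] (a ^ i) (suc N))
      (x≈y⇒x-y≈0 (trans (^-swap a i (suc N)) (trans (cong (_^ i) aᴺ≡1) (1^ i))))
    split : ∃ λ c → X^ (suc N) -ₚ 1ₚ ≋ P *ₚ (c ∷ [])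
    split = split-by-roots (powers a (suc N)) (X^ (suc N) -ₚ 1ₚ)
      (powers-unique a N a≢0 minimal)
      (trans (length-[Xⁿ-1] N) (cong suc (sym (Listₚ.length-applyUpTo (a ^_) (suc N)))))
      roots
    c≢0 : ¬ (proj₁ split ≡ 0#)
    c≢0 c≡0 = 0≢1 (sym (begin
      1#                                               ≡⟨ +-identityʳ 1# ⟨
      1# + 0#                                          ≡⟨ cong₂ _+_ (lead-X^ N) -0#≈0# ⟨
      coeff (X^ (suc N)) (suc N) + - coeff 1ₚ (suc N)  ≡⟨ coeff-- (X^ (suc N)) 1ₚ (suc N) ⟨
      coeff (X^ (suc N) -ₚ 1ₚ) (suc N)                 ≡⟨ at (≋-trans (proj₂ split) (≋-trans (*ₚ-congˡ P
                                                            (≋-trans (∷-cong c≡0 ≋-refl) (∷-zero ≋-refl))) (*ₚ-zeroʳ P))) (suc N) ⟩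
      0#                                               ∎))

-- From self-involutivity to f(α^s) = 0.

module SelfInvolutiveRoot (F K : FiniteField) (ι : FiniteField.Carrier F → FiniteField.Carrier K) (hom : IsFieldHom F K ι)
  (f : Poly.Pol F) (α : FiniteField.Carrier K)
  (α-minimal : ∀ p → Evaluation.ev F K ι hom α p ≡ FiniteField.0# K → ∃ λ m → PolyProperties._≋_ F p (Poly._*ₚ_ F f m))
  (f-top : PolyDegree.Top F f (Poly.deg F f) (FiniteField.1# F)) where
  open FiniteField K
  open FieldProperties K
  private
    module PF = Poly F
    module PPF = PolyProperties F
    module Ev = Evaluation F K ι hom
  open Poly K hiding (_*)
  open PolyProperties K
  open PolyDegree K using (Top)
  open LinearFactors K

  ev-map : ∀ β p → ev β (map ι p) ≡ Ev.ev β p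
  ev-map β []      = refl
  ev-map β (a ∷ p) = cong (λ z → ι a + β * z) (ev-map β p)

  map-top : Top (map ι f) (PF.deg f) 1#
  map-top = trans (Ev.coeff-map f _) (trans (cong ι (proj₁ f-top)) Ev.hom-1) ,
    λ i d<i → trans (Ev.coeff-map f i) (trans (cong ι (proj₂ f-top i d<i)) Ev.hom-0)

  -- The exponent n serves only to find the order of α. Since α is a root of x^N - 1 for N its
  -- order, f divides that polynomial, and the powers of α exhaust its roots.
  f-splits : ∀ n .{{_ : NonZero n}} → ¬ (α ≡ 0#) → α ^ n ≡ 1# → ∃ λ as → map ι f ≋ linProd as
  f-splits n α≢0 αⁿ≡1 = go₁ (order α n αⁿ≡1)
    where
    open ≋-Reasoning
    product : ∀ N m → PF.X^ (suc N) PF.-ₚ PF.1ₚ PPF.≋ f PF.*ₚ m → map ι f *ₚ map ι m ≋ X^ (suc N) -ₚ 1ₚ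
    product N m e = begin
      map ι f *ₚ map ι m                    ≡⟨ Ev.map-* f m ⟨
      map ι (f PF.*ₚ m)                     ≈⟨ Ev.map-cong e ⟨
      map ι (PF.X^ (suc N) PF.-ₚ PF.1ₚ)     ≡⟨ Ev.map-[Xᵏ-1] (suc N) ⟩
      X^ (suc N) -ₚ 1ₚ                      ∎
    go₃ : (∃ λ bs → ∃ λ e → map ι f ≋ linProd bs *ₚ (e ∷ [])) → ∃ λ as → map ι f ≋ linProd as
    go₃ (bs , e , eq) = bs , monic-split (map ι f) (PF.deg f) bs e map-top eq
    go₂ : ∀ N → (∃ λ c → ¬ (c ≡ 0#) × X^ (suc N) -ₚ 1ₚ ≋ linProd (powers α (suc N)) *ₚ (c ∷ [])) →
      (∃ λ m → PF.X^ (suc N) PF.-ₚ PF.1ₚ PPF.≋ f PF.*ₚ m) → ∃ λ as → map ι f ≋ linProd as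
    go₂ N (c , c≢0 , split) (m , e) =
      go₃ (divisor-splits (powers α (suc N)) (map ι f) (map ι m) c c≢0 (≋-trans (product N m e) split))
    go₁ : (∃ λ N → α ^ suc N ≡ 1# × (∀ m → m < N → ¬ (α ^ suc m ≡ 1#))) → ∃ λ as → map ι f ≋ linProd as
    go₁ (N , αᴺ≡1 , minimal) = go₂ N ([Xⁿ-1]-splits α N α≢0 αᴺ≡1 minimal)
      (α-minimal (PF.X^ (suc N) PF.-ₚ PF.1ₚ) (trans (Ev.ev-[Xᵏ-1] α (suc N)) (x≈y⇒x-y≈0 αᴺ≡1)))

  -- `SelfInvolutive` is instantiated at K itself with the list of roots from `f-splits`. That list
  -- contains α because f(α) = 0, so it contains α^s as well.
  αˢ-root : ∀ n s .{{_ : NonZero n}} → ¬ (α ≡ 0#) → α ^ n ≡ 1# → Ev.ev α f ≡ 0# →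
    SelfInvolutive F s f → Ev.ev (α ^ s) f ≡ 0#
  αˢ-root n s α≢0 αⁿ≡1 root self = go (f-splits n α≢0 αⁿ≡1)
    where
    open ≡-Reasoning
    go : (∃ λ as → map ι f ≋ linProd as) → Ev.ev (α ^ s) f ≡ 0#
    go (as , split) = begin
      Ev.ev (α ^ s) f            ≡⟨ ev-map (α ^ s) f ⟨
      ev (α ^ s) (map ι f)       ≡⟨ ev-cong (α ^ s) split ⟩
      ev (α ^ s) (linProd as)    ≡⟨ ∈⇒root (α ^ s) as (proj₁ (self K ι hom as (at split)) α α∈as) ⟩
      0#                         ∎
      where
      α∈as : α ∈ as
      α∈as = root⇒∈ α as (trans (sym (ev-cong α split)) (trans (ev-map α f) root))

-- Finite sums indexed by G.

module GroupSums (K : FiniteField) (n s : ℕ) .{{_ : NonZero n}} where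
  open FiniteField K
  open FieldProperties K
  open GroupAlgebra K n s using (G; _·G_; _≟G_; _⋆_; sumFin; sumG)

  sumFin-cong : ∀ {m} {f g : Fin m → Carrier} → (∀ i → f i ≡ g i) → sumFin f ≡ sumFin g
  sumFin-cong {zero}  e = refl
  sumFin-cong {suc m} e = cong₂ _+_ (e Fin.zero) (sumFin-cong λ i → e (Fin.suc i))

  sumFin-0 : ∀ m → sumFin {m} (λ _ → 0#) ≡ 0#
  sumFin-0 zero    = refl
  sumFin-0 (suc m) = trans (+-identityˡ _) (sumFin-0 m)

  sumFin-+ : ∀ {m} (f g : Fin m → Carrier) → sumFin (λ i → f i + g i) ≡ sumFin f + sumFin g
  sumFin-+ {zero}  f g = sym (+-identityˡ 0#)
  sumFin-+ {suc m} f g = trans (cong (f Fin.zero + g Fin.zero +_) (sumFin-+ (λ i → f (Fin.suc i)) (λ i → g (Fin.suc i))))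
    (+-interchange _ _ _ _)

  sumFin-*ˡ : ∀ {m} c (f : Fin m → Carrier) → sumFin (λ i → c * f i) ≡ c * sumFin f
  sumFin-*ˡ {zero}  c f = sym (zeroʳ c)
  sumFin-*ˡ {suc m} c f = trans (cong (c * f Fin.zero +_) (sumFin-*ˡ c (λ i → f (Fin.suc i)))) (sym (distribˡ c _ _))

  sumFin-swap : ∀ {m k} (f : Fin m → Fin k → Carrier) →
    sumFin (λ i → sumFin (λ j → f i j)) ≡ sumFin (λ j → sumFin (λ i → f i j))
  sumFin-swap {zero} {k} f = sym (sumFin-0 k)
  sumFin-swap {suc m}    f = trans (cong (sumFin (f Fin.zero) +_) (sumFin-swap (λ i → f (Fin.suc i))))
    (sym (sumFin-+ (f Fin.zero) (λ j → sumFin (λ i → f (Fin.suc i) j))))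

  sumFin-single : ∀ {m} (f : Fin m → Carrier) j → (∀ i → ¬ (i ≡ j) → f i ≡ 0#) → sumFin f ≡ f j
  sumFin-single {suc m} f Fin.zero    off = trans
    (cong (f Fin.zero +_) (trans (sumFin-cong λ i → off (Fin.suc i) λ ()) (sumFin-0 m))) (+-identityʳ _)
  sumFin-single {suc m} f (Fin.suc j) off = trans
    (cong₂ _+_ (off Fin.zero λ ()) (sumFin-single (λ i → f (Fin.suc i)) j λ i i≢j → off (Fin.suc i) λ e → i≢j (Finₚ.suc-injective e)))
    (+-identityˡ _)

  -- Sums over G are kept opaque: otherwise the sum over Fin 2 is unfolded during unification.
  abstract
    Σᴳ : (G → Carrier) → Carrier
    Σᴳ = sumG

    Σᴳ-def : (f : G → Carrier) → Σᴳ f ≡ sumFin (λ i → sumFin (λ j → f (i , j)))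
    Σᴳ-def f = refl

    ⋆-Σᴳ : ∀ a b g → (a ⋆ b) g ≡ Σᴳ (λ h → Σᴳ (λ h′ → if ⌊ (h ·G h′) ≟G g ⌋ then a h * b h′ else 0#))
    ⋆-Σᴳ a b g = refl

    Σᴳ-cong : {f g : G → Carrier} → (∀ h → f h ≡ g h) → Σᴳ f ≡ Σᴳ g
    Σᴳ-cong e = sumFin-cong λ i → sumFin-cong λ j → e (i , j)

    Σᴳ-+ : (f g : G → Carrier) → Σᴳ (λ h → f h + g h) ≡ Σᴳ f + Σᴳ g
    Σᴳ-+ f g = trans (sumFin-cong λ i → sumFin-+ (λ j → f (i , j)) (λ j → g (i , j)))
      (sumFin-+ {n} (λ i → sumFin (λ j → f (i , j))) (λ i → sumFin (λ j → g (i , j))))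

    Σᴳ-*ˡ : ∀ c (f : G → Carrier) → Σᴳ (λ h → c * f h) ≡ c * Σᴳ f
    Σᴳ-*ˡ c f = trans (sumFin-cong λ i → sumFin-*ˡ c (λ j → f (i , j))) (sumFin-*ˡ {n} c (λ i → sumFin (λ j → f (i , j))))

    Σᴳ-sumFin : ∀ {m} (f : G → Fin m → Carrier) →
      Σᴳ (λ h → sumFin (λ i → f h i)) ≡ sumFin (λ i → Σᴳ (λ h → f h i))
    Σᴳ-sumFin f = trans (sumFin-cong λ a → sumFin-swap (λ b → f (a , b)))
      (sumFin-swap (λ a i → sumFin (λ b → f (a , b) i)))

    Σᴳ-swap : (f : G → G → Carrier) →
      Σᴳ (λ g → Σᴳ (λ h → f g h)) ≡ Σᴳ (λ h → Σᴳ (λ g → f g h))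
    Σᴳ-swap f = trans (Σᴳ-sumFin (λ g i → sumFin (λ j → f g (i , j))))
      (sumFin-cong λ i → Σᴳ-sumFin (λ g j → f g (i , j)))

    Σᴳ-single : (f : G → Carrier) (u : G) → (∀ h → ¬ (h ≡ u) → f h ≡ 0#) → Σᴳ f ≡ f u
    Σᴳ-single f (i , j) off = trans
      (sumFin-single (λ a → sumFin (λ b → f (a , b))) i λ a a≢i →
        trans (sumFin-cong λ b → off (a , b) λ e → a≢i (cong proj₁ e)) (sumFin-0 2))
      (sumFin-single (λ b → f (i , b)) j λ b b≢j → off (i , b) λ e → b≢j (cong proj₂ e))

  Σᴳ-*ʳ : ∀ c (f : G → Carrier) → Σᴳ (λ h → f h * c) ≡ Σᴳ f * c
  Σᴳ-*ʳ c f = trans (Σᴳ-cong λ h → *-comm (f h) c) (trans (Σᴳ-*ˡ c f) (*-comm c (Σᴳ f)))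

  Σᴳ-*-Σᴳ : (f g : G → Carrier) → Σᴳ (λ h → Σᴳ (λ h′ → f h * g h′)) ≡ Σᴳ f * Σᴳ g
  Σᴳ-*-Σᴳ f g = trans (Σᴳ-cong λ h → Σᴳ-*ˡ (f h) g) (Σᴳ-*ʳ (Σᴳ g) f)

-- Associativity and unit of the multiplication on pairs of exponents.

module GroupLaws (F : FiniteField) (n s : ℕ) .{{_ : NonZero n}} (s²≡1 : (s *ℕ s) % n ≡ 1 % n) where
  open GroupAlgebra F n s using (_·G_; sPow)
  open ≡-Reasoning

  toℕ-mod : ∀ a m .{{_ : NonZero m}} → toℕ (a mod m) ≡ a % m
  toℕ-mod a m = Finₚ.toℕ-fromℕ< (m%n<n a m)

  mod-cong : ∀ m .{{_ : NonZero m}} {a b} → a % m ≡ b % m → a mod m ≡ b mod m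
  mod-cong m {a} {b} e = Finₚ.toℕ-injective (trans (toℕ-mod a m) (trans e (sym (toℕ-mod b m))))

  toℕ-mod-id : ∀ m .{{_ : NonZero m}} (i : Fin m) → toℕ i mod m ≡ i
  toℕ-mod-id m i = Finₚ.toℕ-injective (trans (toℕ-mod (toℕ i) m) (m<n⇒m%n≡m (Finₚ.toℕ<n i)))

  +-%-cong : ∀ m .{{_ : NonZero m}} {a a′ b b′} → a % m ≡ a′ % m → b % m ≡ b′ % m → (a +ℕ b) % m ≡ (a′ +ℕ b′) % m
  +-%-cong m {a} {a′} {b} {b′} e e′ = begin
    (a +ℕ b) % m               ≡⟨ %-distribˡ-+ a b m ⟩
    (a % m +ℕ b % m) % m       ≡⟨ cong₂ (λ x y → (x +ℕ y) % m) e e′ ⟩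
    (a′ % m +ℕ b′ % m) % m     ≡⟨ %-distribˡ-+ a′ b′ m ⟨
    (a′ +ℕ b′) % m             ∎

  *-%-cong : ∀ m .{{_ : NonZero m}} {a a′ b b′} → a % m ≡ a′ % m → b % m ≡ b′ % m → (a *ℕ b) % m ≡ (a′ *ℕ b′) % m
  *-%-cong m {a} {a′} {b} {b′} e e′ = begin
    (a *ℕ b) % m                 ≡⟨ %-distribˡ-* a b m ⟩
    ((a % m) *ℕ (b % m)) % m     ≡⟨ cong₂ (λ x y → (x *ℕ y) % m) e e′ ⟩
    ((a′ % m) *ℕ (b′ % m)) % m   ≡⟨ %-distribˡ-* a′ b′ m ⟨
    (a′ *ℕ b′) % m               ∎

  toℕ-mod-% : ∀ a m .{{_ : NonZero m}} → toℕ (a mod m) % m ≡ a % m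
  toℕ-mod-% a m = trans (cong (_% m) (toℕ-mod a m)) (m%n%n≡m%n a m)

  -- The exponent of y is reduced modulo 2, so conjugation by y has to square to the identity on
  -- powers of x. In the case y y = 1 this is exactly s² ≡ 1 mod n.
  sPow-+ : ∀ (j l : Fin 2) → sPow ((toℕ j +ℕ toℕ l) mod 2) % n ≡ (sPow j *ℕ sPow l) % n
  sPow-+ Fin.zero           Fin.zero           = refl
  sPow-+ Fin.zero           (Fin.suc Fin.zero) = cong (_% n) (sym (ℕₚ.*-identityˡ (s *ℕ 1)))
  sPow-+ (Fin.suc Fin.zero) Fin.zero           = cong (_% n) (sym (ℕₚ.*-identityʳ (s *ℕ 1)))
  sPow-+ (Fin.suc Fin.zero) (Fin.suc Fin.zero) =
    trans (sym s²≡1) (cong (_% n) (sym (cong₂ _*ℕ_ (ℕₚ.*-identityʳ s) (ℕₚ.*-identityʳ s))))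

  ·G-assoc : ∀ u v w → (u ·G v) ·G w ≡ u ·G (v ·G w)
  ·G-assoc (i , j) (k , l) (m , o) = cong₂ _,_ (mod-cong n (begin
    (toℕ ((I +ℕ S *ℕ A) mod n) +ℕ sPow ((toℕ j +ℕ toℕ l) mod 2) *ℕ M) % n
      ≡⟨ +-%-cong n (toℕ-mod-% (I +ℕ S *ℕ A) n) (*-%-cong n (sPow-+ j l) refl) ⟩
    (I +ℕ S *ℕ A +ℕ S *ℕ T *ℕ M) % n
      ≡⟨ cong (_% n) (trans (ℕₚ.+-assoc I _ _) (cong (λ z → I +ℕ (S *ℕ A +ℕ z)) (ℕₚ.*-assoc S T M))) ⟩
    (I +ℕ (S *ℕ A +ℕ S *ℕ (T *ℕ M))) % n
      ≡⟨ cong (λ z → (I +ℕ z) % n) (ℕₚ.*-distribˡ-+ S A (T *ℕ M)) ⟨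
    (I +ℕ S *ℕ (A +ℕ T *ℕ M)) % n
      ≡⟨ +-%-cong n {I} refl (*-%-cong n {S} refl (toℕ-mod-% (A +ℕ T *ℕ M) n)) ⟨
    (I +ℕ S *ℕ toℕ ((A +ℕ T *ℕ M) mod n)) % n ∎))
    (mod-cong 2 {toℕ ((toℕ j +ℕ toℕ l) mod 2) +ℕ toℕ o} {toℕ j +ℕ toℕ ((toℕ l +ℕ toℕ o) mod 2)} (begin
    (toℕ ((toℕ j +ℕ toℕ l) mod 2) +ℕ toℕ o) % 2   ≡⟨ +-%-cong 2 {toℕ ((toℕ j +ℕ toℕ l) mod 2)} {toℕ j +ℕ toℕ l} {toℕ o} (toℕ-mod-% (toℕ j +ℕ toℕ l) 2) refl ⟩
    (toℕ j +ℕ toℕ l +ℕ toℕ o) % 2                 ≡⟨ cong (_% 2) (ℕₚ.+-assoc (toℕ j) _ _) ⟩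
    (toℕ j +ℕ (toℕ l +ℕ toℕ o)) % 2               ≡⟨ +-%-cong 2 {toℕ j} {toℕ j} {toℕ ((toℕ l +ℕ toℕ o) mod 2)} {toℕ l +ℕ toℕ o} refl (toℕ-mod-% (toℕ l +ℕ toℕ o) 2) ⟨
    (toℕ j +ℕ toℕ ((toℕ l +ℕ toℕ o) mod 2)) % 2   ∎))
    where
    I A M S T : ℕ
    I = toℕ i
    A = toℕ k
    M = toℕ m
    S = sPow j
    T = sPow l

  x^a·x^b : ∀ a b (j : Fin 2) → (a mod n , 0 mod 2) ·G (b mod n , j) ≡ ((a +ℕ b) mod n , j)
  x^a·x^b a b j = cong₂ _,_
    (mod-cong n (+-%-cong n (toℕ-mod-% a n) (trans (cong (_% n) (ℕₚ.*-identityˡ (toℕ (b mod n)))) (toℕ-mod-% b n))))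
    (toℕ-mod-id 2 j)

  ·G-identityˡ : ∀ u → (0 mod n , 0 mod 2) ·G u ≡ u
  ·G-identityˡ (i , j) = subst (λ k → (0 mod n , 0 mod 2) ·G (k , j) ≡ (k , j)) (toℕ-mod-id n i) (x^a·x^b 0 (toℕ i) j)

  ·G-identityʳ : ∀ u → u ·G (0 mod n , 0 mod 2) ≡ u
  ·G-identityʳ (i , j) = cong₂ _,_
    (trans (mod-cong n (trans (+-%-cong n {toℕ i} refl (*-%-cong n {sPow j} refl (toℕ-mod-% 0 n)))
      (cong (_% n) (trans (cong (toℕ i +ℕ_) (ℕₚ.*-zeroʳ (sPow j))) (ℕₚ.+-identityʳ _))))) (toℕ-mod-id n i))
    (trans (cong (_mod 2) (ℕₚ.+-identityʳ (toℕ j))) (toℕ-mod-id 2 j))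

-- Linear extension to FG of functions on G with values in an extension field.

module Pairing (F K : FiniteField) (ι : FiniteField.Carrier F → FiniteField.Carrier K) (hom : IsFieldHom F K ι)
  (n s : ℕ) .{{_ : NonZero n}} where
  private
    module F = FiniteField F
    module FA = GroupAlgebra F n s
    module FS = GroupSums F n s
    module Ev = Evaluation F K ι hom
  open FiniteField K
  open FieldProperties K
  open GroupAlgebra F n s using (G; _·G_; _≟G_; FG; _⋆_; _+ᴳ_; _·ᴳ_; δ)
  open GroupAlgebra K n s using (sumFin)
  open GroupSums K n s
  open ≡-Reasoning

  -- For fixed φ this is the F-linear extension of φ from G to FG. With K = F and φ an indicator
  -- function it also reads off single coefficients.
  ⟨_,_⟩ : FG → (G → Carrier) → Carrier
  ⟨ a , φ ⟩ = Σᴳ (λ g → ι (a g) * φ g)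

  ι-sumFin : ∀ {m} (f : Fin m → F.Carrier) → ι (FA.sumFin f) ≡ sumFin (λ i → ι (f i))
  ι-sumFin {zero}  f = Ev.hom-0
  ι-sumFin {suc m} f = trans (Ev.hom-+ _ _) (cong (ι (f Fin.zero) +_) (ι-sumFin (λ i → f (Fin.suc i))))

  ι-Σᴳ : (f : G → F.Carrier) → ι (FS.Σᴳ f) ≡ Σᴳ (λ g → ι (f g))
  ι-Σᴳ f = trans (cong ι (FS.Σᴳ-def f)) (trans (ι-sumFin (λ i → FA.sumFin (λ j → f (i , j))))
    (trans (sumFin-cong λ i → ι-sumFin (λ j → f (i , j))) (sym (Σᴳ-def (λ g → ι (f g))))))

  sum-indicator : ∀ (φ : G → Carrier) c u →
    Σᴳ (λ g → ι (if ⌊ u ≟G g ⌋ then c else F.0#) * φ g) ≡ ι c * φ u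
  sum-indicator φ c u = trans (Σᴳ-single _ u off) on
    where
    off : ∀ g → ¬ (g ≡ u) → ι (if ⌊ u ≟G g ⌋ then c else F.0#) * φ g ≡ 0#
    off g g≢u with u ≟G g
    ... | yes u≡g = ⊥-elim (g≢u (sym u≡g))
    ... | no _    = trans (cong (_* φ g) Ev.hom-0) (zeroˡ _)
    on : ι (if ⌊ u ≟G u ⌋ then c else F.0#) * φ u ≡ ι c * φ u
    on with u ≟G u
    ... | yes _  = refl
    ... | no u≢u = ⊥-elim (u≢u refl)

  -- Moving the sum over g to the innermost place lets the indicator of h h′ = g select g = h h′. A
  -- convolution thus becomes a double sum in which φ is evaluated at products of group elements.
  ⟨⟩-⋆ : ∀ a b φ → ⟨ a ⋆ b , φ ⟩ ≡ Σᴳ (λ h → Σᴳ (λ h′ → ι (a h) * ι (b h′) * φ (h ·G h′)))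
  ⟨⟩-⋆ a b φ = begin
    Σᴳ (λ g → ι ((a ⋆ b) g) * φ g)
      ≡⟨ Σᴳ-cong (λ g → trans
           (cong (_* φ g) (trans (cong ι (FS.⋆-Σᴳ a b g)) (trans (ι-Σᴳ (λ h → FS.Σᴳ (I g h))) (Σᴳ-cong λ h → ι-Σᴳ (I g h)))))
           (trans (sym (Σᴳ-*ʳ (φ g) (λ h → Σᴳ (λ h′ → ι (I g h h′))))) (Σᴳ-cong λ h → sym (Σᴳ-*ʳ (φ g) (λ h′ → ι (I g h h′)))))) ⟩
    Σᴳ (λ g → Σᴳ (λ h → Σᴳ (λ h′ → T g h h′)))
      ≡⟨ Σᴳ-swap (λ g h → Σᴳ (λ h′ → T g h h′)) ⟩
    Σᴳ (λ h → Σᴳ (λ g → Σᴳ (λ h′ → T g h h′)))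
      ≡⟨ Σᴳ-cong (λ h → Σᴳ-swap (λ g h′ → T g h h′)) ⟩
    Σᴳ (λ h → Σᴳ (λ h′ → Σᴳ (λ g → T g h h′)))
      ≡⟨ Σᴳ-cong (λ h → Σᴳ-cong λ h′ → trans (sum-indicator φ (a h F.* b h′) (h ·G h′)) (cong (_* φ (h ·G h′)) (Ev.hom-* _ _))) ⟩
    Σᴳ (λ h → Σᴳ (λ h′ → ι (a h) * ι (b h′) * φ (h ·G h′))) ∎
    where
    I : G → G → G → F.Carrier
    I g h h′ = if ⌊ (h ·G h′) ≟G g ⌋ then a h F.* b h′ else F.0#
    T : G → G → G → Carrier
    T g h h′ = ι (I g h h′) * φ g

  ⟨⟩-cong : ∀ {a b} φ → (∀ g → a g ≡ b g) → ⟨ a , φ ⟩ ≡ ⟨ b , φ ⟩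
  ⟨⟩-cong φ e = Σᴳ-cong λ g → cong (λ z → ι z * φ g) (e g)

  ⟨⟩-+ : ∀ a b φ → ⟨ a +ᴳ b , φ ⟩ ≡ ⟨ a , φ ⟩ + ⟨ b , φ ⟩
  ⟨⟩-+ a b φ = trans (Σᴳ-cong λ g → trans (cong (_* φ g) (Ev.hom-+ _ _)) (distribʳ _ _ _)) (Σᴳ-+ _ _)

  ⟨⟩-· : ∀ c a φ → ⟨ c ·ᴳ a , φ ⟩ ≡ ι c * ⟨ a , φ ⟩
  ⟨⟩-· c a φ = trans (Σᴳ-cong λ g → trans (cong (_* φ g) (Ev.hom-* _ _)) (*-assoc _ _ _)) (Σᴳ-*ˡ (ι c) _)

  ⟨⟩-δ : ∀ u φ → ⟨ δ u , φ ⟩ ≡ φ u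
  ⟨⟩-δ u φ = trans (sum-indicator φ F.1# u) (trans (cong (_* φ u) Ev.hom-1) (*-identityˡ _))

-- Ring laws of the group algebra.

module GroupAlgebraRing (F : FiniteField) (n s : ℕ) .{{_ : NonZero n}} (s²≡1 : (s *ℕ s) % n ≡ 1 % n) where
  open FiniteField F
  open FieldProperties F
  open GroupAlgebra F n s
  open GroupSums F n s
  open GroupLaws F n s s²≡1
  open Pairing F F (λ a → a) (idHom F) n s

  infix 4 _≐_
  record _≐_ (a b : FG) : Set where
    constructor mk≐
    field at : a ≈ᴳ b
  open _≐_ public

  ≐-refl : ∀ {a} → a ≐ a
  ≐-refl = mk≐ λ _ → refl

  ≐-sym : ∀ {a b} → a ≐ b → b ≐ a
  ≐-sym e = mk≐ λ g → sym (at e g)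

  ≐-trans : ∀ {a b c} → a ≐ b → b ≐ c → a ≐ c
  ≐-trans e e′ = mk≐ λ g → trans (at e g) (at e′ g)

  ≐-setoid : Setoid 0ℓ 0ℓ
  ≐-setoid = record { Carrier = FG ; _≈_ = _≐_ ; isEquivalence = record { refl = ≐-refl ; sym = ≐-sym ; trans = ≐-trans } }

  module ≐-Reasoning = SetoidReasoning ≐-setoid

  -- Writing the condition h h′ = g as a factor makes each term a product, so that scalars and sums
  -- can be pulled out.
  ⋆-δ : ∀ a b g → (a ⋆ b) g ≡ Σᴳ (λ h → Σᴳ (λ h′ → a h * b h′ * δ (h ·G h′) g))
  ⋆-δ a b g = trans (⋆-Σᴳ a b g) (Σᴳ-cong λ h → Σᴳ-cong λ h′ → go h h′)
    where
    go : ∀ h h′ → (if ⌊ (h ·G h′) ≟G g ⌋ then a h * b h′ else 0#) ≡ a h * b h′ * δ (h ·G h′) g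
    go h h′ with (h ·G h′) ≟G g
    ... | yes _ = sym (*-identityʳ _)
    ... | no _  = sym (zeroʳ _)

  ⋆-cong : ∀ {a a′ b b′} → a ≐ a′ → b ≐ b′ → a ⋆ b ≐ a′ ⋆ b′
  ⋆-cong {a} {a′} {b} {b′} e e′ = mk≐ λ g → trans (⋆-δ a b g) (trans
    (Σᴳ-cong λ h → Σᴳ-cong λ h′ → cong₂ (λ x y → x * y * δ (h ·G h′) g) (at e h) (at e′ h′)) (sym (⋆-δ a′ b′ g)))

  -- The coefficient at g of (a b) c is the pairing of a b with a function on G, to which `⟨⟩-⋆`
  -- applies. Associativity in G regroups the triple sum, and the same expansion read backwards,
  -- with b c in the pairing, folds it up.
  ⋆-assoc : ∀ a b c → (a ⋆ b) ⋆ c ≐ a ⋆ (b ⋆ c)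
  ⋆-assoc a b c = mk≐ λ g → begin
    ((a ⋆ b) ⋆ c) g
      ≡⟨ ⋆-δ (a ⋆ b) c g ⟩
    Σᴳ (λ h → Σᴳ (λ w → (a ⋆ b) h * c w * δ (h ·G w) g))
      ≡⟨ Σᴳ-cong (λ h → trans (Σᴳ-cong λ w → *-assoc _ _ _) (Σᴳ-*ˡ ((a ⋆ b) h) (λ w → c w * δ (h ·G w) g))) ⟩
    ⟨ a ⋆ b , (λ h → Σᴳ (λ w → c w * δ (h ·G w) g)) ⟩
      ≡⟨ ⟨⟩-⋆ a b (λ h → Σᴳ (λ w → c w * δ (h ·G w) g)) ⟩
    Σᴳ (λ u → Σᴳ (λ v → a u * b v * Σᴳ (λ w → c w * δ ((u ·G v) ·G w) g)))
      ≡⟨ Σᴳ-cong (λ u → Σᴳ-cong λ v → trans (sym (Σᴳ-*ˡ (a u * b v) (λ w → c w * δ ((u ·G v) ·G w) g)))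
           (trans (Σᴳ-cong λ w → trans (cong (λ z → a u * b v * (c w * δ z g)) (·G-assoc u v w)) (rearrange (a u) (b v) (c w) _))
             (Σᴳ-*ˡ (a u) (λ w → b v * c w * δ (u ·G (v ·G w)) g)))) ⟩
    Σᴳ (λ u → Σᴳ (λ v → a u * Σᴳ (λ w → b v * c w * δ (u ·G (v ·G w)) g)))
      ≡⟨ Σᴳ-cong (λ u → Σᴳ-*ˡ (a u) (λ v → Σᴳ (λ w → b v * c w * δ (u ·G (v ·G w)) g))) ⟩
    Σᴳ (λ u → a u * Σᴳ (λ v → Σᴳ (λ w → b v * c w * δ (u ·G (v ·G w)) g)))
      ≡⟨ Σᴳ-cong (λ u → cong (a u *_) (sym (⟨⟩-⋆ b c (λ x → δ (u ·G x) g)))) ⟩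
    Σᴳ (λ u → a u * ⟨ b ⋆ c , (λ x → δ (u ·G x) g) ⟩)
      ≡⟨ Σᴳ-cong (λ u → trans (sym (Σᴳ-*ˡ (a u) (λ x → (b ⋆ c) x * δ (u ·G x) g))) (Σᴳ-cong λ x → sym (*-assoc _ _ _))) ⟩
    Σᴳ (λ u → Σᴳ (λ x → a u * (b ⋆ c) x * δ (u ·G x) g))
      ≡⟨ ⋆-δ a (b ⋆ c) g ⟨
    (a ⋆ (b ⋆ c)) g ∎
    where
    open ≡-Reasoning
    rearrange : ∀ x y z w → x * y * (z * w) ≡ x * (y * z * w)
    rearrange = Solver.solve 4 (λ x y z w → x :* y :* (z :* w) := x :* (y :* z :* w)) refl
      where open Solver using (_:*_; _:=_)

  +ᴳ-cong : ∀ {a a′ b b′} → a ≐ a′ → b ≐ b′ → a +ᴳ b ≐ a′ +ᴳ b′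
  +ᴳ-cong e e′ = mk≐ λ g → cong₂ _+_ (at e g) (at e′ g)

  ·ᴳ-cong : ∀ c {a b} → a ≐ b → c ·ᴳ a ≐ c ·ᴳ b
  ·ᴳ-cong c e = mk≐ λ g → cong (c *_) (at e g)

  ⋆-distribʳ : ∀ a b c → (a +ᴳ b) ⋆ c ≐ a ⋆ c +ᴳ b ⋆ c
  ⋆-distribʳ a b c = mk≐ λ g → begin
    ((a +ᴳ b) ⋆ c) g ≡⟨ ⋆-δ (a +ᴳ b) c g ⟩
    Σᴳ (λ h → Σᴳ (λ h′ → (a h + b h) * c h′ * δ (h ·G h′) g))
      ≡⟨ Σᴳ-cong (λ h → trans (Σᴳ-cong λ h′ → trans (cong (_* δ (h ·G h′) g) (distribʳ _ _ _)) (distribʳ _ _ _)) (Σᴳ-+ _ _)) ⟩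
    Σᴳ (λ h → Σᴳ (λ h′ → a h * c h′ * δ (h ·G h′) g) + Σᴳ (λ h′ → b h * c h′ * δ (h ·G h′) g))
      ≡⟨ Σᴳ-+ (λ h → Σᴳ (λ h′ → a h * c h′ * δ (h ·G h′) g)) (λ h → Σᴳ (λ h′ → b h * c h′ * δ (h ·G h′) g)) ⟩
    Σᴳ (λ h → Σᴳ (λ h′ → a h * c h′ * δ (h ·G h′) g)) + Σᴳ (λ h → Σᴳ (λ h′ → b h * c h′ * δ (h ·G h′) g))
      ≡⟨ cong₂ _+_ (⋆-δ a c g) (⋆-δ b c g) ⟨
    (a ⋆ c +ᴳ b ⋆ c) g ∎
    where open ≡-Reasoning

  ⋆-distribˡ : ∀ a b c → a ⋆ (b +ᴳ c) ≐ a ⋆ b +ᴳ a ⋆ c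
  ⋆-distribˡ a b c = mk≐ λ g → begin
    (a ⋆ (b +ᴳ c)) g ≡⟨ ⋆-δ a (b +ᴳ c) g ⟩
    Σᴳ (λ h → Σᴳ (λ h′ → a h * (b h′ + c h′) * δ (h ·G h′) g))
      ≡⟨ Σᴳ-cong (λ h → trans (Σᴳ-cong λ h′ → trans (cong (_* δ (h ·G h′) g) (distribˡ _ _ _)) (distribʳ _ _ _)) (Σᴳ-+ _ _)) ⟩
    Σᴳ (λ h → Σᴳ (λ h′ → a h * b h′ * δ (h ·G h′) g) + Σᴳ (λ h′ → a h * c h′ * δ (h ·G h′) g))
      ≡⟨ Σᴳ-+ (λ h → Σᴳ (λ h′ → a h * b h′ * δ (h ·G h′) g)) (λ h → Σᴳ (λ h′ → a h * c h′ * δ (h ·G h′) g)) ⟩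
    Σᴳ (λ h → Σᴳ (λ h′ → a h * b h′ * δ (h ·G h′) g)) + Σᴳ (λ h → Σᴳ (λ h′ → a h * c h′ * δ (h ·G h′) g))
      ≡⟨ cong₂ _+_ (⋆-δ a b g) (⋆-δ a c g) ⟨
    (a ⋆ b +ᴳ a ⋆ c) g ∎
    where open ≡-Reasoning

  ·ᴳ-⋆ : ∀ c a b → (c ·ᴳ a) ⋆ b ≐ c ·ᴳ (a ⋆ b)
  ·ᴳ-⋆ c a b = mk≐ λ g → begin
    ((c ·ᴳ a) ⋆ b) g ≡⟨ ⋆-δ (c ·ᴳ a) b g ⟩
    Σᴳ (λ h → Σᴳ (λ h′ → c * a h * b h′ * δ (h ·G h′) g))
      ≡⟨ Σᴳ-cong (λ h → trans (Σᴳ-cong λ h′ → trans (cong (_* δ (h ·G h′) g) (*-assoc c _ _)) (*-assoc c _ _)) (Σᴳ-*ˡ c _)) ⟩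
    Σᴳ (λ h → c * Σᴳ (λ h′ → a h * b h′ * δ (h ·G h′) g))
      ≡⟨ Σᴳ-*ˡ c (λ h → Σᴳ (λ h′ → a h * b h′ * δ (h ·G h′) g)) ⟩
    c * Σᴳ (λ h → Σᴳ (λ h′ → a h * b h′ * δ (h ·G h′) g)) ≡⟨ cong (c *_) (⋆-δ a b g) ⟨
    (c ·ᴳ (a ⋆ b)) g ∎
    where open ≡-Reasoning

  ⋆-·ᴳ : ∀ c a b → a ⋆ (c ·ᴳ b) ≐ c ·ᴳ (a ⋆ b)
  ⋆-·ᴳ c a b = ≐-trans (mk≐ λ g → trans (⋆-δ a (c ·ᴳ b) g) (trans
    (Σᴳ-cong λ h → Σᴳ-cong λ h′ → cong (_* δ (h ·G h′) g) (trans (sym (*-assoc _ _ _)) (cong (_* b h′) (*-comm _ _))))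
    (sym (⋆-δ (c ·ᴳ a) b g)))) (·ᴳ-⋆ c a b)

  0·ᴳ : ∀ a → 0# ·ᴳ a ≐ 0ᴳ
  0·ᴳ a = mk≐ λ g → zeroˡ (a g)

  ⋆-zeroˡ : ∀ a → 0ᴳ ⋆ a ≐ 0ᴳ
  ⋆-zeroˡ a = ≐-trans (⋆-cong (≐-sym (0·ᴳ 0ᴳ)) (≐-refl {a})) (≐-trans (·ᴳ-⋆ 0# 0ᴳ a) (0·ᴳ (0ᴳ ⋆ a)))

  ⋆-zeroʳ : ∀ a → a ⋆ 0ᴳ ≐ 0ᴳ
  ⋆-zeroʳ a = ≐-trans (⋆-cong (≐-refl {a}) (≐-sym (0·ᴳ 0ᴳ))) (≐-trans (⋆-·ᴳ 0# a 0ᴳ) (0·ᴳ (a ⋆ 0ᴳ)))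

  +ᴳ-identityʳ : ∀ a → a +ᴳ 0ᴳ ≐ a
  +ᴳ-identityʳ a = mk≐ λ g → +-identityʳ (a g)

  +ᴳ-identityˡ : ∀ a → 0ᴳ +ᴳ a ≐ a
  +ᴳ-identityˡ a = mk≐ λ g → +-identityˡ (a g)

  δ-⋆-at : ∀ u b g → (δ u ⋆ b) g ≡ Σᴳ (λ h → b h * δ (u ·G h) g)
  δ-⋆-at u b g = begin
    (δ u ⋆ b) g ≡⟨ ⋆-δ (δ u) b g ⟩
    Σᴳ (λ h → Σᴳ (λ h′ → δ u h * b h′ * δ (h ·G h′) g))
      ≡⟨ Σᴳ-cong (λ h → trans (Σᴳ-cong λ h′ → *-assoc _ _ _) (Σᴳ-*ˡ (δ u h) (λ h′ → b h′ * δ (h ·G h′) g))) ⟩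
    ⟨ δ u , (λ h → Σᴳ (λ h′ → b h′ * δ (h ·G h′) g)) ⟩ ≡⟨ ⟨⟩-δ u _ ⟩
    Σᴳ (λ h → b h * δ (u ·G h) g) ∎
    where open ≡-Reasoning

  δ-⋆-δ : ∀ u v → δ u ⋆ δ v ≐ δ (u ·G v)
  δ-⋆-δ u v = mk≐ λ g → trans (δ-⋆-at u (δ v) g) (⟨⟩-δ v (λ h → δ (u ·G h) g))

  sum-δ : ∀ (a : FG) (g : G) → Σᴳ (λ h → a h * δ h g) ≡ a g
  sum-δ a g = trans (Σᴳ-single (λ h → a h * δ h g) g off) on
    where
    off : ∀ h → ¬ (h ≡ g) → a h * δ h g ≡ 0#
    off h h≢g with h ≟G g
    ... | yes h≡g = ⊥-elim (h≢g h≡g)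
    ... | no _    = zeroʳ _
    on : a g * δ g g ≡ a g
    on with g ≟G g
    ... | yes _  = *-identityʳ _
    ... | no g≢g = ⊥-elim (g≢g refl)

  ⋆-identityˡ : ∀ a → 1ᴳ ⋆ a ≐ a
  ⋆-identityˡ a = mk≐ λ g → trans (δ-⋆-at _ a g)
    (trans (Σᴳ-cong λ h → cong (λ z → a h * δ z g) (·G-identityˡ h)) (sum-δ a g))

  ⋆-identityʳ : ∀ a → a ⋆ 1ᴳ ≐ a
  ⋆-identityʳ a = mk≐ λ g → begin
    (a ⋆ 1ᴳ) g ≡⟨ ⋆-δ a 1ᴳ g ⟩
    Σᴳ (λ h → Σᴳ (λ h′ → a h * 1ᴳ h′ * δ (h ·G h′) g))
      ≡⟨ Σᴳ-cong (λ h → trans (Σᴳ-cong λ h′ → *-assoc _ _ _) (trans (Σᴳ-*ˡ (a h) (λ h′ → 1ᴳ h′ * δ (h ·G h′) g))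
           (cong (a h *_) (trans (⟨⟩-δ _ (λ h′ → δ (h ·G h′) g)) (cong (λ z → δ z g) (·G-identityʳ h)))))) ⟩
    Σᴳ (λ h → a h * δ h g) ≡⟨ sum-δ a g ⟩
    a g ∎
    where open ≡-Reasoning

-- Polynomials in x as elements of FG, and FG as spanned over them by 1 and y.

module PolynomialElements (F : FiniteField) (n s : ℕ) .{{_ : NonZero n}} (s²≡1 : (s *ℕ s) % n ≡ 1 % n) where
  open FiniteField F
  open Poly F hiding (_*)
  open FieldProperties F
  open PolyProperties F renaming (at to atₚ)
  open GroupAlgebra F n s
  open GroupSums F n s
  open GroupLaws F n s s²≡1
  open GroupAlgebraRing F n s s²≡1

  ⟦⟧-zero : ∀ {p} → p ≋ [] → ⟦ p ⟧ ≐ 0ᴳ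
  ⟦⟧-zero {[]}    e = ≐-refl
  ⟦⟧-zero {a ∷ p} e = begin
    (a ·ᴳ 1ᴳ) +ᴳ (xᴳ ⋆ ⟦ p ⟧)   ≈⟨ +ᴳ-cong (mk≐ λ g → cong (_* 1ᴳ g) (atₚ e 0)) (⋆-cong (≐-refl {xᴳ}) (⟦⟧-zero (tail-zero e))) ⟩
    (0# ·ᴳ 1ᴳ) +ᴳ (xᴳ ⋆ 0ᴳ)     ≈⟨ +ᴳ-cong (0·ᴳ 1ᴳ) (⋆-zeroʳ xᴳ) ⟩
    0ᴳ +ᴳ 0ᴳ                    ≈⟨ +ᴳ-identityˡ 0ᴳ ⟩
    0ᴳ                          ∎
    where open ≐-Reasoning

  ⟦⟧-cong : ∀ {p r} → p ≋ r → ⟦ p ⟧ ≐ ⟦ r ⟧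
  ⟦⟧-cong {[]}    {r}     e = ≐-sym (⟦⟧-zero (≋-sym e))
  ⟦⟧-cong {a ∷ p} {[]}    e = ⟦⟧-zero e
  ⟦⟧-cong {a ∷ p} {b ∷ r} e = +ᴳ-cong (mk≐ λ g → cong (_* 1ᴳ g) (atₚ e 0)) (⋆-cong (≐-refl {xᴳ}) (⟦⟧-cong (tail-cong e)))

  ⟦⟧-+ : ∀ p r → ⟦ p +ₚ r ⟧ ≐ ⟦ p ⟧ +ᴳ ⟦ r ⟧
  ⟦⟧-+ []      r       = ≐-sym (+ᴳ-identityˡ ⟦ r ⟧)
  ⟦⟧-+ (a ∷ p) []      = ≐-sym (+ᴳ-identityʳ ⟦ a ∷ p ⟧)
  ⟦⟧-+ (a ∷ p) (b ∷ r) = begin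
    ((a + b) ·ᴳ 1ᴳ) +ᴳ xᴳ ⋆ ⟦ p +ₚ r ⟧
      ≈⟨ +ᴳ-cong (mk≐ λ g → distribʳ (1ᴳ g) a b) (≐-trans (⋆-cong (≐-refl {xᴳ}) (⟦⟧-+ p r)) (⋆-distribˡ xᴳ ⟦ p ⟧ ⟦ r ⟧)) ⟩
    ((a ·ᴳ 1ᴳ) +ᴳ (b ·ᴳ 1ᴳ)) +ᴳ (xᴳ ⋆ ⟦ p ⟧ +ᴳ xᴳ ⋆ ⟦ r ⟧)
      ≈⟨ mk≐ (λ g → +-interchange (a * 1ᴳ g) (b * 1ᴳ g) ((xᴳ ⋆ ⟦ p ⟧) g) ((xᴳ ⋆ ⟦ r ⟧) g)) ⟩
    ⟦ a ∷ p ⟧ +ᴳ ⟦ b ∷ r ⟧ ∎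
    where open ≐-Reasoning

  ⟦⟧-· : ∀ c p → ⟦ c ·ₚ p ⟧ ≐ c ·ᴳ ⟦ p ⟧
  ⟦⟧-· c []      = mk≐ λ _ → sym (zeroʳ c)
  ⟦⟧-· c (a ∷ p) = begin
    ((c * a) ·ᴳ 1ᴳ) +ᴳ xᴳ ⋆ ⟦ c ·ₚ p ⟧
      ≈⟨ +ᴳ-cong (mk≐ λ g → *-assoc c a (1ᴳ g)) (≐-trans (⋆-cong (≐-refl {xᴳ}) (⟦⟧-· c p)) (⋆-·ᴳ c xᴳ ⟦ p ⟧)) ⟩
    (c ·ᴳ (a ·ᴳ 1ᴳ)) +ᴳ (c ·ᴳ (xᴳ ⋆ ⟦ p ⟧))
      ≈⟨ mk≐ (λ g → sym (distribˡ c (a * 1ᴳ g) ((xᴳ ⋆ ⟦ p ⟧) g))) ⟩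
    c ·ᴳ ⟦ a ∷ p ⟧ ∎
    where open ≐-Reasoning

  ⟦0∷⟧ : ∀ p → ⟦ 0# ∷ p ⟧ ≐ xᴳ ⋆ ⟦ p ⟧
  ⟦0∷⟧ p = ≐-trans (+ᴳ-cong (0·ᴳ 1ᴳ) (≐-refl {xᴳ ⋆ ⟦ p ⟧})) (+ᴳ-identityˡ (xᴳ ⋆ ⟦ p ⟧))

  ⟦∷⟧-⋆ : ∀ c p b → ⟦ c ∷ p ⟧ ⋆ b ≐ (c ·ᴳ b) +ᴳ xᴳ ⋆ (⟦ p ⟧ ⋆ b)
  ⟦∷⟧-⋆ c p b = begin
    ⟦ c ∷ p ⟧ ⋆ b                                  ≈⟨ ⋆-distribʳ (c ·ᴳ 1ᴳ) (xᴳ ⋆ ⟦ p ⟧) b ⟩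
    (c ·ᴳ 1ᴳ) ⋆ b +ᴳ (xᴳ ⋆ ⟦ p ⟧) ⋆ b              ≈⟨ +ᴳ-cong (≐-trans (·ᴳ-⋆ c 1ᴳ b) (·ᴳ-cong c (⋆-identityˡ b))) (⋆-assoc xᴳ ⟦ p ⟧ b) ⟩
    (c ·ᴳ b) +ᴳ xᴳ ⋆ (⟦ p ⟧ ⋆ b)                   ∎
    where open ≐-Reasoning

  ⟦⟧-* : ∀ p r → ⟦ p *ₚ r ⟧ ≐ ⟦ p ⟧ ⋆ ⟦ r ⟧
  ⟦⟧-* []      r = ≐-sym (⋆-zeroˡ ⟦ r ⟧)
  ⟦⟧-* (a ∷ p) r = begin
    ⟦ (a ·ₚ r) +ₚ (0# ∷ p *ₚ r) ⟧                  ≈⟨ ⟦⟧-+ (a ·ₚ r) (0# ∷ p *ₚ r) ⟩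
    ⟦ a ·ₚ r ⟧ +ᴳ ⟦ 0# ∷ p *ₚ r ⟧                  ≈⟨ +ᴳ-cong (⟦⟧-· a r) (≐-trans (⟦0∷⟧ (p *ₚ r)) (⋆-cong (≐-refl {xᴳ}) (⟦⟧-* p r))) ⟩
    (a ·ᴳ ⟦ r ⟧) +ᴳ xᴳ ⋆ (⟦ p ⟧ ⋆ ⟦ r ⟧)           ≈⟨ ⟦∷⟧-⋆ a p ⟦ r ⟧ ⟨
    ⟦ a ∷ p ⟧ ⋆ ⟦ r ⟧                              ∎
    where open ≐-Reasoning

  ⟦X^⟧ : ∀ k → ⟦ X^ k ⟧ ≐ δ (k mod n , 0 mod 2)
  ⟦X^⟧ zero    = ≐-trans (+ᴳ-cong (mk≐ λ g → *-identityˡ (1ᴳ g)) (⋆-zeroʳ xᴳ)) (+ᴳ-identityʳ 1ᴳ)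
  ⟦X^⟧ (suc k) = begin
    ⟦ 0# ∷ X^ k ⟧                                       ≈⟨ ⟦0∷⟧ (X^ k) ⟩
    xᴳ ⋆ ⟦ X^ k ⟧                                       ≈⟨ ⋆-cong (≐-refl {xᴳ}) (⟦X^⟧ k) ⟩
    xᴳ ⋆ δ (k mod n , 0 mod 2)                          ≈⟨ δ-⋆-δ (1 mod n , 0 mod 2) (k mod n , 0 mod 2) ⟩
    δ ((1 mod n , 0 mod 2) ·G (k mod n , 0 mod 2))      ≈⟨ mk≐ (λ g → cong (λ u → δ u g) (x^a·x^b 1 k (0 mod 2))) ⟩
    δ (suc k mod n , 0 mod 2)                           ∎
    where open ≐-Reasoning

  ⟦Xⁿ-1⟧ : ⟦ X^ n -ₚ 1ₚ ⟧ ≐ 0ᴳ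
  ⟦Xⁿ-1⟧ = begin
    ⟦ X^ n -ₚ 1ₚ ⟧               ≈⟨ ⟦⟧-+ (X^ n) (-ₚ 1ₚ) ⟩
    ⟦ X^ n ⟧ +ᴳ ⟦ -ₚ 1ₚ ⟧        ≈⟨ +ᴳ-cong (≐-trans (⟦X^⟧ n) (mk≐ λ g → cong (λ i → δ (i , 0 mod 2) g) (mod-cong n ([m+n]%n≡m%n 0 n))))
                                     (≐-trans (+ᴳ-cong (≐-refl {(- 1#) ·ᴳ 1ᴳ}) (⋆-zeroʳ xᴳ)) (+ᴳ-identityʳ ((- 1#) ·ᴳ 1ᴳ))) ⟩
    1ᴳ +ᴳ ((- 1#) ·ᴳ 1ᴳ)         ≈⟨ mk≐ (λ g → trans (cong (1ᴳ g +_) (-1*x≈-x (1ᴳ g))) (-‿inverseʳ (1ᴳ g))) ⟩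
    0ᴳ                           ∎
    where open ≐-Reasoning

  y^ : Fin 2 → FG
  y^ j = δ (0 mod n , j)

  ⋆-sumʳ : ∀ {m} a (c : Fin m → Carrier) (b : Fin m → FG) →
    a ⋆ (λ g → sumFin (λ i → c i * b i g)) ≐ (λ g → sumFin (λ i → c i * (a ⋆ b i) g))
  ⋆-sumʳ {zero}  a c b = ⋆-zeroʳ a
  ⋆-sumʳ {suc m} a c b = ≐-trans (⋆-distribˡ a (c Fin.zero ·ᴳ b Fin.zero) (λ g → sumFin (λ i → c (Fin.suc i) * b (Fin.suc i) g)))
    (+ᴳ-cong (⋆-·ᴳ (c Fin.zero) a (b Fin.zero)) (⋆-sumʳ a (λ i → c (Fin.suc i)) (λ i → b (Fin.suc i))))

  -- Horner's scheme unrolled: every further coefficient costs one left multiplication by x, which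
  -- raises all later exponents by one.
  ⟦tabulate⟧-⋆-y : ∀ {m} (c : Fin m → Carrier) j →
    ⟦ tabulate c ⟧ ⋆ y^ j ≐ (λ g → sumFin (λ i → c i * δ (toℕ i mod n , j) g))
  ⟦tabulate⟧-⋆-y {zero}  c j = ⋆-zeroˡ (y^ j)
  ⟦tabulate⟧-⋆-y {suc m} c j = begin
    ⟦ c Fin.zero ∷ tabulate c′ ⟧ ⋆ y^ j
      ≈⟨ ⟦∷⟧-⋆ (c Fin.zero) (tabulate c′) (y^ j) ⟩
    (c Fin.zero ·ᴳ y^ j) +ᴳ xᴳ ⋆ (⟦ tabulate c′ ⟧ ⋆ y^ j)
      ≈⟨ +ᴳ-cong (≐-refl {c Fin.zero ·ᴳ y^ j}) (≐-trans (⋆-cong (≐-refl {xᴳ}) (⟦tabulate⟧-⋆-y c′ j))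
           (⋆-sumʳ xᴳ c′ (λ i → δ (toℕ i mod n , j)))) ⟩
    (c Fin.zero ·ᴳ y^ j) +ᴳ (λ g → sumFin (λ i → c′ i * (xᴳ ⋆ δ (toℕ i mod n , j)) g))
      ≈⟨ +ᴳ-cong (≐-refl {c Fin.zero ·ᴳ y^ j}) (mk≐ λ g → sumFin-cong λ i → cong (c′ i *_)
           (trans (at (δ-⋆-δ (1 mod n , 0 mod 2) (toℕ i mod n , j)) g) (cong (λ u → δ u g) (x^a·x^b 1 (toℕ i) j)))) ⟩
    (λ g → sumFin (λ i → c i * δ (toℕ i mod n , j) g)) ∎
    where
    open ≐-Reasoning
    c′ : Fin m → Carrier
    c′ i = c (Fin.suc i)

  component : FG → Fin 2 → Pol
  component a j = tabulate (λ i → a (i , j))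

  -- Every element is p₀(x) + p₁(x) y, with the coefficients of each polynomial read off a coset of
  -- the powers of x. Annihilation from the left by a polynomial in x can therefore be tested on p₀
  -- and p₁.
  decomposition : ∀ a → a ≐ ⟦ component a Fin.zero ⟧ ⋆ y^ Fin.zero +ᴳ ⟦ component a (Fin.suc Fin.zero) ⟧ ⋆ y^ (Fin.suc Fin.zero)
  decomposition a = mk≐ λ g → sym (begin
    (⟦ component a 0F ⟧ ⋆ y^ 0F) g + (⟦ component a 1F ⟧ ⋆ y^ 1F) g
      ≡⟨ cong₂ _+_ (col 0F g) (col 1F g) ⟩
    sumFin (λ i → a (i , 0F) * δ (i , 0F) g) + sumFin (λ i → a (i , 1F) * δ (i , 1F) g)
      ≡⟨ cong (sumFin (λ i → a (i , 0F) * δ (i , 0F) g) +_) (+-identityʳ _) ⟨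
    sumFin (λ j → sumFin (λ i → a (i , j) * δ (i , j) g))
      ≡⟨ trans (Σᴳ-def (λ h → a h * δ h g)) (sumFin-swap (λ i j → a (i , j) * δ (i , j) g)) ⟨
    Σᴳ (λ h → a h * δ h g)
      ≡⟨ sum-δ a g ⟩
    a g ∎)
    where
    open ≡-Reasoning
    0F 1F : Fin 2
    0F = Fin.zero
    1F = Fin.suc Fin.zero
    col : ∀ j g → (⟦ component a j ⟧ ⋆ y^ j) g ≡ sumFin (λ i → a (i , j) * δ (i , j) g)
    col j g = trans (at (⟦tabulate⟧-⋆-y (λ i → a (i , j)) j) g)
      (sumFin-cong λ i → cong (λ k → a (i , j) * δ (k , j) g) (toℕ-mod-id n i))

-- The automorphism t and the homomorphism from FG to the skew algebra K ⊕ K y.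

module SkewRepresentation (F K : FiniteField) (ι : FiniteField.Carrier F → FiniteField.Carrier K) (hom : IsFieldHom F K ι)
  (f : Poly.Pol F) (α : FiniteField.Carrier K)
  (α-surjective : ∀ v → ∃ λ p → Evaluation.ev F K ι hom α p ≡ v)
  (α-minimal : ∀ p → Evaluation.ev F K ι hom α p ≡ FiniteField.0# K → ∃ λ m → PolyProperties._≋_ F p (Poly._*ₚ_ F f m))
  (n s : ℕ) .{{_ : NonZero n}} (s²≡1 : (s *ℕ s) % n ≡ 1 % n)
  (αⁿ≡1 : FiniteField._^_ K α n ≡ FiniteField.1# K)
  (αˢ-root : Evaluation.ev F K ι hom (FiniteField._^_ K α s) f ≡ FiniteField.0# K) where
  private
    module F = FiniteField F
    module Fₚ = FieldProperties F
  open FiniteField K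
  open FieldProperties K
  open Poly F using (Pol; _+ₚ_; _*ₚ_; -ₚ_; _-ₚ_; X^; 1ₚ)
  open PolyProperties F using (_≋_; ≋-sym; ≋-trans; ≋-refl; *ₚ-cong; *ₚ-comm; *ₚ-assoc)
  open Evaluation F K ι hom
  open GroupAlgebra F n s
  open GroupAlgebra K n s using () renaming (sumFin to sumFinK)
  open GroupSums K n s
  open GroupLaws F n s s²≡1
  open GroupAlgebraRing F n s s²≡1
  open PolynomialElements F n s s²≡1
  open Pairing F K ι hom n s
  open ≡-Reasoning

  -- Substitution of α^s for α in some polynomial expression of v; `t-ev` shows that the choice of
  -- expression does not matter.
  t : Carrier → Carrier
  t v = ev (α ^ s) (proj₁ (α-surjective v))

  -- Two expressions of the same element differ by a multiple of f, and f vanishes at α^s too.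
  t-ev : ∀ p → t (ev α p) ≡ ev (α ^ s) p
  t-ev p = go (α-surjective (ev α p))
    where
    go : (w : ∃ λ r → ev α r ≡ ev α p) → ev (α ^ s) (proj₁ w) ≡ ev (α ^ s) p
    go (r , e) with α-minimal (r -ₚ p)
      (trans (ev-+ α r (-ₚ p)) (trans (cong (ev α r +_) (ev-neg α p)) (x≈y⇒x-y≈0 e)))
    ... | m , r-p≋fm = x-y≈0⇒x≈y _ _ (begin
      ev (α ^ s) r + - ev (α ^ s) p       ≡⟨ cong (ev (α ^ s) r +_) (ev-neg (α ^ s) p) ⟨
      ev (α ^ s) r + ev (α ^ s) (-ₚ p)    ≡⟨ ev-+ (α ^ s) r (-ₚ p) ⟨
      ev (α ^ s) (r -ₚ p)                 ≡⟨ ev-cong (α ^ s) r-p≋fm ⟩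
      ev (α ^ s) (f *ₚ m)                 ≡⟨ ev-* (α ^ s) f m ⟩
      ev (α ^ s) f * ev (α ^ s) m         ≡⟨ cong (_* ev (α ^ s) m) αˢ-root ⟩
      0# * ev (α ^ s) m                   ≡⟨ zeroˡ _ ⟩
      0#                                  ∎)

  t-hom : IsFieldHom K K t
  t-hom = record
    { hom-+ = λ v w → additive v w (α-surjective v) (α-surjective w)
    ; hom-* = λ v w → multiplicative v w (α-surjective v) (α-surjective w)
    ; hom-1 = trans (cong t (sym (ev-1 α))) (trans (t-ev 1ₚ) (ev-1 (α ^ s))) }
    where
    additive : ∀ v w → (∃ λ p → ev α p ≡ v) → (∃ λ p → ev α p ≡ w) → t (v + w) ≡ t v + t w
    additive _ _ (p , refl) (r , refl) = trans (cong t (sym (ev-+ α p r)))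
      (trans (t-ev (p +ₚ r)) (trans (ev-+ (α ^ s) p r) (sym (cong₂ _+_ (t-ev p) (t-ev r)))))
    multiplicative : ∀ v w → (∃ λ p → ev α p ≡ v) → (∃ λ p → ev α p ≡ w) → t (v * w) ≡ t v * t w
    multiplicative _ _ (p , refl) (r , refl) = trans (cong t (sym (ev-* α p r)))
      (trans (t-ev (p *ₚ r)) (trans (ev-* (α ^ s) p r) (sym (cong₂ _*_ (t-ev p) (t-ev r)))))

  open Evaluation K K t t-hom using () renaming
    (hom-+ to t-+; hom-* to t-*; hom-1 to t-1; hom-0 to t-0; hom-neg to t-neg)

  t-ι : ∀ a → t (ι a) ≡ ι a
  t-ι a = trans (cong t (sym (ev-const α a))) (trans (t-ev (a ∷ [])) (ev-const (α ^ s) a))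

  ev-X : ∀ β → ev β (X^ 1) ≡ β
  ev-X β = trans (ev-X^ β 1) (*-identityʳ β)

  t-α : t α ≡ α ^ s
  t-α = trans (cong t (sym (ev-X α))) (trans (t-ev (X^ 1)) (ev-X (α ^ s)))

  t-^ : ∀ v m → t (v ^ m) ≡ t v ^ m
  t-^ v zero    = t-1
  t-^ v (suc m) = trans (t-* v (v ^ m)) (cong (t v *_) (t-^ v m))

  αˢˢ≡α : (α ^ s) ^ s ≡ α
  αˢˢ≡α = begin
    (α ^ s) ^ s          ≡⟨ ^-* α s s ⟨
    α ^ (s *ℕ s)         ≡⟨ ^-% α n αⁿ≡1 (s *ℕ s) ⟨
    α ^ ((s *ℕ s) % n)   ≡⟨ cong (α ^_) s²≡1 ⟩
    α ^ (1 % n)          ≡⟨ ^-% α n αⁿ≡1 1 ⟩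
    α * 1#               ≡⟨ *-identityʳ α ⟩
    α                    ∎

  -- As t fixes the coefficients coming from F, applying it twice replaces α by α^(s s) in a
  -- polynomial expression, and α^(s s) = α because s² ≡ 1 modulo n.
  t-involutive : ∀ v → t (t v) ≡ v
  t-involutive v = go (α-surjective v)
    where
    t-ev-β : ∀ β p → t (ev β p) ≡ ev (t β) p
    t-ev-β β []      = t-0
    t-ev-β β (a ∷ p) = trans (t-+ (ι a) (β * ev β p)) (cong₂ _+_ (t-ι a) (trans (t-* β (ev β p)) (cong (t β *_) (t-ev-β β p))))
    go : (∃ λ p → ev α p ≡ v) → t (t v) ≡ v
    go (p , refl) = begin
      t (t (ev α p))           ≡⟨ cong t (t-ev p) ⟩
      t (ev (α ^ s) p)         ≡⟨ t-ev-β (α ^ s) p ⟩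
      ev (t (α ^ s)) p         ≡⟨ cong (λ β → ev β p) (trans (t-^ α s) (trans (cong (_^ s) t-α) αˢˢ≡α)) ⟩
      ev α p                   ∎

  -- a ↦ (π₀ a , π₁ a) is the quotient map from FG onto the skew algebra K ⊕ K y with y v = t(v) y.
  φ₀ φ₁ : G → Carrier
  φ₀ (i , Fin.zero)         = α ^ toℕ i
  φ₀ (i , Fin.suc Fin.zero) = 0#
  φ₁ (i , Fin.zero)         = 0#
  φ₁ (i , Fin.suc Fin.zero) = α ^ toℕ i

  π₀ π₁ : FG → Carrier
  π₀ a = ⟨ a , φ₀ ⟩
  π₁ a = ⟨ a , φ₁ ⟩

  private
    α^mod : ∀ k → α ^ toℕ (k mod n) ≡ α ^ k
    α^mod k = trans (cong (α ^_) (toℕ-mod k n)) (^-% α n αⁿ≡1 k)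

    α^untwisted : ∀ i k → α ^ toℕ ((i +ℕ 1 *ℕ k) mod n) ≡ α ^ i * α ^ k
    α^untwisted i k = trans (α^mod (i +ℕ 1 *ℕ k)) (trans (cong (λ z → α ^ (i +ℕ z)) (ℕₚ.*-identityˡ k)) (^-+ α i k))

    -- The rule y x^k = x^(s k) y seen in K, where α^(s k) = t(α^k). The factor `s *ℕ 1` is what
    -- `sPow` computes to at the exponent 1 of y.
    α^twisted : ∀ i k → α ^ toℕ ((i +ℕ s *ℕ 1 *ℕ k) mod n) ≡ α ^ i * t (α ^ k)
    α^twisted i k = begin
      α ^ toℕ ((i +ℕ s *ℕ 1 *ℕ k) mod n)   ≡⟨ α^mod (i +ℕ s *ℕ 1 *ℕ k) ⟩
      α ^ (i +ℕ s *ℕ 1 *ℕ k)               ≡⟨ cong (λ z → α ^ (i +ℕ z)) (trans (cong (_*ℕ k) (ℕₚ.*-identityʳ s)) (ℕₚ.*-comm s k)) ⟩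
      α ^ (i +ℕ k *ℕ s)                    ≡⟨ ^-+ α i (k *ℕ s) ⟩
      α ^ i * α ^ (k *ℕ s)                 ≡⟨ cong (α ^ i *_) (^-* α k s) ⟩
      α ^ i * (α ^ s) ^ k                  ≡⟨ cong (λ z → α ^ i * z ^ k) t-α ⟨
      α ^ i * t α ^ k                      ≡⟨ cong (α ^ i *_) (t-^ α k) ⟨
      α ^ i * t (α ^ k)                    ∎

    +0* : ∀ {x y} z → x ≡ y → x ≡ y + 0# * z
    +0* z e = trans e (sym (trans (cong (_ +_) (zeroˡ z)) (+-identityʳ _)))

    0*+ : ∀ {x y} z → x ≡ y → x ≡ 0# * z + y
    0*+ z e = trans e (sym (trans (cong (_+ _) (zeroˡ z)) (+-identityˡ _)))

  -- This and `φ₁-·G` are the two components of (v + w y)(v′ + w′ y) = (v v′ + w t(w′)) + (v w′ + w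
  -- t(v′)) y, checked on the four kinds of pairs of group elements.
  φ₀-·G : ∀ u v → φ₀ (u ·G v) ≡ φ₀ u * φ₀ v + φ₁ u * t (φ₁ v)
  φ₀-·G (i , Fin.zero)         (k , Fin.zero)         = +0* (t 0#) (α^untwisted (toℕ i) (toℕ k))
  φ₀-·G (i , Fin.zero)         (k , Fin.suc Fin.zero) = +0* (t (α ^ toℕ k)) (sym (zeroʳ _))
  φ₀-·G (i , Fin.suc Fin.zero) (k , Fin.zero)         = 0*+ (α ^ toℕ k) (sym (trans (cong (α ^ toℕ i *_) t-0) (zeroʳ _)))
  φ₀-·G (i , Fin.suc Fin.zero) (k , Fin.suc Fin.zero) = 0*+ 0# (α^twisted (toℕ i) (toℕ k))

  φ₁-·G : ∀ u v → φ₁ (u ·G v) ≡ φ₀ u * φ₁ v + φ₁ u * t (φ₀ v)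
  φ₁-·G (i , Fin.zero)         (k , Fin.zero)         = +0* (t (α ^ toℕ k)) (sym (zeroʳ _))
  φ₁-·G (i , Fin.zero)         (k , Fin.suc Fin.zero) = +0* (t 0#) (α^untwisted (toℕ i) (toℕ k))
  φ₁-·G (i , Fin.suc Fin.zero) (k , Fin.zero)         = 0*+ 0# (α^twisted (toℕ i) (toℕ k))
  φ₁-·G (i , Fin.suc Fin.zero) (k , Fin.suc Fin.zero) = 0*+ (α ^ toℕ k) (sym (trans (cong (α ^ toℕ i *_) t-0) (zeroʳ _)))

  -- Both components of a skew product have the shape A B + C t(D), so one statement with free
  -- functions covers them. The double sum separates into products of pairings, and t leaves its sum
  -- because it is additive and fixes the image of F.
  ⟨⟩-skew : ∀ a b (Φ A B C D : G → Carrier) → (∀ u v → Φ (u ·G v) ≡ A u * B v + C u * t (D v)) →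
    ⟨ a ⋆ b , Φ ⟩ ≡ ⟨ a , A ⟩ * ⟨ b , B ⟩ + ⟨ a , C ⟩ * t ⟨ b , D ⟩
  ⟨⟩-skew a b Φ A B C D e = begin
    ⟨ a ⋆ b , Φ ⟩
      ≡⟨ ⟨⟩-⋆ a b Φ ⟩
    Σᴳ (λ u → Σᴳ (λ v → ι (a u) * ι (b v) * Φ (u ·G v)))
      ≡⟨ Σᴳ-cong (λ u → Σᴳ-cong λ v → trans (cong (ι (a u) * ι (b v) *_) (e u v)) (expand (ι (a u)) (ι (b v)) (A u) (B v) (C u) (t (D v)))) ⟩
    Σᴳ (λ u → Σᴳ (λ v → ι (a u) * A u * (ι (b v) * B v) + ι (a u) * C u * (ι (b v) * t (D v))))
      ≡⟨ trans (Σᴳ-cong λ u → Σᴳ-+ (λ v → ι (a u) * A u * (ι (b v) * B v)) (λ v → ι (a u) * C u * (ι (b v) * t (D v))))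
           (Σᴳ-+ (λ u → Σᴳ (λ v → ι (a u) * A u * (ι (b v) * B v))) (λ u → Σᴳ (λ v → ι (a u) * C u * (ι (b v) * t (D v))))) ⟩
    Σᴳ (λ u → Σᴳ (λ v → ι (a u) * A u * (ι (b v) * B v))) + Σᴳ (λ u → Σᴳ (λ v → ι (a u) * C u * (ι (b v) * t (D v))))
      ≡⟨ cong₂ _+_ (Σᴳ-*-Σᴳ (λ u → ι (a u) * A u) (λ v → ι (b v) * B v)) (Σᴳ-*-Σᴳ (λ u → ι (a u) * C u) (λ v → ι (b v) * t (D v))) ⟩
    ⟨ a , A ⟩ * ⟨ b , B ⟩ + ⟨ a , C ⟩ * Σᴳ (λ v → ι (b v) * t (D v))
      ≡⟨ cong (λ z → ⟨ a , A ⟩ * ⟨ b , B ⟩ + ⟨ a , C ⟩ * z) (trans (T.ι-Σᴳ (λ v → ι (b v) * D v))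
           (Σᴳ-cong λ v → trans (t-* (ι (b v)) (D v)) (cong (_* t (D v)) (t-ι (b v))))) ⟨
    ⟨ a , A ⟩ * ⟨ b , B ⟩ + ⟨ a , C ⟩ * t ⟨ b , D ⟩ ∎
    where
    -- Here t itself plays the part of the field embedding, so the exchange of an embedding with a
    -- sum over G applies to it.
    module T = Pairing K K t t-hom n s
    expand : ∀ x y p q r w → x * y * (p * q + r * w) ≡ x * p * (y * q) + x * r * (y * w)
    expand = Solver.solve 6 (λ x y p q r w → x :* y :* (p :* q :+ r :* w) := x :* p :* (y :* q) :+ x :* r :* (y :* w)) refl
      where open Solver using (_:*_; _:+_; _:=_)

  π₀-⋆ : ∀ a b → π₀ (a ⋆ b) ≡ π₀ a * π₀ b + π₁ a * t (π₁ b)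
  π₀-⋆ a b = ⟨⟩-skew a b φ₀ φ₀ φ₀ φ₁ φ₁ φ₀-·G

  π₁-⋆ : ∀ a b → π₁ (a ⋆ b) ≡ π₀ a * π₁ b + π₁ a * t (π₀ b)
  π₁-⋆ a b = ⟨⟩-skew a b φ₁ φ₀ φ₁ φ₁ φ₀ φ₁-·G

  π₀-⋆-scalar : ∀ a b → π₁ a ≡ 0# → π₀ (a ⋆ b) ≡ π₀ a * π₀ b
  π₀-⋆-scalar a b e = trans (π₀-⋆ a b) (trans (cong (λ z → π₀ a * π₀ b + z * t (π₁ b)) e) (sym (+0* (t (π₁ b)) refl)))

  π₁-⋆-scalar : ∀ a b → π₁ a ≡ 0# → π₁ (a ⋆ b) ≡ π₀ a * π₁ b
  π₁-⋆-scalar a b e = trans (π₁-⋆ a b) (trans (cong (λ z → π₀ a * π₁ b + z * t (π₀ b)) e) (sym (+0* (t (π₀ b)) refl)))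

  π₀-1 : π₀ 1ᴳ ≡ 1#
  π₀-1 = trans (⟨⟩-δ (0 mod n , 0 mod 2) φ₀) (α^mod 0)

  π₁-1 : π₁ 1ᴳ ≡ 0#
  π₁-1 = ⟨⟩-δ (0 mod n , 0 mod 2) φ₁

  π₀-x : π₀ xᴳ ≡ α
  π₀-x = trans (⟨⟩-δ (1 mod n , 0 mod 2) φ₀) (trans (α^mod 1) (*-identityʳ α))

  π₁-x : π₁ xᴳ ≡ 0#
  π₁-x = ⟨⟩-δ (1 mod n , 0 mod 2) φ₁

  π₀-y : π₀ yᴳ ≡ 0#
  π₀-y = ⟨⟩-δ (0 mod n , 1 mod 2) φ₀

  π₁-y : π₁ yᴳ ≡ 1#
  π₁-y = trans (⟨⟩-δ (0 mod n , 1 mod 2) φ₁) (α^mod 0)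

  ⟨⟩-0 : ∀ φ → ⟨ 0ᴳ , φ ⟩ ≡ 0#
  ⟨⟩-0 φ = trans (⟨⟩-cong φ (λ g → sym (Fₚ.zeroˡ F.0#))) (trans (⟨⟩-· F.0# 0ᴳ φ) (trans (cong (_* ⟨ 0ᴳ , φ ⟩) hom-0) (zeroˡ _)))

  ⟨⟩-- : ∀ a b φ → ⟨ a -ᴳ b , φ ⟩ ≡ ⟨ a , φ ⟩ + - ⟨ b , φ ⟩
  ⟨⟩-- a b φ = trans (⟨⟩-cong φ (λ g → cong (a g F.+_) (sym (Fₚ.-1*x≈-x (b g)))))
    (trans (⟨⟩-+ a ((F.- F.1#) ·ᴳ b) φ) (cong (⟨ a , φ ⟩ +_)
      (trans (⟨⟩-· (F.- F.1#) b φ) (trans (cong (_* ⟨ b , φ ⟩) (trans (hom-neg F.1#) (cong -_ hom-1))) (-1*x≈-x _)))))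

  π₁-⟦⟧ : ∀ p → π₁ ⟦ p ⟧ ≡ 0#
  π₁-⟦⟧ []      = ⟨⟩-0 φ₁
  π₁-⟦⟧ (c ∷ p) = begin
    π₁ ((c ·ᴳ 1ᴳ) +ᴳ xᴳ ⋆ ⟦ p ⟧)       ≡⟨ ⟨⟩-+ (c ·ᴳ 1ᴳ) (xᴳ ⋆ ⟦ p ⟧) φ₁ ⟩
    π₁ (c ·ᴳ 1ᴳ) + π₁ (xᴳ ⋆ ⟦ p ⟧)     ≡⟨ cong₂ _+_ (trans (⟨⟩-· c 1ᴳ φ₁) (trans (cong (ι c *_) π₁-1) (zeroʳ _)))
                                            (trans (π₁-⋆-scalar xᴳ ⟦ p ⟧ π₁-x) (trans (cong (π₀ xᴳ *_) (π₁-⟦⟧ p)) (zeroʳ _))) ⟩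
    0# + 0#                            ≡⟨ +-identityˡ 0# ⟩
    0#                                 ∎

  π₀-⟦⟧ : ∀ p → π₀ ⟦ p ⟧ ≡ ev α p
  π₀-⟦⟧ []      = ⟨⟩-0 φ₀
  π₀-⟦⟧ (c ∷ p) = begin
    π₀ ((c ·ᴳ 1ᴳ) +ᴳ xᴳ ⋆ ⟦ p ⟧)       ≡⟨ ⟨⟩-+ (c ·ᴳ 1ᴳ) (xᴳ ⋆ ⟦ p ⟧) φ₀ ⟩
    π₀ (c ·ᴳ 1ᴳ) + π₀ (xᴳ ⋆ ⟦ p ⟧)     ≡⟨ cong₂ _+_ (trans (⟨⟩-· c 1ᴳ φ₀) (trans (cong (ι c *_) π₀-1) (*-identityʳ _)))
                                            (trans (π₀-⋆-scalar xᴳ ⟦ p ⟧ π₁-x) (cong₂ _*_ π₀-x (π₀-⟦⟧ p))) ⟩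
    ι c + α * ev α p                   ∎

  private
    ev-tabulate : ∀ {m} (c : Fin m → F.Carrier) → ev α (tabulate c) ≡ sumFinK (λ i → ι (c i) * α ^ toℕ i)
    ev-tabulate {zero}  c = refl
    ev-tabulate {suc m} c = cong₂ _+_ (sym (*-identityʳ _)) (begin
      α * ev α (tabulate c′)                               ≡⟨ cong (α *_) (ev-tabulate c′) ⟩
      α * sumFinK (λ i → ι (c′ i) * α ^ toℕ i)             ≡⟨ sumFin-*ˡ α (λ i → ι (c′ i) * α ^ toℕ i) ⟨
      sumFinK (λ i → α * (ι (c′ i) * α ^ toℕ i))           ≡⟨ sumFin-cong (λ i → *-swap α (ι (c′ i)) (α ^ toℕ i)) ⟩
      sumFinK (λ i → ι (c′ i) * (α * α ^ toℕ i))           ∎)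
      where
      c′ : Fin m → F.Carrier
      c′ i = c (Fin.suc i)

  π₀-component : ∀ a → π₀ a ≡ ev α (component a Fin.zero)
  π₀-component a = trans (Σᴳ-def (λ g → ι (a g) * φ₀ g)) (trans (sumFin-cong {n} row) (sym (ev-tabulate (λ i → a (i , Fin.zero)))))
    where
    row : ∀ i → ι (a (i , Fin.zero)) * α ^ toℕ i + (ι (a (i , Fin.suc Fin.zero)) * 0# + 0#) ≡ ι (a (i , Fin.zero)) * α ^ toℕ i
    row i = trans (cong (ι (a (i , Fin.zero)) * α ^ toℕ i +_) (trans (+-identityʳ _) (zeroʳ _))) (+-identityʳ _)

  π₁-component : ∀ a → π₁ a ≡ ev α (component a (Fin.suc Fin.zero))
  π₁-component a = trans (Σᴳ-def (λ g → ι (a g) * φ₁ g)) (trans (sumFin-cong {n} row) (sym (ev-tabulate (λ i → a (i , Fin.suc Fin.zero)))))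
    where
    row : ∀ i → ι (a (i , Fin.zero)) * 0# + (ι (a (i , Fin.suc Fin.zero)) * α ^ toℕ i + 0#) ≡ ι (a (i , Fin.suc Fin.zero)) * α ^ toℕ i
    row i = trans (cong₂ _+_ (zeroʳ _) (+-identityʳ _)) (+-identityˡ _)

  -- The kernel of π is generated by f, which h annihilates.
  cofactor-kills-kernel : ∀ h → f *ₚ h ≋ X^ n -ₚ 1ₚ → ∀ a → π₀ a ≡ 0# → π₁ a ≡ 0# → ⟦ h ⟧ ⋆ a ≐ 0ᴳ
  cofactor-kills-kernel h fh≋ a e₀ e₁ = R.begin
    ⟦ h ⟧ ⋆ a                                                R.≈⟨ ⋆-cong (≐-refl {⟦ h ⟧}) (decomposition a) ⟩
    ⟦ h ⟧ ⋆ (⟦ c₀ ⟧ ⋆ y^ 0F +ᴳ ⟦ c₁ ⟧ ⋆ y^ 1F)               R.≈⟨ ⋆-distribˡ ⟦ h ⟧ (⟦ c₀ ⟧ ⋆ y^ 0F) (⟦ c₁ ⟧ ⋆ y^ 1F) ⟩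
    ⟦ h ⟧ ⋆ (⟦ c₀ ⟧ ⋆ y^ 0F) +ᴳ ⟦ h ⟧ ⋆ (⟦ c₁ ⟧ ⋆ y^ 1F)     R.≈⟨ +ᴳ-cong (kill c₀ (y^ 0F) (trans (sym (π₀-component a)) e₀)) (kill c₁ (y^ 1F) (trans (sym (π₁-component a)) e₁)) ⟩
    0ᴳ +ᴳ 0ᴳ                                                 R.≈⟨ +ᴳ-identityˡ 0ᴳ ⟩
    0ᴳ                                                       R.∎
    where
    module R = ≐-Reasoning
    0F 1F : Fin 2
    0F = Fin.zero
    1F = Fin.suc Fin.zero
    c₀ c₁ : Pol
    c₀ = component a 0F
    c₁ = component a 1F
    hfm : ∀ p m → p ≋ f *ₚ m → h *ₚ p ≋ (X^ n -ₚ 1ₚ) *ₚ m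
    hfm p m e = ≋-trans (*ₚ-cong (≋-refl {h}) e) (≋-trans (≋-sym (*ₚ-assoc h f m))
      (*ₚ-cong (≋-trans (*ₚ-comm h f) fh≋) (≋-refl {m})))
    kill-root : ∀ p → (∃ λ m → p ≋ f *ₚ m) → ⟦ h ⟧ ⋆ ⟦ p ⟧ ≐ 0ᴳ
    kill-root p (m , e) = R.begin
      ⟦ h ⟧ ⋆ ⟦ p ⟧                R.≈⟨ ⟦⟧-* h p ⟨
      ⟦ h *ₚ p ⟧                   R.≈⟨ ⟦⟧-cong (hfm p m e) ⟩
      ⟦ (X^ n -ₚ 1ₚ) *ₚ m ⟧        R.≈⟨ ⟦⟧-* (X^ n -ₚ 1ₚ) m ⟩
      ⟦ X^ n -ₚ 1ₚ ⟧ ⋆ ⟦ m ⟧       R.≈⟨ ⋆-cong ⟦Xⁿ-1⟧ (≐-refl {⟦ m ⟧}) ⟩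
      0ᴳ ⋆ ⟦ m ⟧                   R.≈⟨ ⋆-zeroˡ ⟦ m ⟧ ⟩
      0ᴳ                           R.∎
    kill : ∀ p b → ev α p ≡ 0# → ⟦ h ⟧ ⋆ (⟦ p ⟧ ⋆ b) ≐ 0ᴳ
    kill p b e = ≐-trans (≐-sym (⋆-assoc ⟦ h ⟧ ⟦ p ⟧ b))
      (≐-trans (⋆-cong (kill-root p (α-minimal p e)) (≐-refl {b})) (⋆-zeroˡ b))

  -- The two idempotents: equations in K and their lift to FG.

  module PrimitiveIdempotents (A h ℓ : Pol) (ninv : F.Carrier) (fh≋ : f *ₚ h ≋ X^ n -ₚ 1ₚ)
    (normalised : ι ninv * ev α (A *ₚ h) ≡ - 1#) (1≤s : 1 ≤ s)
    (ℓ-inverse : (α ^ (s ∸ 1) + - 1#) * ev α ℓ ≡ 1#) where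
    private module R = ≐-Reasoning

    -- Θ is the idempotent of F[x]/(x^n - 1) belonging to f, seen in FG. The unscaled E is kept
    -- apart because the two claimed idempotents start with multiples of it of opposite sign.
    E Θ : FG
    E = ⟦ A *ₚ h ⟧
    Θ = (F.- ninv) ·ᴳ E

    π₀-ninv·E : π₀ (ninv ·ᴳ E) ≡ - 1#
    π₀-ninv·E = trans (⟨⟩-· ninv E φ₀) (trans (cong (ι ninv *_) (π₀-⟦⟧ (A *ₚ h))) normalised)

    π₀-Θ : π₀ Θ ≡ 1#
    π₀-Θ = begin
      π₀ Θ                                 ≡⟨ ⟨⟩-· (F.- ninv) E φ₀ ⟩
      ι (F.- ninv) * π₀ E                  ≡⟨ cong₂ _*_ (hom-neg ninv) (π₀-⟦⟧ (A *ₚ h)) ⟩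
      - ι ninv * ev α (A *ₚ h)             ≡⟨ -‿distribˡ-* (ι ninv) (ev α (A *ₚ h)) ⟨
      - (ι ninv * ev α (A *ₚ h))           ≡⟨ cong -_ normalised ⟩
      - (- 1#)                             ≡⟨ -‿involutive 1# ⟩
      1#                                   ∎

    π₁-·E : ∀ c → π₁ (c ·ᴳ E) ≡ 0#
    π₁-·E c = trans (⟨⟩-· c E φ₁) (trans (cong (ι c *_) (π₁-⟦⟧ (A *ₚ h))) (zeroʳ _))

    E-respects-π : ∀ a b → π₀ a ≡ π₀ b → π₁ a ≡ π₁ b → E ⋆ a ≐ E ⋆ b
    E-respects-π a b e₀ e₁ = mk≐ λ g → Fₚ.x-y≈0⇒x≈y _ _ (at (R.begin
      E ⋆ a -ᴳ E ⋆ b                                R.≈⟨ mk≐ (λ g → cong ((E ⋆ a) g F.+_) (Fₚ.-1*x≈-x _)) ⟨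
      E ⋆ a +ᴳ ((F.- F.1#) ·ᴳ (E ⋆ b))              R.≈⟨ +ᴳ-cong (≐-refl {E ⋆ a}) (⋆-·ᴳ (F.- F.1#) E b) ⟨
      E ⋆ a +ᴳ E ⋆ ((F.- F.1#) ·ᴳ b)                R.≈⟨ ⋆-distribˡ E a ((F.- F.1#) ·ᴳ b) ⟨
      E ⋆ (a +ᴳ ((F.- F.1#) ·ᴳ b))                  R.≈⟨ ⋆-cong (≐-refl {E}) (mk≐ λ g → cong (a g F.+_) (Fₚ.-1*x≈-x (b g))) ⟩
      E ⋆ (a -ᴳ b)                                  R.≈⟨ ⋆-cong (⟦⟧-* A h) (≐-refl {a -ᴳ b}) ⟩
      (⟦ A ⟧ ⋆ ⟦ h ⟧) ⋆ (a -ᴳ b)                    R.≈⟨ ⋆-assoc ⟦ A ⟧ ⟦ h ⟧ (a -ᴳ b) ⟩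
      ⟦ A ⟧ ⋆ (⟦ h ⟧ ⋆ (a -ᴳ b))                    R.≈⟨ ⋆-cong (≐-refl {⟦ A ⟧}) (cofactor-kills-kernel h fh≋ (a -ᴳ b)
                                                        (trans (⟨⟩-- a b φ₀) (x≈y⇒x-y≈0 e₀)) (trans (⟨⟩-- a b φ₁) (x≈y⇒x-y≈0 e₁))) ⟩
      ⟦ A ⟧ ⋆ 0ᴳ                                    R.≈⟨ ⋆-zeroʳ ⟦ A ⟧ ⟩
      0ᴳ                                            R.∎) g)

    -- The scalar moves to the other factor, turning Θ E into E Θ. Since Θ and 1 have the same image
    -- in K ⊕ K y, this equals E 1.
    Θ-⋆-E : Θ ⋆ E ≐ E
    Θ-⋆-E = R.begin
      Θ ⋆ E                        R.≈⟨ ·ᴳ-⋆ (F.- ninv) E E ⟩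
      (F.- ninv) ·ᴳ (E ⋆ E)        R.≈⟨ ⋆-·ᴳ (F.- ninv) E E ⟨
      E ⋆ Θ                        R.≈⟨ E-respects-π Θ 1ᴳ (trans π₀-Θ (sym π₀-1)) (trans (π₁-·E (F.- ninv)) (sym π₁-1)) ⟩
      E ⋆ 1ᴳ                       R.≈⟨ ⋆-identityʳ E ⟩
      E                            R.∎

    Θ-absorbed : ∀ c b → Θ ⋆ ((c ·ᴳ E) ⋆ b) ≐ (c ·ᴳ E) ⋆ b
    Θ-absorbed c b = ≐-trans (≐-sym (⋆-assoc Θ (c ·ᴳ E) b))
      (⋆-cong (≐-trans (⋆-·ᴳ c Θ E) (·ᴳ-cong c Θ-⋆-E)) (≐-refl {b}))

    -- An element fixed by Θ is a scalar multiple of its product with E, and that product depends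
    -- only on the image in K ⊕ K y.
    π-injective : ∀ a b → Θ ⋆ a ≐ a → Θ ⋆ b ≐ b → π₀ a ≡ π₀ b → π₁ a ≡ π₁ b → a ≐ b
    π-injective a b Θa Θb e₀ e₁ = R.begin
      a                             R.≈⟨ Θa ⟨
      Θ ⋆ a                         R.≈⟨ ·ᴳ-⋆ (F.- ninv) E a ⟩
      (F.- ninv) ·ᴳ (E ⋆ a)         R.≈⟨ ·ᴳ-cong (F.- ninv) (E-respects-π a b e₀ e₁) ⟩
      (F.- ninv) ·ᴳ (E ⋆ b)         R.≈⟨ ·ᴳ-⋆ (F.- ninv) E b ⟨
      Θ ⋆ b                         R.≈⟨ Θb ⟩
      b                             R.∎

    z c : Carrier
    z = α ^ (s ∸ 1)
    c = - ev α ℓ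

    α≢0 : ¬ (α ≡ 0#)
    α≢0 = unit-root-≢0 α n αⁿ≡1

    αz≡αˢ : α * z ≡ α ^ s
    αz≡αˢ = cong (α ^_) (ℕₚ.m+[n∸m]≡n 1≤s)

    -- The value of ℓ at α is an inverse of z - 1, which therefore cannot vanish.
    z≢1 : ¬ (z + - 1# ≡ 0#)
    z≢1 e = 0≢1 (trans (sym (zeroˡ _)) (trans (cong (_* ev α ℓ) (sym e)) ℓ-inverse))

    -- As z = t(α)/α and t is an involution, t(z) = α/t(α) is the inverse of z.
    ztz≡1 : z * t z ≡ 1#
    ztz≡1 = *-cancelˡ α α≢0 (begin
      α * (z * t z)                 ≡⟨ *-assoc α z (t z) ⟨
      α * z * t z                   ≡⟨ cong₂ _*_ αz≡αˢ (trans (t-^ α (s ∸ 1)) (cong (_^ (s ∸ 1)) t-α)) ⟩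
      α ^ s * (α ^ s) ^ (s ∸ 1)     ≡⟨ cong ((α ^ s) ^_) (ℕₚ.m+[n∸m]≡n 1≤s) ⟩
      (α ^ s) ^ s                   ≡⟨ αˢˢ≡α ⟩
      α                             ≡⟨ *-identityʳ α ⟨
      α * 1#                        ∎)

    -- The congruence (z - 1) ℓ(α) = 1 in terms of c = -ℓ(α), that is c = 1/(1 - z), written without
    -- division so that t can be applied to it.
    c-eq : c ≡ 1# + z * c
    c-eq = +-cancelˡ (- (z * c)) _ _ (begin
      - (z * c) + c                             ≡⟨ cong₂ _+_ (trans (cong -_ (sym (-‿distribʳ-* z (ev α ℓ)))) (-‿involutive _)) (sym (-1*x≈-x _)) ⟩
      z * ev α ℓ + - 1# * ev α ℓ                ≡⟨ distribʳ (ev α ℓ) z (- 1#) ⟨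
      (z + - 1#) * ev α ℓ                       ≡⟨ ℓ-inverse ⟩
      1#                                        ≡⟨ +-identityʳ 1# ⟨
      1# + 0#                                   ≡⟨ cong (1# +_) (-‿inverseˡ (z * c)) ⟨
      1# + (- (z * c) + z * c)                  ≡⟨ +-swap 1# (- (z * c)) (z * c) ⟩
      - (z * c) + (1# + z * c)                  ∎)

    -- Apply t to `c-eq` and multiply by z; the factor z t(z) is 1.
    tc-eq : z * t c ≡ z + t c
    tc-eq = begin
      z * t c                  ≡⟨ cong (λ v → z * t v) c-eq ⟩
      z * t (1# + z * c)       ≡⟨ cong (z *_) (trans (t-+ 1# (z * c)) (cong₂ _+_ t-1 (t-* z c))) ⟩
      z * (1# + t z * t c)     ≡⟨ distribˡ z 1# (t z * t c) ⟩
      z * 1# + z * (t z * t c) ≡⟨ cong₂ _+_ (*-identityʳ z) (trans (sym (*-assoc z (t z) (t c))) (trans (cong (_* t c) ztz≡1) (*-identityˡ (t c)))) ⟩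
      z + t c                  ∎

    -- (z − 1)(c + t c) = z − 1, where c = 1 + z c and z t c = z + t c.
    trace-c : c + t c ≡ 1#
    trace-c = *-cancelˡ (z + - 1#) z≢1 (begin
      (z + - 1#) * (c + t c)                       ≡⟨ distribʳ (c + t c) z (- 1#) ⟩
      z * (c + t c) + - 1# * (c + t c)             ≡⟨ cong₂ _+_ (trans (distribˡ z c (t c)) (cong (z * c +_) tc-eq)) (-1*x≈-x _) ⟩
      z * c + (z + t c) + - (c + t c)              ≡⟨ cong (λ v → z * c + (z + t c) + - (v + t c)) c-eq ⟩
      z * c + (z + t c) + - (1# + z * c + t c)     ≡⟨ cong₂ _+_ (+-swap (z * c) z (t c)) (trans (cong -_ (+-assoc 1# (z * c) (t c))) (sym (-‿+-comm 1# (z * c + t c)))) ⟩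
      z + (z * c + t c) + (- 1# + - (z * c + t c)) ≡⟨ +-interchange z (z * c + t c) (- 1#) (- (z * c + t c)) ⟩
      z + - 1# + (z * c + t c + - (z * c + t c))   ≡⟨ cong (z + - 1# +_) (-‿inverseʳ _) ⟩
      z + - 1# + 0#                                ≡⟨ +-identityʳ _ ⟩
      z + - 1#                                     ≡⟨ *-identityʳ _ ⟨
      (z + - 1#) * 1#                              ∎)

    c≢0 : ¬ (c ≡ 0#)
    c≢0 e = 0≢1 (begin
      0#           ≡⟨ e ⟨
      c            ≡⟨ c-eq ⟩
      1# + z * c   ≡⟨ cong (λ v → 1# + z * v) e ⟩
      1# + z * 0#  ≡⟨ cong (1# +_) (zeroʳ z) ⟩
      1# + 0#      ≡⟨ +-identityʳ 1# ⟩
      1#           ∎)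

    -- The equations e g = g e = g = g² for e = p + q y and g = a + b y in the skew algebra.
    record UnderIdempotent (p q a b : Carrier) : Set where
      field
        eg₀ : p * a + q * t b ≡ a
        eg₁ : p * b + q * t a ≡ b
        ge₀ : a * p + b * t q ≡ a
        ge₁ : a * q + b * t p ≡ b
        gg₀ : a * a + b * t b ≡ a

    -- If e = e₁ + e₂ with orthogonal idempotents, then e e₁ = e₁ e = e₁, so Θ fixes e₁ along with
    -- e. The dichotomy for the image of e₁ therefore lifts to FG: either e₁ = 0, or e₁ = e and e₂ =
    -- 0. That q is nonzero gives both e ≠ 0 and non-centrality.
    primitive-criterion : ∀ e p q → Θ ⋆ e ≐ e → π₀ e ≡ p → π₁ e ≡ q → ¬ (q ≡ 0#) →
      p * p + q * t q ≡ p → p * q + q * t p ≡ q →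
      (∀ a b → UnderIdempotent p q a b → (a ≡ 0# × b ≡ 0#) ⊎ (a ≡ p × b ≡ q)) →
      IsPrimitiveIdempotent e × ¬ IsCentral e
    primitive-criterion e p q Θe refl refl q≢0 idem₀ idem₁ dichotomy =
      (at idempotent , nonzero , indecomposable) , non-central
      where
      idempotent : e ⋆ e ≐ e
      idempotent = π-injective (e ⋆ e) e (≐-trans (≐-sym (⋆-assoc Θ e e)) (⋆-cong Θe (≐-refl {e}))) Θe
        (trans (π₀-⋆ e e) idem₀) (trans (π₁-⋆ e e) idem₁)

      nonzero : ¬ (e ≈ᴳ 0ᴳ)
      nonzero e≈0 = q≢0 (trans (⟨⟩-cong φ₁ e≈0) (⟨⟩-0 φ₁))

      -- The y-components of e x and x e are q t(α) = q α z and q α. As q and α are nonzero,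
      -- equality would force z = 1.
      non-central : ¬ IsCentral e
      non-central central = z≢1 (x≈y⇒x-y≈0 (*-cancelˡ α α≢0 (*-cancelˡ q q≢0 (begin
        q * (α * z)                          ≡⟨ cong (q *_) (trans αz≡αˢ (trans (sym t-α) (cong t (sym π₀-x)))) ⟩
        q * t (π₀ xᴳ)                        ≡⟨ +-identityˡ _ ⟨
        0# + q * t (π₀ xᴳ)                   ≡⟨ cong (_+ q * t (π₀ xᴳ)) (trans (cong (p *_) π₁-x) (zeroʳ p)) ⟨
        p * π₁ xᴳ + q * t (π₀ xᴳ)            ≡⟨ π₁-⋆ e xᴳ ⟨
        π₁ (e ⋆ xᴳ)                          ≡⟨ ⟨⟩-cong φ₁ (central xᴳ) ⟩
        π₁ (xᴳ ⋆ e)                          ≡⟨ π₁-⋆-scalar xᴳ e π₁-x ⟩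
        π₀ xᴳ * q                            ≡⟨ trans (cong (_* q) π₀-x) (*-comm α q) ⟩
        q * α                                ≡⟨ cong (q *_) (*-identityʳ α) ⟨
        q * (α * 1#)                         ∎))))

      indecomposable : ∀ e₁ e₂ → IsIdempotent e₁ → IsIdempotent e₂ →
        e₁ ⋆ e₂ ≈ᴳ 0ᴳ → e₂ ⋆ e₁ ≈ᴳ 0ᴳ → e ≈ᴳ e₁ +ᴳ e₂ → e₁ ≈ᴳ 0ᴳ ⊎ e₂ ≈ᴳ 0ᴳ
      indecomposable e₁ e₂ idem₁ _ e₁e₂ e₂e₁ e≈ = conclude (dichotomy (π₀ e₁) (π₁ e₁) (record
        { eg₀ = trans (sym (π₀-⋆ e e₁)) (⟨⟩-cong φ₀ (at ee₁))
        ; eg₁ = trans (sym (π₁-⋆ e e₁)) (⟨⟩-cong φ₁ (at ee₁))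
        ; ge₀ = trans (sym (π₀-⋆ e₁ e)) (⟨⟩-cong φ₀ (at e₁e))
        ; ge₁ = trans (sym (π₁-⋆ e₁ e)) (⟨⟩-cong φ₁ (at e₁e))
        ; gg₀ = trans (sym (π₀-⋆ e₁ e₁)) (⟨⟩-cong φ₀ idem₁) }))
        where
        ee₁ : e ⋆ e₁ ≐ e₁
        ee₁ = R.begin
          e ⋆ e₁                  R.≈⟨ ⋆-cong (mk≐ e≈) (≐-refl {e₁}) ⟩
          (e₁ +ᴳ e₂) ⋆ e₁         R.≈⟨ ⋆-distribʳ e₁ e₂ e₁ ⟩
          e₁ ⋆ e₁ +ᴳ e₂ ⋆ e₁      R.≈⟨ +ᴳ-cong (mk≐ idem₁) (mk≐ e₂e₁) ⟩
          e₁ +ᴳ 0ᴳ                R.≈⟨ +ᴳ-identityʳ e₁ ⟩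
          e₁                      R.∎
        e₁e : e₁ ⋆ e ≐ e₁
        e₁e = R.begin
          e₁ ⋆ e                  R.≈⟨ ⋆-cong (≐-refl {e₁}) (mk≐ e≈) ⟩
          e₁ ⋆ (e₁ +ᴳ e₂)         R.≈⟨ ⋆-distribˡ e₁ e₁ e₂ ⟩
          e₁ ⋆ e₁ +ᴳ e₁ ⋆ e₂      R.≈⟨ +ᴳ-cong (mk≐ idem₁) (mk≐ e₁e₂) ⟩
          e₁ +ᴳ 0ᴳ                R.≈⟨ +ᴳ-identityʳ e₁ ⟩
          e₁                      R.∎
        Θe₁ : Θ ⋆ e₁ ≐ e₁
        Θe₁ = R.begin
          Θ ⋆ e₁                  R.≈⟨ ⋆-cong (≐-refl {Θ}) ee₁ ⟨
          Θ ⋆ (e ⋆ e₁)            R.≈⟨ ⋆-assoc Θ e e₁ ⟨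
          (Θ ⋆ e) ⋆ e₁            R.≈⟨ ⋆-cong Θe (≐-refl {e₁}) ⟩
          e ⋆ e₁                  R.≈⟨ ee₁ ⟩
          e₁                      R.∎
        conclude : (π₀ e₁ ≡ 0# × π₁ e₁ ≡ 0#) ⊎ (π₀ e₁ ≡ p × π₁ e₁ ≡ q) → e₁ ≈ᴳ 0ᴳ ⊎ e₂ ≈ᴳ 0ᴳ
        conclude (inj₁ (a≡0 , b≡0)) = inj₁ (at (π-injective e₁ 0ᴳ Θe₁ (⋆-zeroʳ Θ)
          (trans a≡0 (sym (⟨⟩-0 φ₀))) (trans b≡0 (sym (⟨⟩-0 φ₁)))))
        conclude (inj₂ (a≡p , b≡q)) = inj₂ λ g → Fₚ.+-cancelˡ (e₁ g) (e₂ g) F.0#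
          (trans (sym (e≈ g)) (trans (sym (at (π-injective e₁ e Θe₁ Θe a≡p b≡q) g)) (sym (Fₚ.+-identityʳ (e₁ g)))))

    private
      neg*neg : ∀ x y → - x * - y ≡ x * y
      neg*neg x y = trans (sym (-‿distribˡ-* x (- y))) (trans (cong -_ (sym (-‿distribʳ-* x y))) (-‿involutive (x * y)))

      idempotent-scalar : ∀ a → a * (a + t a) ≡ a → a ≡ 0# ⊎ a + t a ≡ 1#
      idempotent-scalar a e with a ≟ 0#
      ... | yes a≡0 = inj₁ a≡0
      ... | no a≢0  = inj₂ (*-cancelˡ a a≢0 (trans e (sym (*-identityʳ a))))

    -- Since e₂ = c (1 - y), an element g = g e₂ is a left multiple of 1 - y, so b = -a. Then g² = g
    -- gives a (a + t(a)) = a, and e₂ g = g gives a = c (a + t(a)).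
    dichotomy₂ : ∀ a b → UnderIdempotent c (- c) a b → (a ≡ 0# × b ≡ 0#) ⊎ (a ≡ c × b ≡ - c)
    dichotomy₂ a b under = finish (idempotent-scalar a (begin
        a * (a + t a)          ≡⟨ distribˡ a a (t a) ⟩
        a * a + a * t a        ≡⟨ cong (a * a +_) (neg*neg a (t a)) ⟨
        a * a + - a * - t a    ≡⟨ cong (a * a +_) (cong₂ _*_ (sym b≡-a) (trans (sym (t-neg a)) (cong t (sym b≡-a)))) ⟩
        a * a + b * t b        ≡⟨ gg₀ ⟩
        a                      ∎))
      where
      open UnderIdempotent under
      b≡-a : b ≡ - a
      b≡-a = begin
        b                               ≡⟨ ge₁ ⟨
        a * - c + b * t c               ≡⟨ cong₂ _+_ (-‿distribʳ-* a c) (-‿involutive (b * t c)) ⟨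
        - (a * c) + - (- (b * t c))     ≡⟨ -‿+-comm (a * c) (- (b * t c)) ⟩
        - (a * c + - (b * t c))         ≡⟨ cong (λ v → - (a * c + v)) (trans (-‿distribʳ-* b (t c)) (cong (b *_) (sym (t-neg c)))) ⟩
        - (a * c + b * t (- c))         ≡⟨ cong -_ ge₀ ⟩
        - a                             ∎
      a≡c : a + t a ≡ 1# → a ≡ c
      a≡c trace = begin
        a                        ≡⟨ eg₀ ⟨
        c * a + - c * t b        ≡⟨ cong (λ v → c * a + - c * v) (trans (cong t b≡-a) (t-neg a)) ⟩
        c * a + - c * - t a      ≡⟨ cong (c * a +_) (neg*neg c (t a)) ⟩
        c * a + c * t a          ≡⟨ distribˡ c a (t a) ⟨
        c * (a + t a)            ≡⟨ cong (c *_) trace ⟩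
        c * 1#                   ≡⟨ *-identityʳ c ⟩
        c                        ∎
      finish : a ≡ 0# ⊎ a + t a ≡ 1# → (a ≡ 0# × b ≡ 0#) ⊎ (a ≡ c × b ≡ - c)
      finish (inj₁ a≡0)   = inj₁ (a≡0 , trans b≡-a (trans (cong -_ a≡0) -0#≈0#))
      finish (inj₂ trace) = inj₂ (a≡c trace , trans b≡-a (cong -_ (a≡c trace)))

    -- The mirror image: e₁ = (1 + y) t(c), so g = e₁ g is a right multiple of 1 + y, and (1 + y) a
    -- = a + t(a) y gives b = t(a). The final value of a now comes from g e₁ = g, which reads a = (a
    -- + t(a)) t(c).
    dichotomy₁ : ∀ a b → UnderIdempotent (t c) c a b → (a ≡ 0# × b ≡ 0#) ⊎ (a ≡ t c × b ≡ c)
    dichotomy₁ a b under = finish (idempotent-scalar a (begin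
        a * (a + t a)          ≡⟨ distribˡ a a (t a) ⟩
        a * a + a * t a        ≡⟨ cong (a * a +_) (*-comm a (t a)) ⟩
        a * a + t a * a        ≡⟨ cong (a * a +_) (cong₂ _*_ (sym b≡ta) (trans (sym (t-involutive a)) (cong t (sym b≡ta)))) ⟩
        a * a + b * t b        ≡⟨ gg₀ ⟩
        a                      ∎))
      where
      open UnderIdempotent under
      b≡ta : b ≡ t a
      b≡ta = begin
        b                                    ≡⟨ eg₁ ⟨
        t c * b + c * t a                    ≡⟨ +-comm (t c * b) (c * t a) ⟩
        c * t a + t c * b                    ≡⟨ cong₂ (λ x y → x * t a + t c * y) (t-involutive c) (t-involutive b) ⟨
        t (t c) * t a + t c * t (t b)        ≡⟨ cong₂ _+_ (t-* (t c) a) (t-* c (t b)) ⟨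
        t (t c * a) + t (c * t b)            ≡⟨ t-+ (t c * a) (c * t b) ⟨
        t (t c * a + c * t b)                ≡⟨ cong t eg₀ ⟩
        t a                                  ∎
      a≡tc : a + t a ≡ 1# → a ≡ t c
      a≡tc trace = begin
        a                        ≡⟨ ge₀ ⟨
        a * t c + b * t c        ≡⟨ distribʳ (t c) a b ⟨
        (a + b) * t c            ≡⟨ cong (λ v → (a + v) * t c) b≡ta ⟩
        (a + t a) * t c          ≡⟨ cong (_* t c) trace ⟩
        1# * t c                 ≡⟨ *-identityˡ (t c) ⟩
        t c                      ∎
      finish : a ≡ 0# ⊎ a + t a ≡ 1# → (a ≡ 0# × b ≡ 0#) ⊎ (a ≡ t c × b ≡ c)
      finish (inj₁ a≡0)   = inj₁ (a≡0 , trans b≡ta (trans (cong t a≡0) t-0))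
      finish (inj₂ trace) = inj₂ (a≡tc trace , trans b≡ta (trans (cong t (a≡tc trace)) (t-involutive c)))

    u e₁ e₂ : FG
    u  = ⟦ ℓ ⟧ ⋆ (1ᴳ -ᴳ yᴳ)
    e₁ = Θ ⋆ (u +ᴳ 1ᴳ)
    e₂ = (ninv ·ᴳ E) ⋆ u

    π₀-u : π₀ u ≡ ev α ℓ
    π₀-u = begin
      π₀ u                                   ≡⟨ π₀-⋆-scalar ⟦ ℓ ⟧ (1ᴳ -ᴳ yᴳ) (π₁-⟦⟧ ℓ) ⟩
      π₀ ⟦ ℓ ⟧ * π₀ (1ᴳ -ᴳ yᴳ)               ≡⟨ cong₂ _*_ (π₀-⟦⟧ ℓ) (trans (⟨⟩-- 1ᴳ yᴳ φ₀) (cong₂ (λ x y → x + - y) π₀-1 π₀-y)) ⟩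
      ev α ℓ * (1# + - 0#)                   ≡⟨ cong (ev α ℓ *_) (trans (cong (1# +_) -0#≈0#) (+-identityʳ 1#)) ⟩
      ev α ℓ * 1#                            ≡⟨ *-identityʳ _ ⟩
      ev α ℓ                                 ∎

    π₁-u : π₁ u ≡ c
    π₁-u = begin
      π₁ u                                   ≡⟨ π₁-⋆-scalar ⟦ ℓ ⟧ (1ᴳ -ᴳ yᴳ) (π₁-⟦⟧ ℓ) ⟩
      π₀ ⟦ ℓ ⟧ * π₁ (1ᴳ -ᴳ yᴳ)               ≡⟨ cong₂ _*_ (π₀-⟦⟧ ℓ) (trans (⟨⟩-- 1ᴳ yᴳ φ₁) (cong₂ (λ x y → x + - y) π₁-1 π₁-y)) ⟩
      ev α ℓ * (0# + - 1#)                   ≡⟨ cong (ev α ℓ *_) (+-identityˡ (- 1#)) ⟩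
      ev α ℓ * - 1#                          ≡⟨ trans (*-comm _ _) (-1*x≈-x _) ⟩
      c                                      ∎

    π₀-e₁ : π₀ e₁ ≡ t c
    π₀-e₁ = begin
      π₀ e₁                       ≡⟨ π₀-⋆-scalar Θ (u +ᴳ 1ᴳ) (π₁-·E (F.- ninv)) ⟩
      π₀ Θ * π₀ (u +ᴳ 1ᴳ)         ≡⟨ cong₂ _*_ π₀-Θ (trans (⟨⟩-+ u 1ᴳ φ₀) (cong₂ _+_ π₀-u π₀-1)) ⟩
      1# * (ev α ℓ + 1#)          ≡⟨ *-identityˡ _ ⟩
      -- This is 1 - c; replacing 1 by c + t(c) leaves t(c).
      ev α ℓ + 1#                 ≡⟨ cong (ev α ℓ +_) trace-c ⟨
      ev α ℓ + (c + t c)          ≡⟨ +-assoc (ev α ℓ) c (t c) ⟨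
      ev α ℓ + c + t c            ≡⟨ cong (_+ t c) (-‿inverseʳ (ev α ℓ)) ⟩
      0# + t c                    ≡⟨ +-identityˡ (t c) ⟩
      t c                         ∎

    π₁-e₁ : π₁ e₁ ≡ c
    π₁-e₁ = begin
      π₁ e₁                       ≡⟨ π₁-⋆-scalar Θ (u +ᴳ 1ᴳ) (π₁-·E (F.- ninv)) ⟩
      π₀ Θ * π₁ (u +ᴳ 1ᴳ)         ≡⟨ cong₂ _*_ π₀-Θ (trans (⟨⟩-+ u 1ᴳ φ₁) (cong₂ _+_ π₁-u π₁-1)) ⟩
      1# * (c + 0#)               ≡⟨ trans (*-identityˡ _) (+-identityʳ c) ⟩
      c                           ∎

    π₀-e₂ : π₀ e₂ ≡ c
    π₀-e₂ = begin
      π₀ e₂                       ≡⟨ π₀-⋆-scalar (ninv ·ᴳ E) u (π₁-·E ninv) ⟩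
      π₀ (ninv ·ᴳ E) * π₀ u       ≡⟨ cong₂ _*_ π₀-ninv·E π₀-u ⟩
      - 1# * ev α ℓ               ≡⟨ -1*x≈-x (ev α ℓ) ⟩
      c                           ∎

    π₁-e₂ : π₁ e₂ ≡ - c
    π₁-e₂ = begin
      π₁ e₂                       ≡⟨ π₁-⋆-scalar (ninv ·ᴳ E) u (π₁-·E ninv) ⟩
      π₀ (ninv ·ᴳ E) * π₁ u       ≡⟨ cong₂ _*_ π₀-ninv·E π₁-u ⟩
      - 1# * c                    ≡⟨ -1*x≈-x c ⟩
      - c                         ∎

    private
      -- All four idempotency equations are instances: x = t(c) and x = c for the first element, x =
      -- c and x = -c for the second.
      by-trace : ∀ x → x * c + x * t c ≡ x
      by-trace x = trans (sym (distribˡ x c (t c))) (trans (cong (x *_) trace-c) (*-identityʳ x))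

    e₁-primitive : IsPrimitiveIdempotent e₁ × ¬ IsCentral e₁
    e₁-primitive = primitive-criterion e₁ (t c) c (Θ-absorbed (F.- ninv) (u +ᴳ 1ᴳ)) π₀-e₁ π₁-e₁ c≢0
      (trans (+-comm (t c * t c) (c * t c)) (trans (cong (_+ t c * t c) (*-comm c (t c))) (by-trace (t c))))
      (trans (cong₂ (λ x y → x + c * y) (*-comm (t c) c) (t-involutive c)) (trans (+-comm (c * t c) (c * c)) (by-trace c)))
      dichotomy₁

    e₂-primitive : IsPrimitiveIdempotent e₂ × ¬ IsCentral e₂
    e₂-primitive = primitive-criterion e₂ c (- c) (Θ-absorbed ninv u) π₀-e₂ π₁-e₂
      (λ e → c≢0 (trans (sym (-‿involutive c)) (trans (cong -_ e) -0#≈0#)))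
      (trans (cong (c * c +_) (trans (cong (- c *_) (t-neg c)) (neg*neg c (t c)))) (by-trace c))
      (trans (cong (_+ - c * t c) (*-comm c (- c))) (by-trace (- c)))
      dichotomy₂

-- Values at a root of f: the origin of the factor -1/n.

module RootEquations (F K : FiniteField) (ι : FiniteField.Carrier F → FiniteField.Carrier K) (hom : IsFieldHom F K ι)
  (f h : Poly.Pol F) (n : ℕ) (α : FiniteField.Carrier K)
  (fh≋ : PolyProperties._≋_ F (Poly._*ₚ_ F f h) (Poly._-ₚ_ F (Poly.X^ F n) (Poly.1ₚ F)))
  (root : Evaluation.ev F K ι hom α f ≡ FiniteField.0# K) where
  private module F = FiniteField F
  open FiniteField K
  open FieldProperties K
  open Poly F using (Pol; _+ₚ_; _*ₚ_; _·ₚ_; X^; 1ₚ; coeff; rev; deriv)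
  open PolyProperties F
  open EulerOperator F
  open Evaluation F K ι hom
  open ≡-Reasoning

  ev-f* : ∀ m → ev α (f *ₚ m) ≡ 0#
  ev-f* m = trans (ev-* α f m) (trans (cong (_* ev α m) root) (zeroˡ _))

  αⁿ≡1 : α ^ n ≡ 1#
  αⁿ≡1 = x-y≈0⇒x≈y (α ^ n) 1# (trans (sym (ev-[Xᵏ-1] α n)) (trans (sym (ev-cong α fh≋)) (ev-f* h)))

  inverse-at-root : ∀ p ℓ m → p *ₚ ℓ ≋ 1ₚ +ₚ f *ₚ m → ev α p * ev α ℓ ≡ 1#
  inverse-at-root p ℓ m e = begin
    ev α p * ev α ℓ              ≡⟨ ev-* α p ℓ ⟨
    ev α (p *ₚ ℓ)                ≡⟨ ev-cong α e ⟩
    ev α (1ₚ +ₚ f *ₚ m)          ≡⟨ ev-+ α 1ₚ (f *ₚ m) ⟩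
    ev α 1ₚ + ev α (f *ₚ m)      ≡⟨ cong₂ _+_ (ev-1 α) (ev-f* m) ⟩
    1# + 0#                      ≡⟨ +-identityʳ 1# ⟩
    1#                           ∎

  -- Apply x d/dx to f h = x^n - 1 and evaluate at α: the term with f drops out, and n α^n = n
  -- remains.
  Df-h : ev α (D f) * ev α h ≡ ι (F.fromℕ n)
  Df-h = begin
    ev α (D f) * ev α h                          ≡⟨ ev-* α (D f) h ⟨
    ev α (D f *ₚ h)                              ≡⟨ +-identityʳ _ ⟨
    ev α (D f *ₚ h) + 0#                         ≡⟨ cong (ev α (D f *ₚ h) +_) (ev-f* (D h)) ⟨
    ev α (D f *ₚ h) + ev α (f *ₚ D h)            ≡⟨ ev-+ α (D f *ₚ h) (f *ₚ D h) ⟨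
    ev α (D f *ₚ h +ₚ f *ₚ D h)                  ≡⟨ ev-cong α (D-* f h) ⟨
    ev α (D (f *ₚ h))                            ≡⟨ ev-cong α (≋-trans (D-cong fh≋) (D-[Xⁿ-1] n)) ⟩
    ev α (F.fromℕ n ·ₚ X^ n)                     ≡⟨ ev-· α (F.fromℕ n) (X^ n) ⟩
    ι (F.fromℕ n) * ev α (X^ n)                  ≡⟨ cong (ι (F.fromℕ n) *_) (trans (ev-X^ α n) αⁿ≡1) ⟩
    ι (F.fromℕ n) * 1#                           ≡⟨ *-identityʳ _ ⟩
    ι (F.fromℕ n)                                ∎

  -- At the root, (deg f) f - x f′ takes the value -α f′(α), so its product with h(α) is -n by
  -- `Df-h`. Multiplication by 1/n gives -1, and by -1/n gives 1.
  normalised : ∀ k → 1 ≤ k → (∀ i → k < i → coeff f i ≡ F.0#) → ∀ ninv → ninv F.* F.fromℕ n ≡ F.1# →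
    ι ninv * ev α (rev (k ∸ 1) (deriv (rev k f)) *ₚ h) ≡ - 1#
  normalised k 1≤k above ninv e = begin
    ι ninv * ev α (A *ₚ h)             ≡⟨ cong (ι ninv *_) (trans (ev-* α A h) (cong (_* ev α h) A≡-Df)) ⟩
    ι ninv * (- ev α (D f) * ev α h)   ≡⟨ cong (ι ninv *_) (trans (sym (-‿distribˡ-* _ _)) (cong -_ Df-h)) ⟩
    ι ninv * - ι (F.fromℕ n)           ≡⟨ -‿distribʳ-* _ _ ⟨
    - (ι ninv * ι (F.fromℕ n))         ≡⟨ cong -_ (trans (sym (hom-* ninv (F.fromℕ n))) (trans (cong ι e) hom-1)) ⟩
    - 1#                               ∎
    where
    A : Pol
    A = rev (k ∸ 1) (deriv (rev k f))
    A≡-Df : ev α A ≡ - ev α (D f)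
    A≡-Df = +-inverseˡ-unique (ev α A) (ev α (D f)) (begin
      ev α A + ev α (D f)              ≡⟨ ev-+ α A (D f) ⟨
      ev α (A +ₚ D f)                  ≡⟨ ev-cong α (reciprocal-derivative f k 1≤k above) ⟩
      ev α (F.fromℕ k ·ₚ f)            ≡⟨ ev-· α (F.fromℕ k) f ⟩
      ι (F.fromℕ k) * ev α f           ≡⟨ trans (cong (ι (F.fromℕ k) *_) root) (zeroʳ _) ⟩
      0#                               ∎)

-- The theorem, with K the residues modulo f and α the class of x.

monic-top : ∀ F f → Poly.Monic F f → PolyDegree.Top F f (Poly.deg F f) (FiniteField.1# F)
monic-top F f monic with PolyDegree.deg-spec F f
... | inj₁ f≋0 = ⊥-elim (FiniteField.0≢1 F (trans (sym (PolyProperties.at f≋0 (Poly.deg F f))) monic))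
... | inj₂ ((_ , above) , _) = monic , above

-- Here `ninv` is 1/n and `h` is (x^n - 1)/f, each given by its defining equation, and `A` is
-- ((f*)′)* with the outer reciprocal taken in degree deg f - 1.
theorem6p1 :
  (F : FiniteField) (n s : ℕ) .{{_ : NonZero n}} →
  let open FiniteField F
      open Poly F
      open GroupAlgebra F n s
      d = gcd n (s ∸ 1)
  in
  IsPrimePower size →
  1 ≤ s →
  (s *ℕ s) % n ≡ 1 % n →
  gcd (2 *ℕ n) size ≡ 1 →
  ∀ (f : Pol) → Monic f → Irreducible f →
  (∃ λ g → f *ₚ g *ₚ (X^ d -ₚ 1ₚ) ≈ₚ X^ n -ₚ 1ₚ) →
  SelfInvolutive F s f →
  ∀ (ℓ : Pol) → (∃ λ m → (X^ (s ∸ 1) -ₚ 1ₚ) *ₚ ℓ ≈ₚ 1ₚ +ₚ f *ₚ m) →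
  ∀ (ninv : Carrier) → ninv * fromℕ n ≡ 1# →
  ∀ (h : Pol) → f *ₚ h ≈ₚ X^ n -ₚ 1ₚ →
  let A  = rev (deg f ∸ 1) (deriv (rev (deg f) f))
      E  = ⟦ A *ₚ h ⟧
      e₁ = ((- ninv) ·ᴳ E) ⋆ (⟦ ℓ ⟧ ⋆ (1ᴳ -ᴳ yᴳ) +ᴳ 1ᴳ)
      e₂ = (ninv ·ᴳ E) ⋆ (⟦ ℓ ⟧ ⋆ (1ᴳ -ᴳ yᴳ))
  in (IsPrimitiveIdempotent e₁ × ¬ IsCentral e₁) ×
     (IsPrimitiveIdempotent e₂ × ¬ IsCentral e₂)
theorem6p1 F n s _ 1≤s s²≡1 _ f monic irr _ self ℓ (m , ℓ-inverse) ninv ninv-inverse h fh≈ =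
  e₁-primitive , e₂-primitive
  where
  f-top : PolyDegree.Top F f (Poly.deg F f) (FiniteField.1# F)
  f-top = monic-top F f monic
  open QuotientField F f f-top irr using (K; ι; ι-hom; α; α-root; α-surjective; α-minimal)
  open RootEquations F K ι ι-hom f h n α (PolyProperties.mk≋ fh≈) α-root
  open SelfInvolutiveRoot F K ι ι-hom f α α-minimal f-top using (αˢ-root)
  open SkewRepresentation F K ι ι-hom f α α-surjective α-minimal n s s²≡1 αⁿ≡1
    (αˢ-root n s (FieldProperties.unit-root-≢0 K α n αⁿ≡1) αⁿ≡1 α-root self)
  open PrimitiveIdempotents (Poly.rev F (Poly.deg F f ∸ 1) (Poly.deriv F (Poly.rev F (Poly.deg F f) f))) h ℓ ninv
    (PolyProperties.mk≋ fh≈)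
    (normalised (Poly.deg F f) (proj₁ irr) (proj₂ f-top) ninv ninv-inverse)
    1≤s
    (trans (cong (λ v → FiniteField._*_ K v (Evaluation.ev F K ι ι-hom α ℓ)) (sym (Evaluation.ev-[Xᵏ-1] F K ι ι-hom α (s ∸ 1))))
      (inverse-at-root (Poly._-ₚ_ F (Poly.X^ F (s ∸ 1)) (Poly.1ₚ F)) ℓ m (PolyProperties.mk≋ ℓ-inverse)))
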